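{- Let $f_t=\prod_{n\ge 1}(1-q^{nt})$ and define integers $p_j(n)$ by $f_1^{j}=\sum_{n\ge0}p_j(n)q^n$. Let $C_k(\beta)$ and $D_{k,i}(\beta)$ ($1\le k\le 8$, $1\le i\le\lfloor k/3\rfloor$, $\beta\ge 0$) be the integer sequences which, for each fixed $k$ (and $i$), all satisfy the recurrence $$s(\beta+4)=h(k)\,s(\beta+2)+r(k)\,s(\beta)\qquad(\beta\ge 0),$$ with the following coefficients and initial values $(s(0),s(1),s(2),s(3))$: - $k=1$: $h=-3$, $r=0$; $C_1:(1,-3,-3,9)$. - $k=2$: $h=3^2$, $r=0$; $C_2:(1,9,9,81)$. - $k=3$: $h=-2^2\cdot 3$, $r=-3^7$; $C_3:(1,0,-12,-2187)$; $D_{3,1}:(0,1,-243,-12)$. - $k=4$: $h=-2\cdot3^2\cdot19$, $r=-3^{10}$; $C_4:(1,-243,-99,24057)$; $D_{4,1}:(0,-12,2916,4104)$. - $k=5$: $h=2^2\cdot3^3\cdot17$, $r=-3^{13}$; $C_5:(1,2187,1107,2421009)$; $D_{5,1}:(0,90,-21870,165240)$. - $k=6$: $h=-2\cdot3^2\cdot17\cdot23$, $r=-3^{16}$; $C_6:(1,-13122,-7038,49305915)$; $D_{6,1}:(0,-486,118098,3420468)$; $D_{6,2}:(0,1,-177147,-7038)$. - $k=7$: $h=2^2\cdot3^3\cdot491$, $r=-3^{19}$; $C_7:(1,59049,33345,1968988905)$; $D_{7,1}:(0,1701,-413343,90200628)$; $D_{7,2}:(0,-21,3720087,-1113588)$.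 - $k=8$: $h=-2\cdot3^4\cdot5\cdot359$, $r=-3^{22}$; $C_8:(1,-177147,-113643,20131516521)$; $D_{8,1}:(0,0,0,0)$; $D_{8,2}:(0,252,-44641044,-73279080)$. Then for every $\beta\ge0$ and $1\le k\le 8$, as formal Laurent series in $q$, $$\sum_{n=0}^\infty p_{3k}\Big(3^{2\beta}n+\frac{k(3^{2\beta}-1)}{8}\Big)q^n=C_k(2\beta)f_1^{3k}+\sum_{i=1}^{\lfloor k/3\rfloor}D_{k,i}(2\beta)\,q^{i}f_1^{3k-12i}f_3^{12i}$$ and $$\sum_{n=-\lfloor k/3\rfloor}^\infty p_{3k}\Big(3^{2\beta+1}n+\frac{k(3^{2\beta+2}-1)}{8}\Big)q^n=C_k(2\beta+1)f_3^{3k}+\sum_{i=1}^{\lfloor k/3\rfloor}D_{k,i}(2\beta+1)\,q^{ -i}f_1^{12i}f_3^{3k-12i}.$$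
   Context: All identities are between formal Laurent series in $q$ with integer coefficients; negative powers of $f_t$ are the inverses of $f_t$ in the ring of formal power series. Empty sums are $0$. -}

module Defs where

open import Data.Nat.Base as ℕ using (ℕ; zero; suc; NonZero; s≤s; z≤n)
open import Data.Nat.Divisibility using (_∣_; ∣m∣n⇒∣m+n; _∣0; m∣m*n)
open import Data.Nat.Properties as ℕₚ using ()
open import Data.Integer.Base
  using (ℤ; +_; -[1+_]; 0ℤ; 1ℤ; _+_; _*_; -_; _-_; _<_; _⊓_; +<+)
open import Data.Integer.Properties as ℤₚ using ()
open import Data.Fin.Base using (Fin; toℕ)
open import Data.Fin.Properties using (toℕ<n)
open import Data.Product.Base using (_,_; _×_)
open import Data.Bool.Base using (if_then_else_)
open import Function.Base using (_∘_)
open import Relation.Nullary.Decidable using (does; dec-false)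
open import Relation.Binary.PropositionalEquality using (_≡_; refl; sym; trans; cong; cong₂; subst)

open import Algebra.Properties.CommutativeMonoid.Sum ℤₚ.+-0-commutativeMonoid
  using (sum; sum-cong-≗; sum-replicate-zero)

------------------------------------------------------------------------

PowerSeries : Set
PowerSeries = ℕ → ℤ

𝟙 : PowerSeries
𝟙 zero    = 1ℤ
𝟙 (suc _) = 0ℤ

infixl 7 _⊛_
_⊛_ : PowerSeries → PowerSeries → PowerSeries
(a ⊛ b) n = sum {suc n} λ i → a (toℕ i) * b (n ℕ.∸ toℕ i)

-- A series a with constant term 1 has the form 1 + q a', and its inverse is
-- the unique solution of b = 1 - q (a' b).  Iterating this equation n times
-- from b = 1 determines the coefficients of q⁰, …, qⁿ.  For any other
-- constant term the result is meaningless; see ⁻¹-inverse.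
inverseApprox : PowerSeries → ℕ → PowerSeries
inverseApprox a zero    n       = 𝟙 n
inverseApprox a (suc N) zero    = 1ℤ
inverseApprox a (suc N) (suc n) = - ((a ∘ suc) ⊛ inverseApprox a N) n

infix 9 _⁻¹
_⁻¹ : PowerSeries → PowerSeries
(a ⁻¹) n = inverseApprox a n n

infixr 8 _↑ℕ_ _↑_
_↑ℕ_ : PowerSeries → ℕ → PowerSeries
a ↑ℕ zero  = 𝟙
a ↑ℕ suc n = a ⊛ (a ↑ℕ n)

_↑_ : PowerSeries → ℤ → PowerSeries
a ↑ (+ n)    = a ↑ℕ n
a ↑ -[1+ n ] = (a ⁻¹) ↑ℕ suc n

-- 1 - q^m, for m ≥ 1
1-q^ : ℕ → PowerSeries
1-q^ m n = 𝟙 n - (if does (n ℕₚ.≟ m) then 1ℤ else 0ℤ)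

∏ : ℕ → ℕ → PowerSeries
∏ t zero    = 𝟙
∏ t (suc N) = 1-q^ (suc N ℕ.* t) ⊛ ∏ t N

-- The infinite product ∏_{n≥1} (1 - q^{nt}), for t ≥ 1: the coefficient of
-- q^n is the same in all partial products with at least n factors; see
-- ∏-stable.
f : ℕ → PowerSeries
f t n = ∏ t n n

------------------------------------------------------------------------

record Laurent : Set where
  field
    coeff   : ℤ → ℤ
    order   : ℤ
    -- order is only a lower bound: coeff order may vanish.
    bounded : ∀ n → n < order → coeff n ≡ 0ℤ

open Laurent public

infix 4 _≈_
_≈_ : Laurent → Laurent → Set
x ≈ y = ∀ n → coeff x n ≡ coeff y n

fromPowerSeries : PowerSeries → Laurent
fromPowerSeries a = record { coeff = c ; order = 0ℤ ; bounded = bd }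
  where
  c : ℤ → ℤ
  c (+ n)    = a n
  c -[1+ _ ] = 0ℤ
  bd : ∀ n → n < 0ℤ → c n ≡ 0ℤ
  bd (+ _)    (+<+ ())
  bd -[1+ _ ] _ = refl

𝟘 : Laurent
𝟘 = record { coeff = λ _ → 0ℤ ; order = 0ℤ ; bounded = λ _ _ → refl }

infixl 6 _⊕_
_⊕_ : Laurent → Laurent → Laurent
x ⊕ y = record
  { coeff   = λ n → coeff x n + coeff y n
  ; order   = order x ⊓ order y
  ; bounded = λ n n< → cong₂ _+_
      (bounded x n (ℤₚ.<-≤-trans n< (ℤₚ.i⊓j≤i (order x) (order y))))
      (bounded y n (ℤₚ.<-≤-trans n< (ℤₚ.i⊓j≤j (order x) (order y))))
  }

infixr 7 _·_ q^_·_
_·_ : ℤ → Laurent → Laurent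
c · x = record
  { coeff   = λ n → c * coeff x n
  ; order   = order x
  ; bounded = λ n n< → trans (cong (c *_) (bounded x n n<)) (ℤₚ.*-zeroʳ c)
  }

q^_·_ : ℤ → Laurent → Laurent
q^ i · x = record
  { coeff   = λ n → coeff x (n - i)
  ; order   = order x + i
  ; bounded = λ n n< → bounded x (n - i)
      (subst (n - i <_) (cancel (order x)) (ℤₚ.+-monoˡ-< (- i) n<))
  }
  where
  cancel : ∀ o → o + i - i ≡ o
  cancel o = trans (ℤₚ.+-assoc o i (- i))
                   (trans (cong (λ z → o + z) (ℤₚ.+-inverseʳ i)) (ℤₚ.+-identityʳ o))

∑[1⋯_] : ℕ → (ℕ → Laurent) → Laurent
∑[1⋯ zero  ] x = 𝟘
∑[1⋯ suc m ] x = ∑[1⋯ m ] x ⊕ x (suc m)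

∑[_⋯∞] : ℤ → (ℤ → ℤ) → Laurent
∑[ m ⋯∞] a = record
  { coeff   = λ n → if does (m ℤₚ.≤? n) then a n else 0ℤ
  ; order   = m
  ; bounded = λ n n<m → cong (if_then a n else 0ℤ)
                             (dec-false (m ℤₚ.≤? n) (ℤₚ.<⇒≱ n<m))
  }

-- p j n is the coefficient of q^n in f₁^j, and 0 for n < 0.
p : ℤ → ℤ → ℤ
p j = coeff (fromPowerSeries (f 1 ↑ j))

------------------------------------------------------------------------

recurrence : (h r : ℤ) → ℤ × ℤ × ℤ × ℤ → ℕ → ℤ
recurrence h r (s₀ , s₁ , s₂ , s₃) = s
  where
  s : ℕ → ℤ
  s 0 = s₀
  s 1 = s₁
  s 2 = s₂
  s 3 = s₃
  s (suc (suc (suc (suc β)))) = h * s (suc (suc β)) + r * s β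

-- In h, r, C and D only the indices 1 ≤ k ≤ 8 and 1 ≤ i ≤ ⌊k/3⌋ are
-- meaningful; all other values are set to 0.
h : ℕ → ℤ
h 1 = - (+ 3)
h 2 = + (3 ℕ.^ 2)
h 3 = - (+ (2 ℕ.^ 2 ℕ.* 3))
h 4 = - (+ (2 ℕ.* 3 ℕ.^ 2 ℕ.* 19))
h 5 = + (2 ℕ.^ 2 ℕ.* 3 ℕ.^ 3 ℕ.* 17)
h 6 = - (+ (2 ℕ.* 3 ℕ.^ 2 ℕ.* 17 ℕ.* 23))
h 7 = + (2 ℕ.^ 2 ℕ.* 3 ℕ.^ 3 ℕ.* 491)
h 8 = - (+ (2 ℕ.* 3 ℕ.^ 4 ℕ.* 5 ℕ.* 359))
h _ = 0ℤ

r : ℕ → ℤ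
r 1 = 0ℤ
r 2 = 0ℤ
r 3 = - (+ (3 ℕ.^ 7))
r 4 = - (+ (3 ℕ.^ 10))
r 5 = - (+ (3 ℕ.^ 13))
r 6 = - (+ (3 ℕ.^ 16))
r 7 = - (+ (3 ℕ.^ 19))
r 8 = - (+ (3 ℕ.^ 22))
r _ = 0ℤ

C-initial : ℕ → ℤ × ℤ × ℤ × ℤ
C-initial 1 = + 1 , - (+ 3)      , - (+ 3)      , + 9
C-initial 2 = + 1 , + 9          , + 9          , + 81
C-initial 3 = + 1 , + 0          , - (+ 12)     , - (+ 2187)
C-initial 4 = + 1 , - (+ 243)    , - (+ 99)     , + 24057
C-initial 5 = + 1 , + 2187       , + 1107       , + 2421009
C-initial 6 = + 1 , - (+ 13122)  , - (+ 7038)   , + 49305915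
C-initial 7 = + 1 , + 59049      , + 33345      , + 1968988905
C-initial 8 = + 1 , - (+ 177147) , - (+ 113643) , + 20131516521
C-initial _ = 0ℤ , 0ℤ , 0ℤ , 0ℤ

D-initial : ℕ → ℕ → ℤ × ℤ × ℤ × ℤ
D-initial 3 1 = + 0 , + 1       , - (+ 243)      , - (+ 12)
D-initial 4 1 = + 0 , - (+ 12)  , + 2916         , + 4104
D-initial 5 1 = + 0 , + 90      , - (+ 21870)    , + 165240
D-initial 6 1 = + 0 , - (+ 486) , + 118098       , + 3420468
D-initial 6 2 = + 0 , + 1       , - (+ 177147)   , - (+ 7038)
D-initial 7 1 = + 0 , + 1701    , - (+ 413343)   , + 90200628
D-initial 7 2 = + 0 , - (+ 21)  , + 3720087      , - (+ 1113588)
D-initial 8 1 = + 0 , + 0       , + 0            , + 0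
D-initial 8 2 = + 0 , + 252     , - (+ 44641044) , - (+ 73279080)
D-initial _ _ = 0ℤ , 0ℤ , 0ℤ , 0ℤ

C : ℕ → ℕ → ℤ
C k = recurrence (h k) (r k) (C-initial k)

D : ℕ → ℕ → ℕ → ℤ
D k i = recurrence (h k) (r k) (D-initial k i)

------------------------------------------------------------------------

private
  sum-zero : ∀ {n} (t : Fin n → ℤ) → (∀ i → t i ≡ 0ℤ) → sum t ≡ 0ℤ
  sum-zero {n} t t≡0 = trans (sum-cong-≗ t≡0) (sum-replicate-zero n)

  1-q^-⊛ : ∀ m (a : PowerSeries) n → n ℕ.< m → (1-q^ m ⊛ a) n ≡ a n
  1-q^-⊛ m a n n<m = trans (cong₂ _+_ head≡ tail≡) (ℤₚ.+-identityʳ (a n))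
    where
    off : ∀ i → i ℕ.< m → 1-q^ m i ≡ 𝟙 i
    off i i<m = trans
      (cong (λ b → 𝟙 i - (if b then 1ℤ else 0ℤ)) (dec-false (i ℕₚ.≟ m) (ℕₚ.<⇒≢ i<m)))
      (ℤₚ.+-identityʳ (𝟙 i))
    head≡ : 1-q^ m 0 * a n ≡ a n
    head≡ = trans (cong (_* a n) (off 0 (ℕₚ.≤-<-trans z≤n n<m))) (ℤₚ.*-identityˡ (a n))
    tail≡ : sum {n} (λ i → 1-q^ m (suc (toℕ i)) * a (n ℕ.∸ suc (toℕ i))) ≡ 0ℤ
    tail≡ = sum-zero _ λ i →
      cong (_* a (n ℕ.∸ suc (toℕ i))) (off (suc (toℕ i)) (ℕₚ.≤-<-trans (toℕ<n i) n<m))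

  inverseApprox-stable : ∀ a N M n → n ℕ.≤ N → n ℕ.≤ M →
                         inverseApprox a N n ≡ inverseApprox a M n
  inverseApprox-stable a zero    zero    zero    _         _         = refl
  inverseApprox-stable a zero    (suc M) zero    _         _         = refl
  inverseApprox-stable a (suc N) zero    zero    _         _         = refl
  inverseApprox-stable a (suc N) (suc M) zero    _         _         = refl
  inverseApprox-stable a (suc N) (suc M) (suc n) (s≤s n≤N) (s≤s n≤M) =
    cong -_ (sum-cong-≗ {suc n} λ i → cong (a (suc (toℕ i)) *_)
      (inverseApprox-stable a N M (n ℕ.∸ toℕ i)
        (ℕₚ.≤-trans (ℕₚ.m∸n≤m n (toℕ i)) n≤N)
        (ℕₚ.≤-trans (ℕₚ.m∸n≤m n (toℕ i)) n≤M)))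

∏-stable : ∀ t .{{_ : NonZero t}} N n → n ℕ.≤ N → ∏ t N n ≡ f t n
∏-stable t N n n≤N = go (ℕₚ.≤⇒≤′ n≤N)
  where
  go : ∀ {N} → n ℕ.≤′ N → ∏ t N n ≡ f t n
  go ℕ.≤′-refl = refl
  go (ℕ.≤′-step {N} n≤′N) = trans
    (1-q^-⊛ (suc N ℕ.* t) (∏ t N) n
      (ℕₚ.≤-trans (s≤s (ℕₚ.≤′⇒≤ n≤′N)) (ℕₚ.m≤m*n (suc N) t)))
    (go n≤′N)

⁻¹-inverse : ∀ a → a 0 ≡ 1ℤ → ∀ n → (a ⊛ a ⁻¹) n ≡ 𝟙 n
⁻¹-inverse a a₀≡1 zero    = cong (λ x → x * 1ℤ + 0ℤ) a₀≡1
⁻¹-inverse a a₀≡1 (suc n) = trans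
  (cong₂ _+_ (trans (cong (_* (a ⁻¹) (suc n)) a₀≡1) (ℤₚ.*-identityˡ ((a ⁻¹) (suc n)))) tail≡)
  (ℤₚ.+-inverseˡ (((a ∘ suc) ⊛ inverseApprox a n) n))
  where
  tail≡ : ((a ∘ suc) ⊛ a ⁻¹) n ≡ ((a ∘ suc) ⊛ inverseApprox a n) n
  tail≡ = sum-cong-≗ {suc n} λ i → cong (a (suc (toℕ i)) *_)
    (inverseApprox-stable a (n ℕ.∸ toℕ i) n (n ℕ.∸ toℕ i)
      ℕₚ.≤-refl (ℕₚ.m∸n≤m n (toℕ i)))

f-constant : ∀ t → f t 0 ≡ 1ℤ
f-constant t = refl

-- The quotients k (3^{2β} - 1) / 8 are exact.
8∣3^2β∸1 : ∀ β → 8 ∣ 3 ℕ.^ (2 ℕ.* β) ℕ.∸ 1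
8∣3^2β∸1 β = subst (λ x → 8 ∣ x ℕ.∸ 1) (ℕₚ.^-*-assoc 3 2 β) (go β)
  where
  go : ∀ β → 8 ∣ 9 ℕ.^ β ℕ.∸ 1
  go zero    = 8 ∣0
  go (suc β) = subst (8 ∣_) (step (9 ℕ.^ β) (ℕₚ.m^n>0 9 β))
                 (∣m∣n⇒∣m+n (go β) (m∣m*n (9 ℕ.^ β)))
    where
    step : ∀ x → 1 ℕ.≤ x → (x ℕ.∸ 1) ℕ.+ 8 ℕ.* x ≡ 9 ℕ.* x ℕ.∸ 1
    step (suc x) _ = refl

{-# OPTIONS --safe #-}
module Submission where

-- Put x = f₁³ and g = f₃³, and split a series into its three parts by exponent
-- modulo 3.  This is a ring homomorphism a(q) ↦ δ₀ + δ₁ t + δ₂ t² from R to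
-- R[t]/(t³ - q), where R is the ring of power series; it sends g to x.  Jacobi's
-- identity f₁³ = Σ (-1)^k (2k+1) q^(k(k+1)/2) shows that it sends x to z - 3 g t
-- for some z, since k(k+1)/2 is never 2 modulo 3 and is 1 exactly when k ≡ 1.
-- Taking norms to R factor by factor in the product for f₁ gives
-- z³ - 27 q g³ = x⁴/g.  Hence each of the residue classes that occur turns a
-- monomial in q, x, g into a combination of such monomials, and the theorem
-- follows by induction on β from the matrices of these two maps; that their
-- products satisfy the stated recurrences on the initial vectors is a finite
-- computation.

open import Algebra.Bundles using (CommutativeRing)
import Algebra.Properties.Semiring.Exp as Exp
import Algebra.Solver.Ring as RingSolver
open import Algebra.Solver.Ring.AlmostCommutativeRing using (fromCommutativeRing; _-Raw-AlmostCommutative⟶_)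
open import Data.Fin.Base using (Fin; toℕ; fromℕ<)
open import Data.Fin.Patterns using (0F; 1F; 2F)
import Data.Fin.Properties as Finₚ
import Data.Integer.Base as ℤ
import Data.Integer.Properties as ℤₚ
open import Data.Integer.Solver renaming (module +-*-Solver to ℤSolver)
import Data.Maybe.Base as Maybe
open import Data.Nat.Base as ℕ using (ℕ; zero; suc; s≤s; z≤n)
import Data.Nat.Properties as ℕₚ
open import Data.Nat.Solver renaming (module +-*-Solver to ℕSolver)
open import Data.Product.Base using (_×_; _,_; ∃; proj₁; proj₂)
open import Level using (_⊔_; 0ℓ)
import Relation.Binary.Reasoning.Setoid as SetoidReasoning
open import Relation.Binary.PropositionalEquality as ≡ using (_≡_)
open import Relation.Nullary.Decidable using (does; yes; no; dec⇒maybe; from-yes; _×-dec_)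

-- Let k = 3J + ρ. The step from even to odd powers of 3 takes class ρ, the step back takes class J.
-- The first closes up because of a grading: give z and t weight 1 modulo 3 and put u = g⁴/x, w = z³
-- - 27 q g³. The images of x and of q u then have weights 1 and 0, so in component ρ of qⁱ uⁱ
-- x^(3(J-i)+ρ) every exponent of z is a multiple of 3, and z³ = w + 27 q g³ eliminates z. In the
-- step back g is a series in q³, so that only component i of wⁱ has to be known, and w g = x⁴
-- yields it. The obstacle is the negative exponents. Those of f₁ and f₃ are absorbed into u and w,
-- those of q by multiplying the odd series by q^J; all algebra then takes place among power series.
-- Infinite products enter through finite, purely algebraic forms: Jacobi's identity weighted with
-- Gaussian binomial coefficients, and the norm of the first 3M factors of f₁. Working modulo q^K
-- carries them over to f₁ and f₃.

-- Triangular numbers and Jacobi's coefficients modulo 3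

-- Coefficients of Jacobi's series: θ-coeff k = (-1)^k (2k+1).
θ-coeff : ℕ → ℤ.ℤ
θ-coeff 0             = ℤ.1ℤ
θ-coeff 1             = ℤ.- (ℤ.+ 3)
θ-coeff (suc (suc k)) = ℤ.- (ℤ.+ 2) ℤ.* θ-coeff (suc k) ℤ.- θ-coeff k

triangular : ℕ → ℕ
triangular zero    = 0
triangular (suc k) = suc k ℕ.+ triangular k

-- The second equation says t = 3 T(m) - m without subtraction; it is what turns the next triangular
-- number into 1 + 9 T(m).
triangular[3m] : ∀ m → ∃ λ t → (triangular (m ℕ.* 3) ≡ 3 ℕ.* t) × (m ℕ.+ t ≡ 3 ℕ.* triangular m)
triangular[3m] zero    = 0 , ≡.refl , ≡.refl
triangular[3m] (suc m) with t , eq , eq′ ← triangular[3m] m = t ℕ.+ 3 ℕ.* m ℕ.+ 2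
  , ≡.trans (≡.cong (λ s → 3 ℕ.+ m ℕ.* 3 ℕ.+ (2 ℕ.+ m ℕ.* 3 ℕ.+ (1 ℕ.+ m ℕ.* 3 ℕ.+ s))) eq)
      (solve 2 (λ m t → con 3 :+ m :* con 3 :+ (con 2 :+ m :* con 3 :+ (con 1 :+ m :* con 3 :+ con 3 :* t))
        := con 3 :* (t :+ con 3 :* m :+ con 2)) ≡.refl m t)
  , ≡.trans (solve 2 (λ m t → con 1 :+ m :+ (t :+ con 3 :* m :+ con 2) := con 3 :+ con 3 :* m :+ (m :+ t)) ≡.refl m t)
      (≡.trans (≡.cong (3 ℕ.+ 3 ℕ.* m ℕ.+_) eq′)
        (solve 2 (λ m s → con 3 :+ con 3 :* m :+ con 3 :* s := con 3 :* (con 1 :+ m :+ s)) ≡.refl m (triangular m)))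
  where open ℕSolver

-- The exponents in class 1 are thus 1 + 9 T(m): that class is again a theta series, in q⁹.
triangular[3m+1] : ∀ m → triangular (1 ℕ.+ m ℕ.* 3) ≡ 1 ℕ.+ 3 ℕ.* (3 ℕ.* triangular m)
triangular[3m+1] m with t , eq , eq′ ← triangular[3m] m = ≡.trans (≡.cong (1 ℕ.+ m ℕ.* 3 ℕ.+_) eq)
  (≡.trans (solve 2 (λ m t → con 1 :+ m :* con 3 :+ con 3 :* t := con 1 :+ con 3 :* (m :+ t)) ≡.refl m t)
    (≡.cong (λ s → 1 ℕ.+ 3 ℕ.* s) eq′))
  where open ℕSolver

triangular[3m+2] : ∀ m → ∃ λ t → triangular (2 ℕ.+ m ℕ.* 3) ≡ 3 ℕ.* t
triangular[3m+2] m = 1 ℕ.+ m ℕ.+ 3 ℕ.* triangular m ,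
  ≡.trans (≡.cong (2 ℕ.+ m ℕ.* 3 ℕ.+_) (triangular[3m+1] m))
    (solve 2 (λ m s → con 2 :+ m :* con 3 :+ (con 1 :+ con 3 :* (con 3 :* s)) := con 3 :* (con 1 :+ m :+ con 3 :* s))
      ≡.refl m (triangular m))
  where open ℕSolver

θ-coeff[3m+1] : ∀ m → θ-coeff (1 ℕ.+ m ℕ.* 3) ≡ ℤ.- (ℤ.+ 3) ℤ.* θ-coeff m
θ-coeff[3m+1] 0             = ≡.refl
θ-coeff[3m+1] 1             = ≡.refl
θ-coeff[3m+1] (suc (suc m)) = ≡.trans
  -- The characteristic polynomial is (X + 1)² and (-1)³ = -1, so every third term satisfies the
  -- same recurrence; here it is unrolled from positions 3m+1 and 3m+2 up to 3m+7.
  (solve 2 (λ p s → let n = λ a b → con (ℤ.- (ℤ.+ 2)) :* b :- a ; c₃ = n p s ; c₄ = n s c₃ ; c₅ = n c₃ c₄ ; c₆ = n c₄ c₅ in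
      n c₅ c₆ := n p c₄) ≡.refl (θ-coeff (1 ℕ.+ m ℕ.* 3)) (θ-coeff (2 ℕ.+ m ℕ.* 3)))
  (≡.trans (≡.cong₂ (λ a b → ℤ.- (ℤ.+ 2) ℤ.* b ℤ.- a) (θ-coeff[3m+1] m) (θ-coeff[3m+1] (suc m)))
    (solve 2 (λ a b → con (ℤ.- (ℤ.+ 2)) :* (con (ℤ.- (ℤ.+ 3)) :* b) :- con (ℤ.- (ℤ.+ 3)) :* a
      := con (ℤ.- (ℤ.+ 3)) :* (con (ℤ.- (ℤ.+ 2)) :* b :- a)) ≡.refl (θ-coeff m) (θ-coeff (suc m))))
  where open ℤSolver

-- The cubic extension and the two transition matrices

-- Elements a₀ + a₁ t + a₂ t² of A[t]/(t³ - q).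
module Cubic {a} {A : Set a} (_+_ _*_ : A → A → A) (0# 1# q : A) where

  Triple : Set a
  Triple = Fin 3 → A

  ⟨_,_,_⟩ : A → A → A → Triple
  ⟨ x , y , z ⟩ 0F = x
  ⟨ x , y , z ⟩ 1F = y
  ⟨ x , y , z ⟩ 2F = z

  infixl 7 _⊗_
  _⊗_ : Triple → Triple → Triple
  (s ⊗ t) 0F = (s 0F * t 0F) + (q * ((s 1F * t 2F) + (s 2F * t 1F)))
  (s ⊗ t) 1F = ((s 0F * t 1F) + (s 1F * t 0F)) + (q * (s 2F * t 2F))
  (s ⊗ t) 2F = ((s 0F * t 2F) + (s 1F * t 1F)) + (s 2F * t 0F)

  infixr 8 _^⊗_
  _^⊗_ : Triple → ℕ → Triple
  s ^⊗ zero  = ⟨ 1# , 0# , 0# ⟩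
  s ^⊗ suc n = s ⊗ s ^⊗ n

vec₃ : ℤ.ℤ → ℤ.ℤ → ℤ.ℤ → ℕ → ℤ.ℤ
vec₃ a b c 0 = a
vec₃ a b c 1 = b
vec₃ a b c _ = c

-- Row i lists the coefficients of component ρ of qⁱ uⁱ x^(3(J-i)+ρ) with respect to q^(J-j) wʲ
-- g^(3(J-j)+ρ). They come from expanding the images in q, z, g and replacing z³ by w + 27 q g³.
-- Only the rows and columns up to J have a meaning.
matE : Fin 3 → Fin 3 → ℕ → ℕ → ℤ.ℤ
matE 0F 0F _ = vec₃ (ℤ.+ 1) (ℤ.+ 0) (ℤ.+ 0)
matE 0F 1F _ = vec₃ (ℤ.- (ℤ.+ 3)) (ℤ.+ 0) (ℤ.+ 0)
matE 0F 2F _ = vec₃ (ℤ.+ 9) (ℤ.+ 0) (ℤ.+ 0)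
matE 1F 0F 0 = vec₃ (ℤ.+ 0) (ℤ.+ 1) (ℤ.+ 0)
matE 1F 0F _ = vec₃ (ℤ.+ 9) (ℤ.+ 0) (ℤ.+ 0)
matE 1F 1F 0 = vec₃ (ℤ.- (ℤ.+ 243)) (ℤ.- (ℤ.+ 12)) (ℤ.+ 0)
matE 1F 1F _ = vec₃ (ℤ.+ 0) (ℤ.+ 1) (ℤ.+ 0)
matE 1F 2F 0 = vec₃ (ℤ.+ 2187) (ℤ.+ 90) (ℤ.+ 0)
matE 1F 2F _ = vec₃ (ℤ.+ 0) (ℤ.- (ℤ.+ 3)) (ℤ.+ 0)
matE 2F 0F 0 = vec₃ (ℤ.- (ℤ.+ 13122)) (ℤ.- (ℤ.+ 486)) (ℤ.+ 1)
matE 2F 0F 1 = vec₃ (ℤ.+ 0) (ℤ.+ 9) (ℤ.+ 0)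
matE 2F 0F _ = vec₃ (ℤ.+ 243) (ℤ.+ 6) (ℤ.+ 0)
matE 2F 1F 0 = vec₃ (ℤ.+ 59049) (ℤ.+ 1701) (ℤ.- (ℤ.+ 21))
matE 2F 1F 1 = vec₃ (ℤ.+ 0) (ℤ.+ 0) (ℤ.+ 1)
matE 2F 1F _ = vec₃ (ℤ.+ 0) (ℤ.+ 9) (ℤ.+ 0)
matE 2F 2F 0 = vec₃ (ℤ.- (ℤ.+ 177147)) (ℤ.+ 0) (ℤ.+ 252)
matE 2F 2F 1 = vec₃ (ℤ.+ 0) (ℤ.- (ℤ.+ 243)) (ℤ.- (ℤ.+ 12))
matE 2F 2F _ = vec₃ (ℤ.+ 0) (ℤ.+ 0) (ℤ.+ 1)

-- Row i describes component i of wⁱ. Neither J nor ρ occurs: the power of g is a scalar for the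
-- dissection, and the factor q^(J-i) only moves component i to component J.
matF : ℕ → ℕ → ℤ.ℤ
matF 0 = vec₃ (ℤ.+ 1) (ℤ.+ 0) (ℤ.+ 0)
matF 1 = vec₃ (ℤ.- (ℤ.+ 12)) (ℤ.- (ℤ.+ 243)) (ℤ.+ 0)
matF _ = vec₃ (ℤ.+ 252) (ℤ.+ 0) (ℤ.- (ℤ.+ 177147))

∑ℤ : (ℕ → ℤ.ℤ) → ℕ → ℤ.ℤ
∑ℤ t zero    = t 0
∑ℤ t (suc K) = ∑ℤ t K ℤ.+ t (suc K)

infix 8 _·[_]_
_·[_]_ : (ℕ → ℤ.ℤ) → ℕ → (ℕ → ℕ → ℤ.ℤ) → ℕ → ℤ.ℤ
(v ·[ K ] m) j = ∑ℤ (λ i → v i ℤ.* m i j) K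

first : ℕ → ℤ.ℤ
first zero    = ℤ.1ℤ
first (suc _) = ℤ.0ℤ

-- Algebra over an arbitrary commutative ring with a map from the integers

module ℤ-Algebra {c ℓ} (R : CommutativeRing c ℓ)
  (ι : CommutativeRing.rawRing ℤₚ.+-*-commutativeRing -Raw-AlmostCommutative⟶ fromCommutativeRing R)
  where

  open CommutativeRing R
  open Exp semiring using (_^_; ^-homo-*; ^-congˡ; ^-assocʳ)
  open SetoidReasoning setoid
  private module ι = _-Raw-AlmostCommutative⟶_ ι

  -- The same embedding, adjusted so that the constants 0 and 1 of the solver
  -- denote 0# and 1# definitionally.
  ⟪_⟫ : ℤ.ℤ → Carrier
  ⟪ ℤ.+ 0 ⟫ = 0#
  ⟪ ℤ.+ 1 ⟫ = 1#
  ⟪ c     ⟫ = ι.⟦ c ⟧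

  ⟪⟫≈ι : ∀ c → ⟪ c ⟫ ≈ ι.⟦ c ⟧
  ⟪⟫≈ι (ℤ.+ 0)             = sym ι.0-homo
  ⟪⟫≈ι (ℤ.+ 1)             = sym ι.1-homo
  ⟪⟫≈ι (ℤ.+ suc (suc n))   = refl
  ⟪⟫≈ι ℤ.-[1+ n ]          = refl

  ⟪⟫-homo : CommutativeRing.rawRing ℤₚ.+-*-commutativeRing -Raw-AlmostCommutative⟶ fromCommutativeRing R
  ⟪⟫-homo = record
    { ⟦_⟧    = ⟪_⟫
    ; +-homo = λ a b → trans (⟪⟫≈ι (a ℤ.+ b)) (trans (ι.+-homo a b) (sym (+-cong (⟪⟫≈ι a) (⟪⟫≈ι b))))
    ; *-homo = λ a b → trans (⟪⟫≈ι (a ℤ.* b)) (trans (ι.*-homo a b) (sym (*-cong (⟪⟫≈ι a) (⟪⟫≈ι b))))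
    ; -‿homo = λ a → trans (⟪⟫≈ι (ℤ.- a)) (trans (ι.-‿homo a) (sym (-‿cong (⟪⟫≈ι a))))
    ; 0-homo = refl
    ; 1-homo = refl
    }

  private module ⟪⟫ = _-Raw-AlmostCommutative⟶_ ⟪⟫-homo

  module Solver = RingSolver _ (fromCommutativeRing R) ⟪⟫-homo
    (λ a b → Maybe.map (λ eq → reflexive (≡.cong ⟪_⟫ eq)) (dec⇒maybe (a ℤₚ.≟ b)))
  open Solver using (solve; con; _:=_; _:+_; _:*_; _:-_; :-_; _:^_; Polynomial)

  :1 :0 : ∀ {n} → Polynomial n
  :1 = con ℤ.1ℤ
  :0 = con ℤ.0ℤ

  sumTo : (ℕ → Carrier) → ℕ → Carrier
  sumTo t zero    = t 0
  sumTo t (suc K) = sumTo t K + t (suc K)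

  -- A finite form of Jacobi's identity

  module _ (q : Carrier) where

    qPochhammer : ℕ → Carrier
    qPochhammer zero    = 1#
    qPochhammer (suc n) = (1# - q ^ suc n) * qPochhammer n

    -- The Gaussian binomial coefficient [2n+1 choose n-k], by a recurrence
    -- that follows from both q-Pascal rules; at k = 0 it uses the symmetry
    -- k ↔ -1-k.
    gauss : ℕ → ℕ → Carrier
    gauss zero    zero    = 1#
    gauss zero    (suc k) = 0#
    gauss (suc n) zero    = (1# + q ^ suc n + q ^ suc n * q ^ suc n) * gauss n 0
                            + q ^ suc (suc n) * gauss n 1
    gauss (suc n) (suc k) = q ^ (n ℕ.∸ k) * gauss n k
                            + (1# + q ^ suc n * q ^ suc n) * gauss n (suc k)
                            + q ^ (suc (suc (suc n)) ℕ.+ k) * gauss n (suc (suc k))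

    gauss-zero : ∀ n k → n ℕ.< k → gauss n k ≈ 0#
    gauss-zero zero    (suc k) _         = refl
    gauss-zero (suc n) (suc k) (s≤s n<k) = trans
      (+-cong (+-cong (*-congˡ (gauss-zero n k n<k))
                      (*-congˡ (gauss-zero n (suc k) (ℕₚ.m<n⇒m<1+n n<k))))
              (*-congˡ (gauss-zero n (suc (suc k)) (ℕₚ.m<n⇒m<1+n (ℕₚ.m<n⇒m<1+n n<k)))))
      (solve 3 (λ x y z → x :* :0 :+ y :* :0 :+ z :* :0 := :0) refl _ _ _)

    -- For k > n the truncated difference gives a wrong exponent, but then `gauss n k` vanishes.
    q^k*q^n∸k : ∀ n k → q ^ k * (q ^ (n ℕ.∸ k) * gauss n k) ≈ q ^ n * gauss n k
    q^k*q^n∸k n k with k ℕₚ.≤? n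
    ... | yes k≤n = trans (sym (*-assoc _ _ _))
      (*-congʳ (trans (sym (^-homo-* q k (n ℕ.∸ k))) (reflexive (≡.cong (q ^_) (ℕₚ.m+[n∸m]≡n k≤n)))))
    ... | no  k≰n = trans
      (*-congˡ (*-congˡ (gauss-zero n k (ℕₚ.≰⇒> k≰n))))
      (trans (solve 3 (λ x y z → x :* (y :* :0) := z :* :0) refl _ _ (q ^ n))
        (*-congˡ (sym (gauss-zero n k (ℕₚ.≰⇒> k≰n)))))

    θ-term : ℕ → Carrier
    θ-term k = ⟪ θ-coeff k ⟫ * q ^ triangular k

    private
      θ-coeff-rec : ∀ k → ⟪ θ-coeff (suc (suc k)) ⟫
                    ≈ ⟪ ℤ.- (ℤ.+ 2) ⟫ * ⟪ θ-coeff (suc k) ⟫ - ⟪ θ-coeff k ⟫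
      θ-coeff-rec k = trans (⟪⟫.+-homo (ℤ.- (ℤ.+ 2) ℤ.* θ-coeff (suc k)) (ℤ.- θ-coeff k))
        (+-cong (⟪⟫.*-homo (ℤ.- (ℤ.+ 2)) (θ-coeff (suc k))) (⟪⟫.-‿homo (θ-coeff k)))

    -- Write c for `θ-coeff` and T for `triangular`. In the complete sum `gauss n j` collects q^T(j)
    -- (c(j) (1 + Q²) + Q (c(j-1) + c(j+1))), and c(j+1) = -2 c(j) - c(j-1) makes this c(j) q^T(j)
    -- (1 - Q)². Stopping at K leaves one contribution to `gauss n (suc K)` too many and one to
    -- `gauss n K` missing: these are the two boundary terms.
    telescope : ∀ n K → let Q = q ^ suc n in
      sumTo (λ k → θ-term k * gauss (suc n) k) K
      ≈ (1# - Q) * (1# - Q) * sumTo (λ k → θ-term k * gauss n k) K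
        + ⟪ θ-coeff K ⟫ * q ^ triangular K * (Q * q * q ^ K) * gauss n (suc K)
        - ⟪ θ-coeff (suc K) ⟫ * q ^ triangular K * Q * gauss n K
    telescope n zero = solve 4 (λ q Q a b →
        :1 :* :1 :* ((:1 :+ q :* Q :+ q :* Q :* (q :* Q)) :* a :+ q :* (q :* Q) :* b)
        := (:1 :- q :* Q) :* (:1 :- q :* Q) :* (:1 :* :1 :* a)
           :+ :1 :* :1 :* (q :* Q :* q :* :1) :* b
           :- con (ℤ.- (ℤ.+ 3)) :* :1 :* (q :* Q) :* a)
      refl q (q ^ n) (gauss n 0) (gauss n 1)
    telescope n (suc K) = begin
      _ ≈⟨ +-congʳ (telescope n K) ⟩
      _ + c₁ * q ^ triangular (suc K) * gauss (suc n) (suc K)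
        ≈⟨ +-congˡ (trans (*-congʳ (*-congˡ (^-homo-* q (suc K) (triangular K))))
             (*-congˡ (+-congˡ (*-congʳ (*-congˡ (*-congˡ (*-congˡ (^-homo-* q n K)))))))) ⟩
      _ + c₁ * (q * s * t) * (q ^ (n ℕ.∸ K) * g₀ + (1# + Q * Q) * g₁ + q * (q * (q * (q ^ n * s))) * g₂)
        ≈⟨ solve 11 (λ q s t Qn c₀ c₁ g₀ g₁ g₂ S u →
             (:1 :- q :* Qn) :* (:1 :- q :* Qn) :* S
               :+ c₀ :* t :* (q :* Qn :* q :* s) :* g₁ :- c₁ :* t :* (q :* Qn) :* g₀
               :+ c₁ :* (q :* s :* t) :* (u :* g₀ :+ (:1 :+ q :* Qn :* (q :* Qn)) :* g₁ :+ q :* (q :* (q :* (Qn :* s))) :* g₂)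
             := (:1 :- q :* Qn) :* (:1 :- q :* Qn) :* S
               :+ c₀ :* t :* (q :* Qn :* q :* s) :* g₁ :- c₁ :* t :* (q :* Qn) :* g₀
               :+ c₁ :* q :* t :* (s :* (u :* g₀))
               :+ c₁ :* (q :* s :* t) :* ((:1 :+ q :* Qn :* (q :* Qn)) :* g₁ :+ q :* (q :* (q :* (Qn :* s))) :* g₂)) refl
             q s t (q ^ n) c₀ c₁ g₀ g₁ g₂ S (q ^ (n ℕ.∸ K)) ⟩
      _ ≈⟨ +-congʳ (+-congˡ (*-congˡ (q^k*q^n∸k n K))) ⟩
      _ ≈⟨ solve 10 (λ q s t Qn c₀ c₁ g₀ g₁ g₂ S →
             (:1 :- q :* Qn) :* (:1 :- q :* Qn) :* S
               :+ c₀ :* t :* (q :* Qn :* q :* s) :* g₁ :- c₁ :* t :* (q :* Qn) :* g₀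
               :+ c₁ :* q :* t :* (Qn :* g₀)
               :+ c₁ :* (q :* s :* t) :* ((:1 :+ q :* Qn :* (q :* Qn)) :* g₁ :+ q :* (q :* (q :* (Qn :* s))) :* g₂)
             := (:1 :- q :* Qn) :* (:1 :- q :* Qn) :* (S :+ c₁ :* (q :* s :* t) :* g₁)
               :+ c₁ :* (q :* s :* t) :* (q :* Qn :* q :* (q :* s)) :* g₂
               :- (con (ℤ.- (ℤ.+ 2)) :* c₁ :- c₀) :* (q :* s :* t) :* (q :* Qn) :* g₁) refl
             q s t (q ^ n) c₀ c₁ g₀ g₁ g₂ S ⟩
      _ ≈⟨ +-cong (+-cong (*-congˡ (+-congˡ (*-congʳ (*-congˡ (sym t₁))))) (*-congʳ (*-congʳ (*-congˡ (sym t₁)))))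
                  (-‿cong (*-congʳ (*-congʳ (*-cong (sym (θ-coeff-rec K)) (sym t₁))))) ⟩
      _ ∎
      where
      Q = q ^ suc n
      s = q ^ K
      t = q ^ triangular K
      c₀ = ⟪ θ-coeff K ⟫
      c₁ = ⟪ θ-coeff (suc K) ⟫
      g₀ = gauss n K
      g₁ = gauss n (suc K)
      g₂ = gauss n (suc (suc K))
      S = sumTo (λ k → θ-term k * gauss n k) K
      t₁ = ^-homo-* q (suc K) (triangular K)

    -- This is the derivative at y = 1 of the finite triple product (1 - 1/y) ∏ (1 - y qⁱ)(1 -
    -- qⁱ/y), the terms k and -1-k combining to (-1)^k (2k+1). In `telescope` at K = n+1 both
    -- boundary terms vanish, so n ↦ n+1 multiplies the sum by (1 - q^(n+1))².
    finite-Jacobi : ∀ n → sumTo (λ k → θ-term k * gauss n k) n ≈ qPochhammer n * qPochhammer n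
    finite-Jacobi zero    = solve 0 (:1 :* :1 :* :1 := :1 :* :1) refl
    finite-Jacobi (suc n) = begin
      _ ≈⟨ telescope n (suc n) ⟩
      _ ≈⟨ +-cong (+-cong (*-congˡ (+-cong (finite-Jacobi n) (*-congˡ z₁))) (*-congˡ z₂)) (-‿cong (*-congˡ z₁)) ⟩
      _ ≈⟨ solve 5 (λ P e x y z → P :* P :* (e :* e :+ x :* :0) :+ y :* :0 :- z :* :0 := P :* e :* (P :* e))
             refl (1# - q ^ suc n) (qPochhammer n) _ _ _ ⟩
      _ ∎
      where
      z₁ = gauss-zero n (suc n) ℕₚ.≤-refl
      z₂ = gauss-zero n (suc (suc n)) (ℕₚ.m<n⇒m<1+n ℕₚ.≤-refl)

    private
      e : ℕ → Carrier
      e = qPochhammer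

      -- The common step of gauss-product, with a = q^d, s = q^k, where the
      -- three hypotheses are the product formulas for k, k+1 and k+2.
      product-step : ∀ a s ed en g₀ g₁ g₂ E → let m = a * (q * s) * s ; Q = q * (a * (q * s)) in
        (1# - q * a) * ed * en * g₀ ≈ E →
        ed * ((1# - q * (q * m)) * en) * g₁ ≈ E →
        ed * ((1# - q * (q * (q * m))) * ((1# - q * (q * m)) * en)) * g₂ ≈ (1# - a) * E →
        (1# - q * a) * ed * ((1# - q * (q * (q * m))) * ((1# - q * (q * m)) * en))
          * (q * a * g₀ + (1# + Q * Q) * g₁ + q * (q * (q * m)) * g₂)
        ≈ (1# - q * Q * Q) * ((1# - Q * Q) * E)
      product-step a s ed en g₀ g₁ g₂ E h₀ h₁ h₂ = begin
        _ ≈⟨ solve 8 (λ q a s ed en g₀ g₁ g₂ →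
               let m = a :* (q :* s) :* s ; Q = q :* (a :* (q :* s)) in
               (:1 :- q :* a) :* ed :* ((:1 :- q :* (q :* (q :* m))) :* ((:1 :- q :* (q :* m)) :* en))
                 :* (q :* a :* g₀ :+ (:1 :+ Q :* Q) :* g₁ :+ q :* (q :* (q :* m)) :* g₂)
               := q :* a :* (:1 :- q :* (q :* (q :* m))) :* (:1 :- q :* (q :* m)) :* ((:1 :- q :* a) :* ed :* en :* g₀)
                 :+ (:1 :+ Q :* Q) :* (:1 :- q :* (q :* (q :* m))) :* (:1 :- q :* a) :* (ed :* ((:1 :- q :* (q :* m)) :* en) :* g₁)
                 :+ q :* (q :* (q :* m)) :* (:1 :- q :* a) :* (ed :* ((:1 :- q :* (q :* (q :* m))) :* ((:1 :- q :* (q :* m)) :* en)) :* g₂)) refl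
               q a s ed en g₀ g₁ g₂ ⟩
        _ ≈⟨ +-cong (+-cong (*-congˡ h₀) (*-congˡ h₁)) (*-congˡ h₂) ⟩
        _ ≈⟨ solve 4 (λ q a s E →
               let m = a :* (q :* s) :* s ; Q = q :* (a :* (q :* s)) in
               q :* a :* (:1 :- q :* (q :* (q :* m))) :* (:1 :- q :* (q :* m)) :* E
                 :+ (:1 :+ Q :* Q) :* (:1 :- q :* (q :* (q :* m))) :* (:1 :- q :* a) :* E
                 :+ q :* (q :* (q :* m)) :* (:1 :- q :* a) :* ((:1 :- a) :* E)
               := (:1 :- q :* Q :* Q) :* ((:1 :- Q :* Q) :* E)) refl
               q a s E ⟩
        _ ∎

      e-suc : ∀ n {x} → q ^ n ≈ x → e (suc n) ≈ (1# - q * x) * e n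
      e-suc n eq = *-congʳ (+-congˡ (-‿cong (*-congˡ eq)))

    -- The product formula for the Gaussian binomial coefficients

    -- The quotient formula for the binomial coefficient, cleared of denominators, which need not be
    -- invertible here. The witness d replaces the truncated difference of n and k.
    gauss-product : ∀ n d k → n ≡ d ℕ.+ k →
                    e d * e (suc (n ℕ.+ k)) * gauss n k ≈ e (suc (n ℕ.+ n))
    -- The formula for k+1 with `e d` kept in place of `e (d - 1)`. The extra factor 1 - q^d makes
    -- the case d = 0 read 0 = 0, so the induction can use the recurrence up to the edge k = n.
    gauss-product-suc : ∀ n d k → n ≡ d ℕ.+ k →
                        e d * e (suc (suc (n ℕ.+ k))) * gauss n (suc k)
                        ≈ (1# - q ^ d) * e (suc (n ℕ.+ n))

    gauss-product-suc n zero k ≡.refl = trans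
      (*-congˡ (gauss-zero n (suc k) ℕₚ.≤-refl))
      (solve 2 (λ x y → x :* :0 := (:1 :- :1) :* y) refl _ _)
    gauss-product-suc n (suc d) k eq = trans
      (solve 4 (λ a b c d → a :* b :* c :* d := a :* (b :* c :* d)) refl _ _ _ _)
      (*-congˡ (trans
        (reflexive (≡.cong (λ m → e d * e (suc m) * gauss n (suc k)) (≡.sym (ℕₚ.+-suc n k))))
        (gauss-product n d (suc k) (≡.trans eq (≡.sym (ℕₚ.+-suc d k))))))

    gauss-product zero    zero    zero    _ = solve 1 (λ x → :1 :* x :* :1 := x) refl _
    gauss-product (suc n) (suc d) zero    eq with ≡.refl ← ≡.trans (ℕₚ.suc-injective eq) (ℕₚ.+-identityʳ d) = begin
      e (suc n) * e (suc (suc (n ℕ.+ 0))) * gauss (suc n) 0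
        ≡⟨ ≡.cong (λ m → e (suc n) * e (suc (suc m)) * gauss (suc n) 0) (ℕₚ.+-identityʳ n) ⟩
      (1# - q * a) * e n * ((1# - q * (q * a)) * ((1# - q * a) * e n)) * ((1# + q * a + q * a * (q * a)) * g₀ + q * (q * a) * g₁)
        ≈⟨ solve 5 (λ q a en g₀ g₁ →
             (:1 :- q :* a) :* en :* ((:1 :- q :* (q :* a)) :* ((:1 :- q :* a) :* en)) :* ((:1 :+ q :* a :+ q :* a :* (q :* a)) :* g₀ :+ q :* (q :* a) :* g₁)
             := (:1 :- q :* a) :* (:1 :- q :* (q :* a)) :* (:1 :+ q :* a :+ q :* a :* (q :* a)) :* (en :* ((:1 :- q :* a) :* en) :* g₀)
                :+ q :* (q :* a) :* (:1 :- q :* a) :* (en :* ((:1 :- q :* (q :* a)) :* ((:1 :- q :* a) :* en)) :* g₁)) refl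
           q a (e n) g₀ g₁ ⟩
      _ ≈⟨ +-cong (*-congˡ h₀) (*-congˡ h₁) ⟩
      _ ≈⟨ solve 3 (λ q a E →
             (:1 :- q :* a) :* (:1 :- q :* (q :* a)) :* (:1 :+ q :* a :+ q :* a :* (q :* a)) :* E
               :+ q :* (q :* a) :* (:1 :- q :* a) :* ((:1 :- a) :* E)
             := (:1 :- q :* (q :* (q :* (a :* a)))) :* ((:1 :- q :* (q :* (a :* a))) :* E)) refl
             q a E ⟩
      _ ≈⟨ *-cong (+-congˡ (-‿cong (*-congˡ (*-congˡ (*-congˡ (sym (^-homo-* q n n)))))))
             (sym (e-suc (suc (n ℕ.+ n)) (*-congˡ (^-homo-* q n n)))) ⟩
      _ ≡⟨ ≡.cong (λ m → e (suc (suc m))) (≡.sym (ℕₚ.+-suc n n)) ⟩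
      e (suc (suc n ℕ.+ suc n)) ∎
      where
      a = q ^ n
      g₀ = gauss n 0
      g₁ = gauss n 1
      E = e (suc (n ℕ.+ n))
      h₀ : e n * e (suc n) * g₀ ≈ E
      h₀ = trans (reflexive (≡.cong (λ m → e n * e (suc m) * g₀) (≡.sym (ℕₚ.+-identityʳ n))))
             (gauss-product n n 0 (≡.sym (ℕₚ.+-identityʳ n)))
      h₁ : e n * e (suc (suc n)) * g₁ ≈ (1# - a) * E
      h₁ = trans (reflexive (≡.cong (λ m → e n * e (suc (suc m)) * g₁) (≡.sym (ℕₚ.+-identityʳ n))))
             (gauss-product-suc n n 0 (≡.sym (ℕₚ.+-identityʳ n)))
    gauss-product (suc n) zero    (suc k) eq with ≡.refl ← ℕₚ.suc-injective eq = begin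
      1# * e (suc (suc n ℕ.+ suc n)) * (q ^ (n ℕ.∸ n) * gauss n n + x * gauss n (suc n) + y * gauss n (suc (suc n)))
        ≈⟨ *-congˡ (+-cong (+-cong (*-congʳ (reflexive (≡.cong (q ^_) (ℕₚ.n∸n≡0 n)))) (*-congˡ (gauss-zero n (suc n) ℕₚ.≤-refl)))
                     (*-congˡ (gauss-zero n (suc (suc n)) (ℕₚ.m<n⇒m<1+n ℕₚ.≤-refl)))) ⟩
      1# * e (suc (suc n ℕ.+ suc n)) * (1# * gauss n n + x * 0# + y * 0#)
        ≡⟨ ≡.cong (λ m → 1# * e (suc (suc m)) * (1# * gauss n n + x * 0# + y * 0#)) (ℕₚ.+-suc n n) ⟩
      _ ≈⟨ solve 6 (λ A B e₁ g x y → :1 :* (A :* (B :* e₁)) :* (:1 :* g :+ x :* :0 :+ y :* :0) := A :* (B :* (:1 :* e₁ :* g))) refl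
             _ _ (e (suc (n ℕ.+ n))) (gauss n n) x y ⟩
      _ ≈⟨ *-congˡ (*-congˡ (gauss-product n 0 n ≡.refl)) ⟩
      e (suc (suc (suc (n ℕ.+ n)))) ≡⟨ ≡.cong (λ m → e (suc (suc m))) (≡.sym (ℕₚ.+-suc n n)) ⟩
      e (suc (suc n ℕ.+ suc n)) ∎
      where
      x = 1# + q ^ suc n * q ^ suc n
      y = q ^ (suc (suc (suc n)) ℕ.+ n)
    gauss-product (suc n) (suc d) (suc k) eq with ≡.refl ← ℕₚ.suc-injective eq = begin
      _ ≈⟨ *-cong (*-congˡ e₂) (+-cong (+-cong (*-congʳ q^n∸k) (*-congʳ (+-congˡ (*-cong Q≈ Q≈)))) (*-congʳ (*-congˡ (*-congˡ (*-congˡ m≈))))) ⟩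
      _ ≈⟨ product-step (q ^ d) (q ^ k) (e d) en (gauss n k) (gauss n (suc k)) (gauss n (suc (suc k))) E
             (gauss-product n (suc d) k (ℕₚ.+-suc d k))
             (trans (*-congʳ (*-congˡ (sym e₁))) (gauss-product n d (suc k) ≡.refl))
             (trans (*-congʳ (*-congˡ (sym e₂))) (gauss-product-suc n d (suc k) ≡.refl)) ⟩
      _ ≈⟨ *-cong (+-congˡ (-‿cong q³)) (*-congʳ (+-congˡ (-‿cong q²))) ⟩
      e (suc (suc (suc (n ℕ.+ n)))) ≡⟨ ≡.cong (λ m → e (suc (suc m))) (≡.sym (ℕₚ.+-suc n n)) ⟩
      e (suc (suc n ℕ.+ suc n)) ∎
      where
      en = e (suc (n ℕ.+ k))
      E = e (suc (n ℕ.+ n))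
      n≈ : q ^ n ≈ q ^ d * (q * q ^ k)
      n≈ = ^-homo-* q d (suc k)
      Q≈ : q ^ suc n ≈ q * (q ^ d * (q * q ^ k))
      Q≈ = *-congˡ n≈
      m≈ : q ^ (n ℕ.+ k) ≈ q ^ d * (q * q ^ k) * q ^ k
      m≈ = trans (^-homo-* q n k) (*-congʳ n≈)
      q^n∸k : q ^ (n ℕ.∸ k) ≈ q * q ^ d
      q^n∸k = reflexive (≡.cong (q ^_) (≡.trans (≡.cong (ℕ._∸ k) (ℕₚ.+-suc d k)) (ℕₚ.m+n∸n≡m (suc d) k)))
      e₁ : e (suc (n ℕ.+ suc k)) ≈ (1# - q * (q * (q ^ d * (q * q ^ k) * q ^ k))) * en
      e₁ = trans (reflexive (≡.cong (λ m → e (suc m)) (ℕₚ.+-suc n k))) (e-suc (suc (n ℕ.+ k)) (*-congˡ m≈))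
      e₂ : e (suc (suc (n ℕ.+ suc k))) ≈ (1# - q * (q * (q * (q ^ d * (q * q ^ k) * q ^ k)))) * ((1# - q * (q * (q ^ d * (q * q ^ k) * q ^ k))) * en)
      e₂ = trans (e-suc (suc (n ℕ.+ suc k))
             (trans (*-congˡ (reflexive (≡.cong (q ^_) (ℕₚ.+-suc n k)))) (*-congˡ (*-congˡ m≈)))) (*-congˡ e₁)
      q³ : q * (q * (q ^ d * (q * q ^ k))) * (q * (q ^ d * (q * q ^ k))) ≈ q ^ suc (suc (suc (n ℕ.+ n)))
      q³ = trans (solve 2 (λ q x → q :* (q :* x) :* (q :* x) := q :* (q :* (q :* (x :* x)))) refl q _)
             (*-congˡ (*-congˡ (*-congˡ (trans (sym (*-cong n≈ n≈)) (sym (^-homo-* q n n))))))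
      q² : q * (q ^ d * (q * q ^ k)) * (q * (q ^ d * (q * q ^ k))) ≈ q ^ suc (suc (n ℕ.+ n))
      q² = trans (solve 2 (λ q x → q :* x :* (q :* x) := q :* (q :* (x :* x))) refl q _)
             (*-congˡ (*-congˡ (trans (sym (*-cong n≈ n≈)) (sym (^-homo-* q n n)))))

  -- Dissections modulo 3

  module _ (q : Carrier) where
    open Cubic _+_ _*_ 0# 1# q public

  module _ {n} (q : Polynomial n) where
    open Cubic _:+_ _:*_ :0 :1 q public using ()
      renaming (⟨_,_,_⟩ to ⟨_,_,_⟩ᴾ; _⊗_ to ⊗ᴾ; _^⊗_ to ^⊗ᴾ)

  sumToᴾ : ∀ {n} → (ℕ → Polynomial n) → ℕ → Polynomial n
  sumToᴾ t zero    = t 0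
  sumToᴾ t (suc K) = sumToᴾ t K :+ t (suc K)

  -- The determinant of multiplication by `s` on R[t]/(t³ - q), equivalently the product of s over
  -- the three cube roots of q.
  norm : Carrier → (Fin 3 → Carrier) → Carrier
  norm q s = s 0F * s 0F * s 0F + q * (s 1F * s 1F * s 1F) + q * q * (s 2F * s 2F * s 2F)
             - ⟪ ℤ.+ 3 ⟫ * q * (s 0F * s 1F * s 2F)

  norm-⊗ : ∀ q s t → norm q (_⊗_ q s t) ≈ norm q s * norm q t
  norm-⊗ q s t = solve 7 (λ q a b c x y z →
    let N = λ a b c → a :* a :* a :+ q :* (b :* b :* b) :+ q :* q :* (c :* c :* c) :- con (ℤ.+ 3) :* q :* (a :* b :* c) in
    N (a :* x :+ q :* (b :* z :+ c :* y)) (a :* y :+ b :* x :+ q :* (c :* z)) (a :* z :+ b :* y :+ c :* x)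
    := N a b c :* N x y z) refl q (s 0F) (s 1F) (s 2F) (t 0F) (t 1F) (t 2F)

  norm-^⊗ : ∀ q s n → norm q (_^⊗_ q s n) ≈ norm q s ^ n
  norm-^⊗ q s zero    = solve 1 (λ q → :1 :* :1 :* :1 :+ q :* (:0 :* :0 :* :0) :+ q :* q :* (:0 :* :0 :* :0)
    :- con (ℤ.+ 3) :* q :* (:1 :* :0 :* :0) := :1) refl q
  norm-^⊗ q s (suc n) = trans (norm-⊗ q s (_^⊗_ q s n)) (*-congˡ (norm-^⊗ q s n))

  norm-cong : ∀ q {s t} → (∀ r → s r ≈ t r) → norm q s ≈ norm q t
  norm-cong q eq = +-cong
    (+-cong (+-cong (*-cong (*-cong (eq 0F) (eq 0F)) (eq 0F)) (*-congˡ (*-cong (*-cong (eq 1F) (eq 1F)) (eq 1F))))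
      (*-congˡ (*-cong (*-cong (eq 2F) (eq 2F)) (eq 2F))))
    (-‿cong (*-congˡ (*-cong (*-cong (eq 0F) (eq 1F)) (eq 2F))))

  -- The components of a(q) = δ₀(q³) + q δ₁(q³) + q² δ₂(q³) are those of the
  -- image of a in R[t]/(t³ - q).
  record IsDissection (q : Carrier) (δ : Fin 3 → Carrier → Carrier) : Set (c ⊔ ℓ) where
    field
      δ-cong : ∀ r {a b} → a ≈ b → δ r a ≈ δ r b
      δ-+    : ∀ r a b → δ r (a + b) ≈ δ r a + δ r b
      δ-*    : ∀ r a b → δ r (a * b) ≈ (_⊗_ q (λ r → δ r a) (λ r → δ r b)) r
      δ-⟪⟫   : ∀ r c → δ r ⟪ c ⟫ ≈ ⟨_,_,_⟩ q ⟪ c ⟫ 0# 0# r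
      δ-q    : ∀ r → δ r q ≈ ⟨_,_,_⟩ q 0# 1# 0# r

  module Dissection {q δ} (isDissection : IsDissection q δ) where
    open IsDissection isDissection

    private
      infixl 7 _⊠_
      _⊠_ : Triple q → Triple q → Triple q
      _⊠_ = _⊗_ q
      ⟦_,_,_⟧ : Carrier → Carrier → Carrier → Triple q
      ⟦_,_,_⟧ = ⟨_,_,_⟩ q

    infix 4 _⇝_
    _⇝_ : Carrier → Triple q → Set ℓ
    a ⇝ s = ∀ r → δ r a ≈ s r

    ⇝-* : ∀ {a b s t} → a ⇝ s → b ⇝ t → a * b ⇝ s ⊠ t
    ⇝-* {a} {b} p p′ 0F = trans (δ-* 0F a b) (+-cong (*-cong (p 0F) (p′ 0F)) (*-congˡ (+-cong (*-cong (p 1F) (p′ 2F)) (*-cong (p 2F) (p′ 1F)))))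
    ⇝-* {a} {b} p p′ 1F = trans (δ-* 1F a b) (+-cong (+-cong (*-cong (p 0F) (p′ 1F)) (*-cong (p 1F) (p′ 0F))) (*-congˡ (*-cong (p 2F) (p′ 2F))))
    ⇝-* {a} {b} p p′ 2F = trans (δ-* 2F a b) (+-cong (+-cong (*-cong (p 0F) (p′ 2F)) (*-cong (p 1F) (p′ 1F))) (*-cong (p 2F) (p′ 0F)))

    ⇝-^ : ∀ {a s} → a ⇝ s → ∀ n → a ^ n ⇝ _^⊗_ q s n
    ⇝-^ p zero    = λ r → δ-⟪⟫ r ℤ.1ℤ
    ⇝-^ p (suc n) = ⇝-* p (⇝-^ p n)

    -- The hypothesis says that a is b(q³), whose image lies in R itself, and the components are
    -- linear over R.
    δ-scalar : ∀ {a b} → a ⇝ ⟦ b , 0# , 0# ⟧ → ∀ r c → δ r (a * c) ≈ b * δ r c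
    δ-scalar {b = b} p 0F c = trans (⇝-* p (λ _ → refl) 0F)
      (solve 5 (λ b q x y z → b :* x :+ q :* (:0 :* z :+ :0 :* y) := b :* x) refl b q (δ 0F c) (δ 1F c) (δ 2F c))
    δ-scalar {b = b} p 1F c = trans (⇝-* p (λ _ → refl) 1F)
      (solve 5 (λ b q x y z → b :* y :+ :0 :* x :+ q :* (:0 :* z) := b :* y) refl b q (δ 0F c) (δ 1F c) (δ 2F c))
    δ-scalar {b = b} p 2F c = trans (⇝-* p (λ _ → refl) 2F)
      (solve 5 (λ b q x y z → b :* z :+ :0 :* y :+ :0 :* x := b :* z) refl b q (δ 0F c) (δ 1F c) (δ 2F c))

    δ-⟪⟫* : ∀ r m a → δ r (⟪ m ⟫ * a) ≈ ⟪ m ⟫ * δ r a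
    δ-⟪⟫* r m a = δ-scalar (λ r → δ-⟪⟫ r m) r a

    scalar-^ : ∀ {a b} → a ⇝ ⟦ b , 0# , 0# ⟧ → ∀ n → a ^ n ⇝ ⟦ b ^ n , 0# , 0# ⟧
    scalar-^ p zero    = λ r → δ-⟪⟫ r ℤ.1ℤ
    scalar-^ {a} p (suc n) r = trans (δ-scalar p r (a ^ n)) (trans (*-congˡ (scalar-^ p n r)) (collapse r))
      where
      collapse : ∀ r → _ * ⟦ _ , 0# , 0# ⟧ r ≈ ⟦ _ , 0# , 0# ⟧ r
      collapse 0F = refl
      collapse 1F = zeroʳ _
      collapse 2F = zeroʳ _

    -- The images of x, g, u, w and of the monomials in them

    module EtaQuotients {f F f⁻¹ F⁻¹ : Carrier}
      (f*f⁻¹ : f * f⁻¹ ≈ 1#) (F*F⁻¹ : F * F⁻¹ ≈ 1#)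
      (F⇝ : F ⇝ ⟦ f , 0# , 0# ⟧)
      (δ₁f³ : δ 1F (f ^ 3) ≈ ⟪ ℤ.- (ℤ.+ 3) ⟫ * F ^ 3)
      (δ₂f³ : δ 2F (f ^ 3) ≈ 0#)
      (norm-f : norm q (λ r → δ r f) * F ≈ f ^ 4)
      where

      -- w is the norm of the image z - 3 g t of x, and equals x⁴/g by wg≈x⁴.
      x g z w u : Carrier
      x = f ^ 3
      g = F ^ 3
      z = δ 0F x
      w = z * z * z - ⟪ ℤ.+ 27 ⟫ * q * (g * g * g)
      u = g ^ 4 * f⁻¹ ^ 3

      x⇝ : x ⇝ ⟦ z , ⟪ ℤ.- (ℤ.+ 3) ⟫ * g , 0# ⟧
      x⇝ 0F = refl
      x⇝ 1F = δ₁f³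
      x⇝ 2F = δ₂f³

      g⇝ : g ⇝ ⟦ x , 0# , 0# ⟧
      g⇝ = scalar-^ F⇝ 3

      -- Norms are multiplicative, so the norm of x is the cube of the norm of f and the claim is
      -- the cube of `norm-f`. Since x has no component 2, its norm reduces to z³ + q (-3g)³, whence
      -- the 27.
      wg≈x⁴ : w * g ≈ x ^ 4
      wg≈x⁴ = begin
        w * g ≈⟨ *-congʳ (solve 3 (λ q z g → let y = con (ℤ.- (ℤ.+ 3)) :* g in
                   z :* z :* z :- con (ℤ.+ 27) :* q :* (g :* g :* g)
                   := z :* z :* z :+ q :* (y :* y :* y) :+ q :* q :* (:0 :* :0 :* :0) :- con (ℤ.+ 3) :* q :* (z :* y :* :0))
                   refl q z g) ⟩
        norm q ⟦ z , ⟪ ℤ.- (ℤ.+ 3) ⟫ * g , 0# ⟧ * g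
          ≈⟨ *-congʳ (trans (norm-cong q (λ r → sym (x⇝ r))) (norm-cong q (⇝-^ (λ _ → refl) 3))) ⟩
        norm q (_^⊗_ q df 3) * g ≈⟨ *-congʳ (norm-^⊗ q df 3) ⟩
        N ^ 3 * g ≈⟨ solve 2 (λ N F → N :^ 3 :* F :^ 3 := (N :* F) :^ 3) refl N F ⟩
        (N * F) ^ 3 ≈⟨ ^-congˡ 3 norm-f ⟩
        (f ^ 4) ^ 3 ≈⟨ solve 1 (λ f → (f :^ 4) :^ 3 := (f :^ 3) :^ 4) refl f ⟩
        x ^ 4 ∎
        where
        df : Triple q
        df r = δ r f
        N = norm q df

      x*x⁻¹ : x * f⁻¹ ^ 3 ≈ 1#
      x*x⁻¹ = trans (solve 2 (λ a b → a :^ 3 :* b :^ 3 := (a :* b) :^ 3) refl f f⁻¹)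
        (trans (^-congˡ 3 f*f⁻¹) (solve 0 (:1 :^ 3 := :1) refl))

      g*g⁻¹ : g * F⁻¹ ^ 3 ≈ 1#
      g*g⁻¹ = trans (solve 2 (λ a b → a :^ 3 :* b :^ 3 := (a :* b) :^ 3) refl F F⁻¹)
        (trans (^-congˡ 3 F*F⁻¹) (solve 0 (:1 :^ 3 := :1) refl))

      -- The components are those of g times the adjugate of z - 3 g t, the
      -- image of x = g⁴/u.
      u⇝ : u ⇝ ⟦ g * (z * z) , ⟪ ℤ.+ 3 ⟫ * (z * (g * g)) , ⟪ ℤ.+ 9 ⟫ * (g * g * g) ⟧
      u⇝ r = trans (δ-scalar (scalar-^ g⇝ 4) r (f⁻¹ ^ 3)) (trans (*-congʳ (sym wg≈x⁴)) (cramer r))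
        where
        p₀ = δ 0F (f⁻¹ ^ 3)
        p₁ = δ 1F (f⁻¹ ^ 3)
        p₂ = δ 2F (f⁻¹ ^ 3)
        -- The image of x times that of 1/x is 1: three linear equations for p₀, p₁, p₂ with
        -- determinant w, which `cramer` solves.
        unit : ∀ r → (⟦ z , ⟪ ℤ.- (ℤ.+ 3) ⟫ * g , 0# ⟧ ⊠ (λ r → δ r (f⁻¹ ^ 3))) r ≈ ⟦ 1# , 0# , 0# ⟧ r
        unit r = trans (sym (⇝-* x⇝ (λ _ → refl) r)) (trans (δ-cong r x*x⁻¹) (δ-⟪⟫ r ℤ.1ℤ))
        module _ {n} (q z g p₀ p₁ p₂ : Polynomial n) where
          y′ = con (ℤ.- (ℤ.+ 3)) :* g
          w′ = z :* z :* z :- con (ℤ.+ 27) :* q :* (g :* g :* g)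
          e₀ = z :* p₀ :+ q :* (y′ :* p₂ :+ :0 :* p₁)
          e₁ = z :* p₁ :+ y′ :* p₀ :+ q :* (:0 :* p₂)
          e₂ = z :* p₂ :+ y′ :* p₁ :+ :0 :* p₀
        cramer : ∀ r → w * g * δ r (f⁻¹ ^ 3)
                 ≈ ⟦ g * (z * z) , ⟪ ℤ.+ 3 ⟫ * (z * (g * g)) , ⟪ ℤ.+ 9 ⟫ * (g * g * g) ⟧ r
        cramer 0F = trans
          (solve 6 (λ q z g p₀ p₁ p₂ → let y = y′ q z g p₀ p₁ p₂ in
            w′ q z g p₀ p₁ p₂ :* g :* p₀
            := g :* (z :* z :* e₀ q z g p₀ p₁ p₂ :- q :* y :* z :* e₂ q z g p₀ p₁ p₂ :+ q :* y :* y :* e₁ q z g p₀ p₁ p₂))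
            refl q z g p₀ p₁ p₂)
          (trans (*-congˡ (+-cong (+-cong (*-congˡ (unit 0F)) (-‿cong (*-congˡ (unit 2F)))) (*-congˡ (unit 1F))))
            (solve 4 (λ g z a b → g :* (z :* z :* :1 :- a :* :0 :+ b :* :0) := g :* (z :* z)) refl g z _ _))
        cramer 1F = trans
          (solve 6 (λ q z g p₀ p₁ p₂ → let y = y′ q z g p₀ p₁ p₂ in
            w′ q z g p₀ p₁ p₂ :* g :* p₁
            := g :* (z :* z :* e₁ q z g p₀ p₁ p₂ :- y :* z :* e₀ q z g p₀ p₁ p₂ :+ q :* y :* y :* e₂ q z g p₀ p₁ p₂))
            refl q z g p₀ p₁ p₂)
          (trans (*-congˡ (+-cong (+-cong (*-congˡ (unit 1F)) (-‿cong (*-congˡ (unit 0F)))) (*-congˡ (unit 2F))))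
            (solve 4 (λ g z a b → g :* (a :* :0 :- con (ℤ.- (ℤ.+ 3)) :* g :* z :* :1 :+ b :* :0) := con (ℤ.+ 3) :* (z :* (g :* g))) refl g z _ _))
        cramer 2F = trans
          (solve 6 (λ q z g p₀ p₁ p₂ → let y = y′ q z g p₀ p₁ p₂ in
            w′ q z g p₀ p₁ p₂ :* g :* p₂
            := g :* (z :* z :* e₂ q z g p₀ p₁ p₂ :- y :* z :* e₁ q z g p₀ p₁ p₂ :+ y :* y :* e₀ q z g p₀ p₁ p₂))
            refl q z g p₀ p₁ p₂)
          (trans (*-congˡ (+-cong (+-cong (*-congˡ (unit 2F)) (-‿cong (*-congˡ (unit 1F)))) (*-congˡ (unit 0F))))
            (solve 3 (λ g a b → let y = con (ℤ.- (ℤ.+ 3)) :* g in g :* (a :* :0 :- b :* :0 :+ y :* y :* :1) := con (ℤ.+ 9) :* (g :* g :* g)) refl g _ _))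

      private
        x⁻¹-cancel : ∀ n {a b} → x ^ n * a ≈ x ^ n * b → a ≈ b
        x⁻¹-cancel n {a} {b} eq = trans (sym (undo a)) (trans (*-congˡ eq) (undo b))
          where
          unit^ : ∀ n → (f⁻¹ ^ 3) ^ n * x ^ n ≈ 1#
          unit^ zero    = *-identityˡ 1#
          unit^ (suc n) = trans (solve 4 (λ a b c d → a :* b :* (c :* d) := c :* a :* (b :* d)) refl _ _ _ _)
            (trans (*-cong x*x⁻¹ (unit^ n)) (*-identityˡ 1#))
          undo : ∀ a → (f⁻¹ ^ 3) ^ n * (x ^ n * a) ≈ a
          undo a = trans (sym (*-assoc _ _ _)) (trans (*-congʳ (unit^ n)) (*-identityˡ a))

      x*u : x * u ≈ g ^ 4
      x*u = trans (solve 3 (λ x a b → x :* (a :* b) := x :* b :* a) refl x (g ^ 4) _) (trans (*-congʳ x*x⁻¹) (*-identityˡ _))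

      -- Compare the components 1 of g w = x⁴. On the left g is a scalar with image x; on the right
      -- the coefficient of t in (z - 3gt)⁴ is -12 z³g + 81 q g⁴, and z³ = w + 27 q g³ turns it into
      -- -12 w g + (81 - 324) q g⁴. Then w g = x⁴ and g⁴ = x u allow one factor x to be cancelled.
      δ₁w : δ 1F w ≈ ⟪ ℤ.- (ℤ.+ 12) ⟫ * x ^ 3 + ⟪ ℤ.- (ℤ.+ 243) ⟫ * (q * u)
      δ₁w = x⁻¹-cancel 1 (begin
        x ^ 1 * δ 1F w ≈⟨ *-congʳ (*-identityʳ x) ⟩
        x * δ 1F w ≈⟨ δ-scalar g⇝ 1F w ⟨
        δ 1F (g * w) ≈⟨ δ-cong 1F (trans (*-comm g w) wg≈x⁴) ⟩
        δ 1F (x ^ 4) ≈⟨ ⇝-^ x⇝ 4 1F ⟩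
        _ ≈⟨ solve 3 (λ q z g → let w = z :* z :* z :- con (ℤ.+ 27) :* q :* (g :* g :* g) in
               ^⊗ᴾ q (⟨_,_,_⟩ᴾ q z (con (ℤ.- (ℤ.+ 3)) :* g) :0) 4 1F
               := con (ℤ.- (ℤ.+ 12)) :* (w :* g) :+ con (ℤ.- (ℤ.+ 243)) :* (q :* g :^ 4)) refl q z g ⟩
        ⟪ ℤ.- (ℤ.+ 12) ⟫ * (w * g) + ⟪ ℤ.- (ℤ.+ 243) ⟫ * (q * g ^ 4)
          ≈⟨ +-cong (*-congˡ wg≈x⁴) (*-congˡ (*-congˡ (sym x*u))) ⟩
        _ ≈⟨ solve 3 (λ x q u → con (ℤ.- (ℤ.+ 12)) :* (x :^ 4) :+ con (ℤ.- (ℤ.+ 243)) :* (q :* (x :* u))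
               := x :^ 1 :* (con (ℤ.- (ℤ.+ 12)) :* x :^ 3 :+ con (ℤ.- (ℤ.+ 243)) :* (q :* u))) refl x q u ⟩
        _ ∎)

      -- The same with (w g)² = x⁸. Here 252 = 28·9 and -177147 = 3⁸ - 252·27². The coefficient of q
      -- z³ g⁵ in the expansion, 56·(-3)⁵, equals -252·54, so there is no mixed term.
      δ₂w² : δ 2F (w ^ 2) ≈ ⟪ ℤ.+ 252 ⟫ * x ^ 6 + ⟪ ℤ.- (ℤ.+ 177147) ⟫ * (q ^ 2 * u ^ 2)
      δ₂w² = x⁻¹-cancel 2 (begin
        x ^ 2 * δ 2F (w ^ 2) ≈⟨ δ-scalar (scalar-^ g⇝ 2) 2F (w ^ 2) ⟨
        δ 2F (g ^ 2 * w ^ 2) ≈⟨ δ-cong 2F (trans (solve 2 (λ g w → g :^ 2 :* w :^ 2 := (w :* g) :^ 2) refl g w)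
                                  (trans (^-congˡ 2 wg≈x⁴) (solve 1 (λ x → (x :^ 4) :^ 2 := x :^ 8) refl x))) ⟩
        δ 2F (x ^ 8) ≈⟨ ⇝-^ x⇝ 8 2F ⟩
        _ ≈⟨ solve 3 (λ q z g → let w = z :* z :* z :- con (ℤ.+ 27) :* q :* (g :* g :* g) in
               ^⊗ᴾ q (⟨_,_,_⟩ᴾ q z (con (ℤ.- (ℤ.+ 3)) :* g) :0) 8 2F
               := con (ℤ.+ 252) :* (w :* g) :^ 2 :+ con (ℤ.- (ℤ.+ 177147)) :* (q :^ 2 :* (g :^ 4) :^ 2)) refl q z g ⟩
        ⟪ ℤ.+ 252 ⟫ * (w * g) ^ 2 + ⟪ ℤ.- (ℤ.+ 177147) ⟫ * (q ^ 2 * (g ^ 4) ^ 2)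
          ≈⟨ +-cong (*-congˡ (^-congˡ 2 wg≈x⁴)) (*-congˡ (*-congˡ (^-congˡ 2 (sym x*u)))) ⟩
        _ ≈⟨ solve 3 (λ x q u → con (ℤ.+ 252) :* (x :^ 4) :^ 2 :+ con (ℤ.- (ℤ.+ 177147)) :* (q :^ 2 :* (x :* u) :^ 2)
               := x :^ 2 :* (con (ℤ.+ 252) :* x :^ 6 :+ con (ℤ.- (ℤ.+ 177147)) :* (q :^ 2 :* u :^ 2))) refl x q u ⟩
        _ ∎)

      height : Fin 3 → Fin 3 → ℕ → ℕ
      height J ρ i = 3 ℕ.* (toℕ J ℕ.∸ i) ℕ.+ toℕ ρ

      -- With k = 3J + ρ, these are qⁱ f₁^(3k-12i) f₃^(12i) and
      -- q^(J-i) f₁^(12i) f₃^(3k-12i), in a form without negative exponents.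
      basisE basisF : Fin 3 → Fin 3 → ℕ → Carrier
      basisE J ρ i = q ^ i * u ^ i * x ^ height J ρ i
      basisF J ρ i = q ^ (toℕ J ℕ.∸ i) * w ^ i * g ^ height J ρ i

      private
        matE-equation : ∀ J ρ (i : ℕ) {n} (q z g : Polynomial n) → Polynomial n × Polynomial n
        matE-equation J ρ i q z g =
          ⊗ᴾ q (⊗ᴾ q (^⊗ᴾ q (⟨_,_,_⟩ᴾ q :0 :1 :0) i)
                 (^⊗ᴾ q (⟨_,_,_⟩ᴾ q (g :* (z :* z)) (con (ℤ.+ 3) :* (z :* (g :* g))) (con (ℤ.+ 9) :* (g :* g :* g))) i))
            (^⊗ᴾ q (⟨_,_,_⟩ᴾ q z (con (ℤ.- (ℤ.+ 3)) :* g) :0) (height J ρ i)) ρ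
          := sumToᴾ (λ j → con (matE J ρ i j) :* (q :^ (toℕ J ℕ.∸ j) :* (z :* z :* z :- con (ℤ.+ 27) :* q :* (g :* g :* g)) :^ j
               :* g :^ height J ρ j)) (toℕ J)

      -- All images are polynomials in q, z, g, so each admissible triple J, ρ, i is one polynomial
      -- identity. By the grading, z enters component ρ only through z³.
      δ-basisE : ∀ J ρ {i} → i ℕ.≤ toℕ J →
                 δ ρ (basisE J ρ i) ≈ sumTo (λ j → ⟪ matE J ρ i j ⟫ * basisF J ρ j) (toℕ J)
      δ-basisE J ρ {i} i≤J = trans (⇝-* (⇝-* (⇝-^ δ-q i) (⇝-^ u⇝ i)) (⇝-^ x⇝ (height J ρ i)) ρ) (go J ρ i≤J)
        where
        go : ∀ J ρ {i} → i ℕ.≤ toℕ J →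
          ((_^⊗_ q ⟦ 0# , 1# , 0# ⟧ i
            ⊠ _^⊗_ q ⟦ g * (z * z) , ⟪ ℤ.+ 3 ⟫ * (z * (g * g)) , ⟪ ℤ.+ 9 ⟫ * (g * g * g) ⟧ i)
            ⊠ _^⊗_ q ⟦ z , ⟪ ℤ.- (ℤ.+ 3) ⟫ * g , 0# ⟧ (height J ρ i)) ρ
          ≈ sumTo (λ j → ⟪ matE J ρ i j ⟫ * basisF J ρ j) (toℕ J)
        go 0F 0F z≤n = solve 3 (matE-equation 0F 0F 0) refl q z g
        go 0F 1F z≤n = solve 3 (matE-equation 0F 1F 0) refl q z g
        go 0F 2F z≤n = solve 3 (matE-equation 0F 2F 0) refl q z g
        go 1F 0F z≤n = solve 3 (matE-equation 1F 0F 0) refl q z g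
        go 1F 0F (s≤s z≤n) = solve 3 (matE-equation 1F 0F 1) refl q z g
        go 1F 1F z≤n = solve 3 (matE-equation 1F 1F 0) refl q z g
        go 1F 1F (s≤s z≤n) = solve 3 (matE-equation 1F 1F 1) refl q z g
        go 1F 2F z≤n = solve 3 (matE-equation 1F 2F 0) refl q z g
        go 1F 2F (s≤s z≤n) = solve 3 (matE-equation 1F 2F 1) refl q z g
        go 2F 0F z≤n = solve 3 (matE-equation 2F 0F 0) refl q z g
        go 2F 0F (s≤s z≤n) = solve 3 (matE-equation 2F 0F 1) refl q z g
        go 2F 0F (s≤s (s≤s z≤n)) = solve 3 (matE-equation 2F 0F 2) refl q z g
        go 2F 1F z≤n = solve 3 (matE-equation 2F 1F 0) refl q z g
        go 2F 1F (s≤s z≤n) = solve 3 (matE-equation 2F 1F 1) refl q z g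
        go 2F 1F (s≤s (s≤s z≤n)) = solve 3 (matE-equation 2F 1F 2) refl q z g
        go 2F 2F z≤n = solve 3 (matE-equation 2F 2F 0) refl q z g
        go 2F 2F (s≤s z≤n) = solve 3 (matE-equation 2F 2F 1) refl q z g
        go 2F 2F (s≤s (s≤s z≤n)) = solve 3 (matE-equation 2F 2F 2) refl q z g

      private
        δ-q* : ∀ r a → δ r (q * a) ≈ ⟦ q * δ 2F a , δ 0F a , δ 1F a ⟧ r
        δ-q* r a = trans (⇝-* δ-q (λ _ → refl) r) (go r)
          where
          go : ∀ r → (⟦ 0# , 1# , 0# ⟧ ⊠ (λ r → δ r a)) r ≈ ⟦ q * δ 2F a , δ 0F a , δ 1F a ⟧ r
          go 0F = solve 4 (λ q x y z → :0 :* x :+ q :* (:1 :* z :+ :0 :* y) := q :* z) refl q (δ 0F a) (δ 1F a) (δ 2F a)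
          go 1F = solve 4 (λ q x y z → :0 :* y :+ :1 :* x :+ q :* (:0 :* z) := x) refl q (δ 0F a) (δ 1F a) (δ 2F a)
          go 2F = solve 3 (λ x y z → :0 :* z :+ :1 :* y :+ :0 :* x := y) refl (δ 0F a) (δ 1F a) (δ 2F a)

        q^0*w^0 : δ 0F (q ^ 0 * w ^ 0) ≈ 1#
        q^0*w^0 = trans (δ-cong 0F (*-identityˡ 1#)) (δ-⟪⟫ 0F ℤ.1ℤ)

        q^1*w^0 : δ 1F (q ^ 1 * w ^ 0) ≈ 1#
        q^1*w^0 = trans (δ-cong 1F (*-assoc q 1# 1#)) (trans (δ-q* 1F (1# * 1#)) q^0*w^0)

        q^2*w^0 : δ 2F (q ^ 2 * w ^ 0) ≈ 1#
        q^2*w^0 = trans (δ-cong 2F (*-assoc q (q ^ 1) 1#)) (trans (δ-q* 2F (q ^ 1 * 1#)) q^1*w^0)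

        q^0*w^1 : δ 1F (q ^ 0 * w ^ 1) ≈ ⟪ ℤ.- (ℤ.+ 12) ⟫ * x ^ 3 + ⟪ ℤ.- (ℤ.+ 243) ⟫ * (q * u)
        q^0*w^1 = trans (δ-cong 1F (trans (*-identityˡ (w ^ 1)) (*-identityʳ w))) δ₁w

        q^1*w^1 : δ 2F (q ^ 1 * w ^ 1) ≈ ⟪ ℤ.- (ℤ.+ 12) ⟫ * x ^ 3 + ⟪ ℤ.- (ℤ.+ 243) ⟫ * (q * u)
        q^1*w^1 = trans (δ-cong 2F (*-assoc q 1# (w ^ 1))) (trans (δ-q* 2F (1# * w ^ 1)) q^0*w^1)

        q^0*w^2 : δ 2F (q ^ 0 * w ^ 2) ≈ ⟪ ℤ.+ 252 ⟫ * x ^ 6 + ⟪ ℤ.- (ℤ.+ 177147) ⟫ * (q ^ 2 * u ^ 2)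
        q^0*w^2 = trans (δ-cong 2F (*-identityˡ (w ^ 2))) δ₂w²

      δ-basisF : ∀ J ρ {i} → i ℕ.≤ toℕ J →
                 δ J (basisF J ρ i) ≈ sumTo (λ j → ⟪ matF i j ⟫ * basisE J ρ j) (toℕ J)
      δ-basisF J ρ {i} i≤J = trans
        (trans (δ-cong J (*-comm (q ^ (toℕ J ℕ.∸ i) * w ^ i) (g ^ height J ρ i)))
               (δ-scalar (scalar-^ g⇝ (height J ρ i)) J (q ^ (toℕ J ℕ.∸ i) * w ^ i)))
        (go J i≤J)
        where
        X : Carrier
        X = x ^ toℕ ρ
        go : ∀ J {i} → i ℕ.≤ toℕ J → x ^ height J ρ i * δ J (q ^ (toℕ J ℕ.∸ i) * w ^ i)
             ≈ sumTo (λ j → ⟪ matF i j ⟫ * basisE J ρ j) (toℕ J)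
        go 0F z≤n = trans (*-congˡ q^0*w^0)
          (solve 1 (λ X → X :* :1 := :1 :* (:1 :* :1 :* X)) refl X)
        go 1F z≤n = trans (*-congˡ q^1*w^0)
          (solve 4 (λ q u x X → x :* (x :* (x :* X)) :* :1
            := :1 :* (:1 :* :1 :* (x :* (x :* (x :* X)))) :+ :0 :* (q :^ 1 :* u :^ 1 :* X)) refl q u x X)
        go 1F (s≤s z≤n) = trans (*-congˡ q^0*w^1)
          (solve 4 (λ q u x X → X :* (con (ℤ.- (ℤ.+ 12)) :* x :^ 3 :+ con (ℤ.- (ℤ.+ 243)) :* (q :* u))
            := con (ℤ.- (ℤ.+ 12)) :* (:1 :* :1 :* (x :* (x :* (x :* X)))) :+ con (ℤ.- (ℤ.+ 243)) :* (q :^ 1 :* u :^ 1 :* X)) refl q u x X)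
        go 2F z≤n = trans (*-congˡ q^2*w^0)
          (solve 4 (λ q u x X → let x³X = λ X → x :* (x :* (x :* X)) in x³X (x³X X) :* :1
            := :1 :* (:1 :* :1 :* x³X (x³X X)) :+ :0 :* (q :^ 1 :* u :^ 1 :* x³X X) :+ :0 :* (q :^ 2 :* u :^ 2 :* X)) refl q u x X)
        go 2F (s≤s z≤n) = trans (*-congˡ q^1*w^1)
          (solve 4 (λ q u x X → let x³X = λ X → x :* (x :* (x :* X)) in
            x³X X :* (con (ℤ.- (ℤ.+ 12)) :* x :^ 3 :+ con (ℤ.- (ℤ.+ 243)) :* (q :* u))
            := con (ℤ.- (ℤ.+ 12)) :* (:1 :* :1 :* x³X (x³X X)) :+ con (ℤ.- (ℤ.+ 243)) :* (q :^ 1 :* u :^ 1 :* x³X X)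
               :+ :0 :* (q :^ 2 :* u :^ 2 :* X)) refl q u x X)
        go 2F (s≤s (s≤s z≤n)) = trans (*-congˡ q^0*w^2)
          (solve 4 (λ q u x X → let x³X = λ X → x :* (x :* (x :* X)) in
            X :* (con (ℤ.+ 252) :* x :^ 6 :+ con (ℤ.- (ℤ.+ 177147)) :* (q :^ 2 :* u :^ 2))
            := con (ℤ.+ 252) :* (:1 :* :1 :* x³X (x³X X)) :+ :0 :* (q :^ 1 :* u :^ 1 :* x³X X)
               :+ con (ℤ.- (ℤ.+ 177147)) :* (q :^ 2 :* u :^ 2 :* X)) refl q u x X)

  -- Integer combinations and the action of a dissection on them

  sumTo-cong : ∀ {s t} K → (∀ {i} → i ℕ.≤ K → s i ≈ t i) → sumTo s K ≈ sumTo t K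
  sumTo-cong zero    eq = eq z≤n
  sumTo-cong (suc K) eq = +-cong (sumTo-cong K (λ i≤K → eq (ℕₚ.m≤n⇒m≤1+n i≤K))) (eq ℕₚ.≤-refl)

  combination : (ℕ → ℤ.ℤ) → (ℕ → Carrier) → ℕ → Carrier
  combination v b K = sumTo (λ i → ⟪ v i ⟫ * b i) K

  combination-scale : ∀ a v b K → ⟪ a ⟫ * combination v b K ≈ combination (λ j → a ℤ.* v j) b K
  combination-scale a v b zero    = trans (sym (*-assoc ⟪ a ⟫ ⟪ v 0 ⟫ (b 0))) (*-congʳ (sym (⟪⟫.*-homo a (v 0))))
  combination-scale a v b (suc K) = trans (distribˡ ⟪ a ⟫ _ _)
    (+-cong (combination-scale a v b K)
      (trans (sym (*-assoc ⟪ a ⟫ ⟪ v (suc K) ⟫ (b (suc K)))) (*-congʳ (sym (⟪⟫.*-homo a (v (suc K)))))))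

  combination-+ : ∀ v v′ b K → combination v b K + combination v′ b K ≈ combination (λ j → v j ℤ.+ v′ j) b K
  combination-+ v v′ b zero    = trans (sym (distribʳ (b 0) ⟪ v 0 ⟫ ⟪ v′ 0 ⟫)) (*-congʳ (sym (⟪⟫.+-homo (v 0) (v′ 0))))
  combination-+ v v′ b (suc K) = trans
    (solve 5 (λ s t x y z → s :+ x :* z :+ (t :+ y :* z) := s :+ t :+ (x :+ y) :* z) refl
      (combination v b K) (combination v′ b K) ⟪ v (suc K) ⟫ ⟪ v′ (suc K) ⟫ (b (suc K)))
    (+-cong (combination-+ v v′ b K) (*-congʳ (sym (⟪⟫.+-homo (v (suc K)) (v′ (suc K))))))

  combination-cong : ∀ {v v′} b K → (∀ {j} → j ℕ.≤ K → v j ≡ v′ j) → combination v b K ≈ combination v′ b K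
  combination-cong b K eq = sumTo-cong K (λ {j} j≤K → reflexive (≡.cong (λ c → ⟪ c ⟫ * b j) (eq j≤K)))

  combination-unit : ∀ b K → combination first b K ≈ b 0
  combination-unit b zero    = *-identityˡ (b 0)
  combination-unit b (suc K) = trans (+-cong (combination-unit b K) (zeroˡ (b (suc K)))) (+-identityʳ (b 0))

  module _ {q δ} (isDissection : IsDissection q δ) where
    open IsDissection isDissection
    open Dissection isDissection using (δ-⟪⟫*)

    δ-sumTo : ∀ r t K → δ r (sumTo t K) ≈ sumTo (λ i → δ r (t i)) K
    δ-sumTo r t zero    = refl
    δ-sumTo r t (suc K) = trans (δ-+ r (sumTo t K) (t (suc K))) (+-congʳ (δ-sumTo r t K))

    δ-combination : ∀ r v (m : ℕ → ℕ → ℤ.ℤ) {b b′ : ℕ → Carrier} K →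
      (∀ {i} → i ℕ.≤ K → δ r (b i) ≈ combination (m i) b′ K) →
      δ r (combination v b K) ≈ combination (v ·[ K ] m) b′ K
    δ-combination r v m {b} {b′} K δb = trans (δ-sumTo r (λ i → ⟪ v i ⟫ * b i) K) (go K (λ i≤K → δb i≤K))
      where
      term : ∀ i → δ r (b i) ≈ combination (m i) b′ K → δ r (⟪ v i ⟫ * b i) ≈ combination (λ j → v i ℤ.* m i j) b′ K
      term i eq = trans (δ-⟪⟫* r (v i) (b i)) (trans (*-congˡ eq) (combination-scale (v i) (m i) b′ K))
      go : ∀ N → (∀ {i} → i ℕ.≤ N → δ r (b i) ≈ combination (m i) b′ K) →
           sumTo (λ i → δ r (⟪ v i ⟫ * b i)) N ≈ combination (v ·[ N ] m) b′ K
      go zero    δb = term 0 (δb z≤n)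
      go (suc N) δb = trans (+-cong (go N (λ i≤N → δb (ℕₚ.m≤n⇒m≤1+n i≤N))) (term (suc N) (δb ℕₚ.≤-refl)))
        (combination-+ (v ·[ N ] m) (λ j → v (suc N) ℤ.* m (suc N) j) b′ K)

  -- Comparison with monomials having negative exponents

  -- The inverse is an argument because the ring is abstract; for power series this becomes `_↑_`.
  zpow : Carrier → Carrier → ℤ.ℤ → Carrier
  zpow a a⁻¹ (ℤ.+ n)    = a ^ n
  zpow a a⁻¹ ℤ.-[1+ n ] = a⁻¹ ^ suc n

  module _ {q δ} (isDissection : IsDissection q δ) where
    open Dissection isDissection
    open IsDissection isDissection using (δ-cong)

    module _ {f F f⁻¹ F⁻¹ : Carrier}
      (f*f⁻¹ : f * f⁻¹ ≈ 1#) (F*F⁻¹ : F * F⁻¹ ≈ 1#)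
      (F⇝ : F ⇝ ⟨_,_,_⟩ q f 0# 0#)
      (δ₁f³ : δ 1F (f ^ 3) ≈ ⟪ ℤ.- (ℤ.+ 3) ⟫ * F ^ 3)
      (δ₂f³ : δ 2F (f ^ 3) ≈ 0#)
      (norm-f : norm q (λ r → δ r f) * F ≈ f ^ 4)
      where
      open EtaQuotients f*f⁻¹ F*F⁻¹ F⇝ δ₁f³ δ₂f³ norm-f

      private
        k : Fin 3 → Fin 3 → ℕ
        k J ρ = 3 ℕ.* toℕ J ℕ.+ toℕ ρ

      basisE-zero : ∀ J ρ → basisE J ρ 0 ≈ f ^ (3 ℕ.* k J ρ)
      basisE-zero J ρ = trans (solve 1 (λ y → :1 :* :1 :* y := y) refl (x ^ k J ρ)) (^-assocʳ f 3 (k J ρ))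

      monomialE monomialF : Fin 3 → Fin 3 → ℕ → Carrier
      monomialE J ρ i = zpow f f⁻¹ (ℤ.+ (3 ℕ.* k J ρ) ℤ.- ℤ.+ (12 ℕ.* i)) * zpow F F⁻¹ (ℤ.+ (12 ℕ.* i))
      monomialF J ρ i = zpow f f⁻¹ (ℤ.+ (12 ℕ.* i)) * zpow F F⁻¹ (ℤ.+ (3 ℕ.* k J ρ) ℤ.- ℤ.+ (12 ℕ.* i))

      private
        u*x^ : ∀ m → q ^ 1 * u ^ 1 * x ^ suc m ≈ q ^ 1 * (f ^ (3 ℕ.* m) * F ^ 12)
        u*x^ m = trans (solve 4 (λ q u x y → q :* u :^ 1 :* (x :* y) := q :* (x :* u :* y)) refl (q ^ 1) u x (x ^ m))
          (*-congˡ (trans (*-cong x*u (^-assocʳ f 3 m))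
            (solve 2 (λ F y → (F :^ 3) :^ 4 :* y := y :* F :^ 12) refl F (f ^ (3 ℕ.* m)))))
        w*g^ : ∀ p m → p * w ^ 1 * g ^ suc m ≈ p * (f ^ 12 * F ^ (3 ℕ.* m))
        w*g^ p m = trans (solve 4 (λ q u x y → q :* u :^ 1 :* (x :* y) := q :* (u :* x :* y)) refl p w g (g ^ m))
          (*-congˡ (*-cong (trans wg≈x⁴ (solve 1 (λ F → (F :^ 3) :^ 4 := F :^ 12) refl f)) (^-assocʳ F 3 m)))
        w≈ : w ≈ x ^ 4 * F⁻¹ ^ 3
        w≈ = begin
          w ≈⟨ *-identityʳ w ⟨
          w * 1# ≈⟨ *-congˡ g*g⁻¹ ⟨
          w * (g * F⁻¹ ^ 3) ≈⟨ *-assoc w g (F⁻¹ ^ 3) ⟨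
          w * g * F⁻¹ ^ 3 ≈⟨ *-congʳ wg≈x⁴ ⟩
          x ^ 4 * F⁻¹ ^ 3 ∎

        basisE₀ : ∀ J ρ → basisE J ρ 0 ≈ q ^ 0 * monomialE J ρ 0
        basisE₀ J ρ = begin
          1# * 1# * x ^ k J ρ ≈⟨ solve 1 (λ y → :1 :* :1 :* y := :1 :* (y :* :1)) refl (x ^ k J ρ) ⟩
          1# * (x ^ k J ρ * 1#) ≈⟨ *-congˡ (*-congʳ (^-assocʳ f 3 (k J ρ))) ⟩
          1# * (f ^ (3 ℕ.* k J ρ) * 1#)
            ≡⟨ ≡.cong (λ e → 1# * (zpow f f⁻¹ e * 1#)) (ℤₚ.+-identityʳ (ℤ.+ (3 ℕ.* k J ρ))) ⟨
          q ^ 0 * monomialE J ρ 0 ∎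

        basisF₀ : ∀ J ρ → basisF J ρ 0 ≈ q ^ toℕ J * monomialF J ρ 0
        basisF₀ J ρ = begin
          q ^ toℕ J * 1# * g ^ k J ρ ≈⟨ *-assoc (q ^ toℕ J) 1# (g ^ k J ρ) ⟩
          q ^ toℕ J * (1# * g ^ k J ρ) ≈⟨ *-congˡ (*-congˡ (^-assocʳ F 3 (k J ρ))) ⟩
          q ^ toℕ J * (1# * F ^ (3 ℕ.* k J ρ))
            ≡⟨ ≡.cong (λ e → q ^ toℕ J * (1# * zpow F F⁻¹ e)) (ℤₚ.+-identityʳ (ℤ.+ (3 ℕ.* k J ρ))) ⟨
          q ^ toℕ J * monomialF J ρ 0 ∎

      basisE≈ : ∀ J ρ {i} → i ℕ.≤ toℕ J → basisE J ρ i ≈ q ^ i * monomialE J ρ i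
      basisE≈ 0F ρ z≤n = basisE₀ 0F ρ
      basisE≈ 1F ρ z≤n = basisE₀ 1F ρ
      basisE≈ 2F ρ z≤n = basisE₀ 2F ρ
      -- For ρ = 0 and i = J no factor x is left to cancel the 1/x inside u, and a negative power of
      -- f survives; in the other cases x u = g⁴ removes it as far as possible.
      basisE≈ 1F 0F (s≤s z≤n) = solve 3 (λ q f⁻¹ F → q :^ 1 :* ((F :^ 3) :^ 4 :* f⁻¹ :^ 3) :^ 1 :* :1
                                  := q :^ 1 :* (f⁻¹ :^ 3 :* F :^ 12)) refl q f⁻¹ F
      basisE≈ 1F 1F (s≤s z≤n) = u*x^ 0
      basisE≈ 1F 2F (s≤s z≤n) = u*x^ 1
      basisE≈ 2F 0F (s≤s z≤n) = u*x^ 2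
      basisE≈ 2F 1F (s≤s z≤n) = u*x^ 3
      basisE≈ 2F 2F (s≤s z≤n) = u*x^ 4
      basisE≈ 2F 0F (s≤s (s≤s z≤n)) = solve 3 (λ q f⁻¹ F → q :^ 2 :* ((F :^ 3) :^ 4 :* f⁻¹ :^ 3) :^ 2 :* :1
                                         := q :^ 2 :* (f⁻¹ :^ 6 :* F :^ 24)) refl q f⁻¹ F
      basisE≈ 2F 1F (s≤s (s≤s z≤n)) = trans
        (solve 3 (λ q u x → q :* u :^ 2 :* (x :* :1) := q :* (x :* u :* u)) refl (q ^ 2) u x)
        (*-congˡ (trans (*-congʳ x*u) (solve 2 (λ F f⁻¹ → (F :^ 3) :^ 4 :* ((F :^ 3) :^ 4 :* f⁻¹ :^ 3) := f⁻¹ :^ 3 :* F :^ 24) refl F f⁻¹)))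
      basisE≈ 2F 2F (s≤s (s≤s z≤n)) = trans
        (solve 3 (λ q u x → q :* u :^ 2 :* (x :* (x :* :1)) := q :* (x :* u :* (x :* u))) refl (q ^ 2) u x)
        (*-congˡ (trans (*-cong x*u x*u) (solve 1 (λ F → (F :^ 3) :^ 4 :* (F :^ 3) :^ 4 := :1 :* F :^ 24) refl F)))

      basisF≈ : ∀ J ρ {i} → i ℕ.≤ toℕ J → basisF J ρ i ≈ q ^ (toℕ J ℕ.∸ i) * monomialF J ρ i
      basisF≈ 0F ρ z≤n = basisF₀ 0F ρ
      basisF≈ 1F ρ z≤n = basisF₀ 1F ρ
      basisF≈ 2F ρ z≤n = basisF₀ 2F ρ
      basisF≈ 1F 0F (s≤s z≤n) = trans (*-congʳ (*-congˡ (^-congˡ 1 w≈)))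
        (solve 2 (λ f F⁻¹ → :1 :* ((f :^ 3) :^ 4 :* F⁻¹ :^ 3) :^ 1 :* :1 := :1 :* (f :^ 12 :* F⁻¹ :^ 3)) refl f F⁻¹)
      basisF≈ 1F 1F (s≤s z≤n) = w*g^ (q ^ 0) 0
      basisF≈ 1F 2F (s≤s z≤n) = w*g^ (q ^ 0) 1
      basisF≈ 2F 0F (s≤s z≤n) = w*g^ (q ^ 1) 2
      basisF≈ 2F 1F (s≤s z≤n) = w*g^ (q ^ 1) 3
      basisF≈ 2F 2F (s≤s z≤n) = w*g^ (q ^ 1) 4
      basisF≈ 2F 0F (s≤s (s≤s z≤n)) = trans (*-congʳ (*-congˡ (^-congˡ 2 w≈)))
        (solve 2 (λ f F⁻¹ → :1 :* ((f :^ 3) :^ 4 :* F⁻¹ :^ 3) :^ 2 :* :1 := :1 :* (f :^ 24 :* F⁻¹ :^ 6)) refl f F⁻¹)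
      basisF≈ 2F 1F (s≤s (s≤s z≤n)) = trans
        (solve 2 (λ u x → :1 :* u :^ 2 :* (x :* :1) := :1 :* (u :* x :* u)) refl w g)
        (*-congˡ (trans (*-cong wg≈x⁴ w≈) (solve 2 (λ f F⁻¹ → (f :^ 3) :^ 4 :* ((f :^ 3) :^ 4 :* F⁻¹ :^ 3) := f :^ 24 :* F⁻¹ :^ 3) refl f F⁻¹)))
      basisF≈ 2F 2F (s≤s (s≤s z≤n)) = trans
        (solve 2 (λ u x → :1 :* u :^ 2 :* (x :* (x :* :1)) := :1 :* (u :* x :* (u :* x))) refl w g)
        (*-congˡ (trans (*-cong wg≈x⁴ wg≈x⁴) (solve 1 (λ F → (F :^ 3) :^ 4 :* (F :^ 3) :^ 4 := F :^ 24 :* :1) refl f)))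

  -- Dissection of the theta series and the norm of the finite product

  module _ {q δ} (isDissection : IsDissection q δ) where
    open IsDissection isDissection
    open Dissection isDissection

    private
      ⟦_,_,_⟧ : Carrier → Carrier → Carrier → Triple q
      ⟦_,_,_⟧ = ⟨_,_,_⟩ q

    q³⇝ : q ^ 3 ⇝ ⟦ q , 0# , 0# ⟧
    q³⇝ r = trans (⇝-^ δ-q 3 r) (go r)
      where
      go : ∀ r → _^⊗_ q ⟦ 0# , 1# , 0# ⟧ 3 r ≈ ⟦ q , 0# , 0# ⟧ r
      go 0F = solve 1 (λ q → ^⊗ᴾ q (⟨_,_,_⟩ᴾ q :0 :1 :0) 3 0F := q) refl q
      go 1F = solve 1 (λ q → ^⊗ᴾ q (⟨_,_,_⟩ᴾ q :0 :1 :0) 3 1F := :0) refl q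
      go 2F = solve 1 (λ q → ^⊗ᴾ q (⟨_,_,_⟩ᴾ q :0 :1 :0) 3 2F := :0) refl q

    q^[3t]⇝ : ∀ t → q ^ (3 ℕ.* t) ⇝ ⟦ q ^ t , 0# , 0# ⟧
    q^[3t]⇝ t r = trans (δ-cong r (sym (^-assocʳ q 3 t))) (scalar-^ q³⇝ t r)

    q^[1+3t]⇝ : ∀ t → q ^ (1 ℕ.+ 3 ℕ.* t) ⇝ ⟦ 0# , q ^ t , 0# ⟧
    q^[1+3t]⇝ t r = trans (⇝-* δ-q (q^[3t]⇝ t) r) (go r)
      where
      go : ∀ r → (_⊗_ q ⟦ 0# , 1# , 0# ⟧ ⟦ q ^ t , 0# , 0# ⟧) r ≈ ⟦ 0# , q ^ t , 0# ⟧ r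
      go 0F = solve 2 (λ q a → ⊗ᴾ q (⟨_,_,_⟩ᴾ q :0 :1 :0) (⟨_,_,_⟩ᴾ q a :0 :0) 0F := :0) refl q (q ^ t)
      go 1F = solve 2 (λ q a → ⊗ᴾ q (⟨_,_,_⟩ᴾ q :0 :1 :0) (⟨_,_,_⟩ᴾ q a :0 :0) 1F := a) refl q (q ^ t)
      go 2F = solve 2 (λ q a → ⊗ᴾ q (⟨_,_,_⟩ᴾ q :0 :1 :0) (⟨_,_,_⟩ᴾ q a :0 :0) 2F := :0) refl q (q ^ t)

    q^[2+3t]⇝ : ∀ t → q ^ (2 ℕ.+ 3 ℕ.* t) ⇝ ⟦ 0# , 0# , q ^ t ⟧
    q^[2+3t]⇝ t r = trans (⇝-* δ-q (q^[1+3t]⇝ t) r) (go r)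
      where
      go : ∀ r → (_⊗_ q ⟦ 0# , 1# , 0# ⟧ ⟦ 0# , q ^ t , 0# ⟧) r ≈ ⟦ 0# , 0# , q ^ t ⟧ r
      go 0F = solve 2 (λ q a → ⊗ᴾ q (⟨_,_,_⟩ᴾ q :0 :1 :0) (⟨_,_,_⟩ᴾ q :0 a :0) 0F := :0) refl q (q ^ t)
      go 1F = solve 2 (λ q a → ⊗ᴾ q (⟨_,_,_⟩ᴾ q :0 :1 :0) (⟨_,_,_⟩ᴾ q :0 a :0) 1F := :0) refl q (q ^ t)
      go 2F = solve 2 (λ q a → ⊗ᴾ q (⟨_,_,_⟩ᴾ q :0 :1 :0) (⟨_,_,_⟩ᴾ q :0 a :0) 2F := a) refl q (q ^ t)

    private
      θ : ℕ → Carrier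
      θ = θ-term q

      block : ℕ → Carrier
      block m = θ (m ℕ.* 3) + θ (1 ℕ.+ m ℕ.* 3) + θ (2 ℕ.+ m ℕ.* 3)

      blocks : ∀ M → sumTo θ (2 ℕ.+ M ℕ.* 3) ≈ sumTo block M
      blocks zero    = refl
      blocks (suc M) = trans (+-congʳ (+-congʳ (+-congʳ (blocks M))))
        (solve 4 (λ s a b c → s :+ a :+ b :+ c := s :+ (a :+ b :+ c)) refl
          (sumTo block M) (θ (3 ℕ.+ M ℕ.* 3)) (θ (4 ℕ.+ M ℕ.* 3)) (θ (5 ℕ.+ M ℕ.* 3)))

      δ-θ : ∀ r k {s} → q ^ triangular k ⇝ s → δ r (θ k) ≈ ⟪ θ-coeff k ⟫ * s r
      δ-θ r k p = trans (δ-⟪⟫* r (θ-coeff k) (q ^ triangular k)) (*-congˡ (p r))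

      ^-≡ : ∀ {m n s} → m ≡ n → q ^ n ⇝ s → q ^ m ⇝ s
      ^-≡ ≡.refl p = p

      -- The three exponents of a block are 0, 1, 0 modulo 3. Class 2 is therefore empty, and class
      -- 1 holds only the middle term, whose exponent and coefficient are those of a theta term in
      -- q³ times -3.
      δ₁₂-block : ∀ m → (δ 1F (block m) ≈ ⟪ ℤ.- (ℤ.+ 3) ⟫ * (⟪ θ-coeff m ⟫ * q ^ (3 ℕ.* triangular m)))
                      × (δ 2F (block m) ≈ 0#)
      δ₁₂-block m = (begin
          δ 1F (block m) ≈⟨ expand 1F ⟩
          ⟪ θ-coeff (m ℕ.* 3) ⟫ * 0# + ⟪ θ-coeff (1 ℕ.+ m ℕ.* 3) ⟫ * q ^ (3 ℕ.* triangular m) + ⟪ θ-coeff (2 ℕ.+ m ℕ.* 3) ⟫ * 0#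
            ≈⟨ solve 3 (λ a b c → a :* :0 :+ b :+ c :* :0 := b) refl ⟪ θ-coeff (m ℕ.* 3) ⟫ _ ⟪ θ-coeff (2 ℕ.+ m ℕ.* 3) ⟫ ⟩
          ⟪ θ-coeff (1 ℕ.+ m ℕ.* 3) ⟫ * q ^ (3 ℕ.* triangular m)
            ≈⟨ *-congʳ (trans (reflexive (≡.cong ⟪_⟫ (θ-coeff[3m+1] m))) (⟪⟫.*-homo (ℤ.- (ℤ.+ 3)) (θ-coeff m))) ⟩
          ⟪ ℤ.- (ℤ.+ 3) ⟫ * ⟪ θ-coeff m ⟫ * q ^ (3 ℕ.* triangular m) ≈⟨ *-assoc _ _ _ ⟩
          _ ∎)
        , (begin
          δ 2F (block m) ≈⟨ expand 2F ⟩
          _ ≈⟨ solve 3 (λ a b c → a :* :0 :+ b :* :0 :+ c :* :0 := :0) refl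
                 ⟪ θ-coeff (m ℕ.* 3) ⟫ ⟪ θ-coeff (1 ℕ.+ m ℕ.* 3) ⟫ ⟪ θ-coeff (2 ℕ.+ m ℕ.* 3) ⟫ ⟩
          0# ∎)
        where
        t₀ = proj₁ (triangular[3m] m)
        t₂ = proj₁ (triangular[3m+2] m)
        expand : ∀ r → δ r (block m) ≈ ⟪ θ-coeff (m ℕ.* 3) ⟫ * ⟦ q ^ t₀ , 0# , 0# ⟧ r
                   + ⟪ θ-coeff (1 ℕ.+ m ℕ.* 3) ⟫ * ⟦ 0# , q ^ (3 ℕ.* triangular m) , 0# ⟧ r
                   + ⟪ θ-coeff (2 ℕ.+ m ℕ.* 3) ⟫ * ⟦ q ^ t₂ , 0# , 0# ⟧ r
        expand r = trans (trans (δ-+ r _ _) (+-congʳ (δ-+ r _ _)))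
          (+-cong (+-cong (δ-θ r (m ℕ.* 3) (^-≡ (proj₁ (proj₂ (triangular[3m] m))) (q^[3t]⇝ t₀)))
                          (δ-θ r (1 ℕ.+ m ℕ.* 3) (^-≡ (triangular[3m+1] m) (q^[1+3t]⇝ (3 ℕ.* triangular m)))))
                  (δ-θ r (2 ℕ.+ m ℕ.* 3) (^-≡ (proj₂ (triangular[3m+2] m)) (q^[3t]⇝ t₂))))

      sumTo-zero : ∀ K → sumTo (λ _ → 0#) K ≈ 0#
      sumTo-zero zero    = refl
      sumTo-zero (suc K) = trans (+-identityʳ _) (sumTo-zero K)

      sumTo-* : ∀ a t K → sumTo (λ k → a * t k) K ≈ a * sumTo t K
      sumTo-* a t zero    = refl
      sumTo-* a t (suc K) = trans (+-congʳ (sumTo-* a t K)) (sym (distribˡ a _ _))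

    δ₂-θ : ∀ M → δ 2F (sumTo θ (2 ℕ.+ M ℕ.* 3)) ≈ 0#
    δ₂-θ M = trans (δ-cong 2F (blocks M)) (trans (δ-sumTo isDissection 2F block M)
      (trans (sumTo-cong M (λ {i} _ → proj₂ (δ₁₂-block i))) (sumTo-zero M)))

    -- Class 1 of the theta series is a theta series in q³. Dissecting once more returns it to q, so
    -- that it can be compared with the series of f₁³ instead of one for f₃³.
    δδ₁-θ : ∀ r M → δ r (δ 1F (sumTo θ (2 ℕ.+ M ℕ.* 3))) ≈ ⟦ ⟪ ℤ.- (ℤ.+ 3) ⟫ * sumTo θ M , 0# , 0# ⟧ r
    δδ₁-θ r M = trans (δ-cong r (trans (δ-cong 1F (blocks M)) (trans (δ-sumTo isDissection 1F block M)
        (sumTo-cong M (λ {i} _ → proj₁ (δ₁₂-block i))))))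
      (trans (δ-sumTo isDissection r _ M) (trans (sumTo-cong M (λ {i} _ → term r i)) (total r)))
      where
      term : ∀ r i → δ r (⟪ ℤ.- (ℤ.+ 3) ⟫ * (⟪ θ-coeff i ⟫ * q ^ (3 ℕ.* triangular i)))
                     ≈ ⟪ ℤ.- (ℤ.+ 3) ⟫ * (⟪ θ-coeff i ⟫ * ⟦ q ^ triangular i , 0# , 0# ⟧ r)
      term r i = trans (δ-⟪⟫* r (ℤ.- (ℤ.+ 3)) _)
        (*-congˡ (trans (δ-⟪⟫* r (θ-coeff i) _) (*-congˡ (q^[3t]⇝ (triangular i) r))))
      zeros : sumTo (λ i → ⟪ ℤ.- (ℤ.+ 3) ⟫ * (⟪ θ-coeff i ⟫ * 0#)) M ≈ 0#
      zeros = trans (sumTo-cong M (λ {i} _ → trans (*-congˡ (zeroʳ ⟪ θ-coeff i ⟫)) (zeroʳ ⟪ ℤ.- (ℤ.+ 3) ⟫))) (sumTo-zero M)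
      total : ∀ r → sumTo (λ i → ⟪ ℤ.- (ℤ.+ 3) ⟫ * (⟪ θ-coeff i ⟫ * ⟦ q ^ triangular i , 0# , 0# ⟧ r)) M
              ≈ ⟦ ⟪ ℤ.- (ℤ.+ 3) ⟫ * sumTo θ M , 0# , 0# ⟧ r
      total 0F = sumTo-* ⟪ ℤ.- (ℤ.+ 3) ⟫ θ M
      total 1F = zeros
      total 2F = zeros

    private
      δ-1- : ∀ {a s} → a ⇝ s → ∀ r → δ r (1# - a) ≈ ⟦ 1# , 0# , 0# ⟧ r - s r
      δ-1- {a} {s} p r = trans (δ-+ r 1# (- a)) (+-cong (δ-⟪⟫ r ℤ.1ℤ)
        (trans (δ-cong r (solve 1 (λ a → :- a := con (ℤ.- (ℤ.+ 1)) :* a) refl a))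
          (trans (δ-⟪⟫* r (ℤ.- (ℤ.+ 1)) a)
            (trans (*-congˡ (p r)) (solve 1 (λ a → con (ℤ.- (ℤ.+ 1)) :* a := :- a) refl (s r))))))

      1-scalar : ∀ {a b} → a ⇝ ⟦ b , 0# , 0# ⟧ → 1# - a ⇝ ⟦ 1# - b , 0# , 0# ⟧
      1-scalar p r = trans (δ-1- p r) (go r)
        where
        go : ∀ r → ⟦ 1# , 0# , 0# ⟧ r - ⟦ _ , 0# , 0# ⟧ r ≈ ⟦ 1# - _ , 0# , 0# ⟧ r
        go 0F = refl
        go 1F = solve 0 (:0 :- :0 := :0) refl
        go 2F = solve 0 (:0 :- :0 := :0) refl

    qPochhammer-scalar : ∀ N → qPochhammer (q ^ 3) N ⇝ ⟦ qPochhammer q N , 0# , 0# ⟧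
    qPochhammer-scalar zero    r = δ-⟪⟫ r ℤ.1ℤ
    qPochhammer-scalar (suc N) r = trans (δ-scalar (1-scalar (scalar-^ q³⇝ (suc N))) r _)
      (trans (*-congˡ (qPochhammer-scalar N r)) (go r))
      where
      go : ∀ r → (1# - q ^ suc N) * ⟦ qPochhammer q N , 0# , 0# ⟧ r ≈ ⟦ qPochhammer q (suc N) , 0# , 0# ⟧ r
      go 0F = refl
      go 1F = zeroʳ _
      go 2F = zeroʳ _

    private
      N : Carrier → Carrier
      N a = norm q (λ r → δ r a)

      N-* : ∀ a b → N (a * b) ≈ N a * N b
      N-* a b = trans (norm-cong q (λ r → δ-* r a b)) (norm-⊗ q (λ r → δ r a) (λ r → δ r b))

      -- The conjugates of 1 - t^m, the image of 1 - q^m, are 1 - ωʲ t^m for a primitive cube root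
      -- of unity ω. They coincide if 3 divides m; otherwise their product is 1 - t^(3m) = 1 - q^m.
      -- This lemma and the next two are these cases for m modulo 3.
      N-1-q^[3t] : ∀ t → N (1# - q ^ (3 ℕ.* t)) ≈ (1# - q ^ t) * (1# - q ^ t) * (1# - q ^ t)
      N-1-q^[3t] t = trans (norm-cong q (1-scalar (q^[3t]⇝ t)))
        (solve 2 (λ q a → a :* a :* a :+ q :* (:0 :* :0 :* :0) :+ q :* q :* (:0 :* :0 :* :0) :- con (ℤ.+ 3) :* q :* (a :* :0 :* :0)
          := a :* a :* a) refl q (1# - q ^ t))

      q^[3t] : ∀ t → q ^ t * q ^ t * q ^ t ≈ q ^ (3 ℕ.* t)
      q^[3t] t = trans (trans (*-congʳ (sym (^-homo-* q t t))) (sym (^-homo-* q (t ℕ.+ t) t)))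
        (reflexive (≡.cong (q ^_) (ℕSolver.solve 1 (λ t → t ℕSolver.:+ t ℕSolver.:+ t ℕSolver.:= ℕSolver.con 3 ℕSolver.:* t) ≡.refl t)))

      N-1-q^[1+3t] : ∀ t → N (1# - q ^ (1 ℕ.+ 3 ℕ.* t)) ≈ 1# - q ^ (1 ℕ.+ 3 ℕ.* t)
      N-1-q^[1+3t] t = trans (norm-cong q (δ-1- (q^[1+3t]⇝ t)))
        (trans (solve 2 (λ q a → let x = :1 :- :0 ; y = :0 :- a ; z = :0 :- :0 in
            x :* x :* x :+ q :* (y :* y :* y) :+ q :* q :* (z :* z :* z) :- con (ℤ.+ 3) :* q :* (x :* y :* z)
            := :1 :- q :* (a :* a :* a)) refl q (q ^ t))
          (+-congˡ (-‿cong (*-congˡ (q^[3t] t)))))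

      N-1-q^[2+3t] : ∀ t → N (1# - q ^ (2 ℕ.+ 3 ℕ.* t)) ≈ 1# - q ^ (2 ℕ.+ 3 ℕ.* t)
      N-1-q^[2+3t] t = trans (norm-cong q (δ-1- (q^[2+3t]⇝ t)))
        (trans (solve 2 (λ q a → let x = :1 :- :0 ; y = :0 :- :0 ; z = :0 :- a in
            x :* x :* x :+ q :* (y :* y :* y) :+ q :* q :* (z :* z :* z) :- con (ℤ.+ 3) :* q :* (x :* y :* z)
            := :1 :- q :* (q :* (a :* a :* a))) refl q (q ^ t))
          (+-congˡ (-‿cong (*-congˡ (*-congˡ (q^[3t] t))))))

    -- The norm keeps the factors 1 - q^m with m prime to 3 and replaces 1 - q^(3j) by (1 - q^j)³;
    -- the second factor on the left supplies the lost 1 - q^(3j) again.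
    finite-norm : ∀ M → let e = qPochhammer q in
      norm q (λ r → δ r (e (M ℕ.* 3))) * qPochhammer (q ^ 3) M ≈ e (M ℕ.* 3) * (e M * e M * e M)
    finite-norm zero = trans (*-congʳ (norm-cong q (λ r → δ-⟪⟫ r ℤ.1ℤ)))
      (solve 1 (λ q → (:1 :* :1 :* :1 :+ q :* (:0 :* :0 :* :0) :+ q :* q :* (:0 :* :0 :* :0) :- con (ℤ.+ 3) :* q :* (:1 :* :0 :* :0)) :* :1
        := :1 :* (:1 :* :1 :* :1)) refl q)
    finite-norm (suc M) = begin
      N (a₃ * (a₂ * (a₁ * e (M ℕ.* 3)))) * (b₃ * P)
        ≈⟨ *-congʳ (trans (N-* _ _) (*-cong N₃ (trans (N-* _ _) (*-cong N₂ (trans (N-* _ _) (*-congʳ N₁)))))) ⟩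
      d * d * d * (a₂ * (a₁ * N (e (M ℕ.* 3)))) * (b₃ * P)
        ≈⟨ solve 6 (λ d a₂ a₁ n b P → d :* d :* d :* (a₂ :* (a₁ :* n)) :* (b :* P) := b :* a₂ :* a₁ :* (d :* d :* d) :* (n :* P)) refl
             d a₂ a₁ (N (e (M ℕ.* 3))) b₃ P ⟩
      b₃ * a₂ * a₁ * (d * d * d) * (N (e (M ℕ.* 3)) * P) ≈⟨ *-cong (*-congʳ (*-congʳ (*-congʳ b₃≈a₃))) (finite-norm M) ⟩
      a₃ * a₂ * a₁ * (d * d * d) * (e (M ℕ.* 3) * (e M * e M * e M))
        ≈⟨ solve 6 (λ a₃ a₂ a₁ d e₃ e → a₃ :* a₂ :* a₁ :* (d :* d :* d) :* (e₃ :* (e :* e :* e))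
             := a₃ :* (a₂ :* (a₁ :* e₃)) :* (d :* e :* (d :* e) :* (d :* e))) refl a₃ a₂ a₁ d (e (M ℕ.* 3)) (e M) ⟩
      _ ∎
      where
      e = qPochhammer q
      P = qPochhammer (q ^ 3) M
      d = 1# - q ^ suc M
      a₁ = 1# - q ^ (1 ℕ.+ M ℕ.* 3)
      a₂ = 1# - q ^ (2 ℕ.+ M ℕ.* 3)
      a₃ = 1# - q ^ (3 ℕ.+ M ℕ.* 3)
      b₃ = 1# - (q ^ 3) ^ suc M
      M*3 : M ℕ.* 3 ≡ 3 ℕ.* M
      M*3 = ℕₚ.*-comm M 3
      b₃≈a₃ : b₃ ≈ a₃
      b₃≈a₃ = +-congˡ (-‿cong (trans (^-assocʳ q 3 (suc M)) (reflexive (≡.cong (q ^_) (ℕₚ.*-comm 3 (suc M))))))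
      N₁ : N a₁ ≈ a₁
      N₁ = ≡.subst (λ m → N (1# - q ^ (1 ℕ.+ m)) ≈ 1# - q ^ (1 ℕ.+ m)) (≡.sym M*3) (N-1-q^[1+3t] M)
      N₂ : N a₂ ≈ a₂
      N₂ = ≡.subst (λ m → N (1# - q ^ (2 ℕ.+ m)) ≈ 1# - q ^ (2 ℕ.+ m)) (≡.sym M*3) (N-1-q^[2+3t] M)
      N₃ : N a₃ ≈ d * d * d
      N₃ = ≡.subst (λ m → N (1# - q ^ m) ≈ d * d * d) (ℕₚ.*-comm 3 (suc M)) (N-1-q^[3t] (suc M))

open import Defs
open import Data.Nat.Base using (_≤_; _/_; _∸_)
open import Data.Nat.DivMod using (m*n/n≡m)
open import Data.Bool.Base using (if_then_else_)
open import Data.Integer.Base using (ℤ; +_; -[1+_]; 0ℤ; 1ℤ; _+_; _*_; -_; _-_)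
open import Function.Base using (_∘_)
open import Relation.Binary.PropositionalEquality using (refl; cong; cong₂; sym; trans)

-- The recurrent sequences and the transition matrices

∑ℤ-cong : ∀ {s t} K → (∀ i → s i ≡ t i) → ∑ℤ s K ≡ ∑ℤ t K
∑ℤ-cong zero    eq = eq 0
∑ℤ-cong (suc K) eq = cong₂ _+_ (∑ℤ-cong K eq) (eq (suc K))

·-linear : ∀ a b v v′ m K j →
           ((λ i → a * v i + b * v′ i) ·[ K ] m) j ≡ a * (v ·[ K ] m) j + b * (v′ ·[ K ] m) j
·-linear a b v v′ m zero j = solve 5 (λ a b x y z → (a :* x :+ b :* y) :* z := a :* (x :* z) :+ b :* (y :* z))
  refl a b (v 0) (v′ 0) (m 0 j)
  where open ℤSolver
·-linear a b v v′ m (suc K) j = trans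
  (cong (_+ (a * v (suc K) + b * v′ (suc K)) * m (suc K) j) (·-linear a b v v′ m K j))
  (solve 7 (λ a b x y z s t → a :* s :+ b :* t :+ (a :* x :+ b :* y) :* z := a :* (s :+ x :* z) :+ b :* (t :+ y :* z))
    refl a b (v (suc K)) (v′ (suc K)) (m (suc K) j) ((v ·[ K ] m) j) ((v′ ·[ K ] m) j))
  where open ℤSolver

index : Fin 3 → Fin 3 → ℕ
index J ρ = 3 ℕ.* toℕ J ℕ.+ toℕ ρ

coefficients : Fin 3 → Fin 3 → ℕ → ℕ → ℤ
coefficients J ρ β zero    = C (index J ρ) β
coefficients J ρ β (suc i) = D (index J ρ) (suc i) β

coefficients-rec : ∀ J ρ β i → let k = index J ρ in
  coefficients J ρ (4 ℕ.+ β) i ≡ h k * coefficients J ρ (2 ℕ.+ β) i + r k * coefficients J ρ β i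
coefficients-rec J ρ β zero    = refl
coefficients-rec J ρ β (suc i) = refl

module _ (J ρ : Fin 3) (m : ℕ → ℕ → ℤ) where
  private
    v = coefficients J ρ
    K = toℕ J

  -- By the common recurrence, two consecutive instances imply all of them.
  transfer : ∀ n j → (v n ·[ K ] m) j ≡ v (suc n) j → (v (2 ℕ.+ n) ·[ K ] m) j ≡ v (3 ℕ.+ n) j →
             ∀ β → (v (β ℕ.* 2 ℕ.+ n) ·[ K ] m) j ≡ v (suc (β ℕ.* 2 ℕ.+ n)) j
  transfer n j base₀ base₁ zero          = base₀
  transfer n j base₀ base₁ (suc zero)    = base₁
  transfer n j base₀ base₁ (suc (suc β)) = begin
    (v (4 ℕ.+ b) ·[ K ] m) j
      ≡⟨ ∑ℤ-cong K (λ i → cong (_* m i j) (coefficients-rec J ρ b i)) ⟩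
    ((λ i → h k * v (2 ℕ.+ b) i + r k * v b i) ·[ K ] m) j
      ≡⟨ ·-linear (h k) (r k) (v (2 ℕ.+ b)) (v b) m K j ⟩
    h k * (v (2 ℕ.+ b) ·[ K ] m) j + r k * (v b ·[ K ] m) j
      ≡⟨ cong₂ (λ x y → h k * x + r k * y) (transfer n j base₀ base₁ (suc β)) (transfer n j base₀ base₁ β) ⟩
    h k * v (3 ℕ.+ b) j + r k * v (suc b) j
      ≡⟨ coefficients-rec J ρ (suc b) j ⟨
    v (5 ℕ.+ b) j ∎
    where
    open ≡.≡-Reasoning
    k = index J ρ
    b = β ℕ.* 2 ℕ.+ n

private
  -- Decided by evaluation for all k = 3J + ρ up to 8. Everything compared is a tabulated initial
  -- value except `v 4`, the first value produced by the recurrence.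
  base-cases : ∀ J ρ (j : Fin (suc (toℕ J))) → let v = coefficients J ρ ; K = toℕ J in
    ((v 0 ·[ K ] matE J ρ) (toℕ j) ≡ v 1 (toℕ j) × (v 2 ·[ K ] matE J ρ) (toℕ j) ≡ v 3 (toℕ j))
    × ((v 1 ·[ K ] matF) (toℕ j) ≡ v 2 (toℕ j) × (v 3 ·[ K ] matF) (toℕ j) ≡ v 4 (toℕ j))
  base-cases = from-yes (Finₚ.all? λ J → Finₚ.all? λ ρ → Finₚ.all? λ (j : Fin (suc (toℕ J))) →
    let v = coefficients J ρ ; K = toℕ J in
    (((v 0 ·[ K ] matE J ρ) (toℕ j) ℤₚ.≟ v 1 (toℕ j)) ×-dec ((v 2 ·[ K ] matE J ρ) (toℕ j) ℤₚ.≟ v 3 (toℕ j)))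
    ×-dec (((v 1 ·[ K ] matF) (toℕ j) ℤₚ.≟ v 2 (toℕ j)) ×-dec ((v 3 ·[ K ] matF) (toℕ j) ℤₚ.≟ v 4 (toℕ j))))

  base-cases′ : ∀ J ρ {j} → j ≤ toℕ J → let v = coefficients J ρ ; K = toℕ J in
    ((v 0 ·[ K ] matE J ρ) j ≡ v 1 j × (v 2 ·[ K ] matE J ρ) j ≡ v 3 j)
    × ((v 1 ·[ K ] matF) j ≡ v 2 j × (v 3 ·[ K ] matF) j ≡ v 4 j)
  base-cases′ J ρ {j} j≤J with fromℕ< (s≤s j≤J) | Finₚ.toℕ-fromℕ< (s≤s j≤J)
  ... | i | refl = base-cases J ρ i

coefficients-matE : ∀ J ρ β {j} → j ≤ toℕ J →
  (coefficients J ρ (β ℕ.* 2) ·[ toℕ J ] matE J ρ) j ≡ coefficients J ρ (suc (β ℕ.* 2)) j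
coefficients-matE J ρ β {j} j≤J with base₀ , base₁ ← proj₁ (base-cases′ J ρ j≤J) =
  ≡.subst (λ n → (coefficients J ρ n ·[ toℕ J ] matE J ρ) j ≡ coefficients J ρ (suc n) j)
    (ℕₚ.+-identityʳ (β ℕ.* 2)) (transfer J ρ (matE J ρ) 0 j base₀ base₁ β)

coefficients-matF : ∀ J ρ β {j} → j ≤ toℕ J →
  (coefficients J ρ (suc (β ℕ.* 2)) ·[ toℕ J ] matF) j ≡ coefficients J ρ (suc β ℕ.* 2) j
coefficients-matF J ρ β {j} j≤J with base₀ , base₁ ← proj₂ (base-cases′ J ρ j≤J) =
  ≡.subst (λ n → (coefficients J ρ n ·[ toℕ J ] matF) j ≡ coefficients J ρ (suc n) j)
    (ℕₚ.+-comm (β ℕ.* 2) 1) (transfer J ρ matF 1 j base₀ base₁ β)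

-- The hypothesis excludes k = 0, where `C` has the default value 0 instead of 1.
coefficients-zero : ∀ J ρ → 1 ≤ index J ρ → ∀ j → j ≤ toℕ J → coefficients J ρ 0 j ≡ first j
coefficients-zero 0F 1F _ 0 _ = refl
coefficients-zero 0F 2F _ 0 _ = refl
coefficients-zero 1F ρ  _ j j≤J = go ρ j≤J
  where
  go : ∀ ρ {j} → j ≤ 1 → coefficients 1F ρ 0 j ≡ first j
  go 0F z≤n       = refl
  go 1F z≤n       = refl
  go 2F z≤n       = refl
  go 0F (s≤s z≤n) = refl
  go 1F (s≤s z≤n) = refl
  go 2F (s≤s z≤n) = refl
coefficients-zero 2F ρ  _ j j≤J = go ρ j≤J
  where
  go : ∀ ρ {j} → j ≤ 2 → coefficients 2F ρ 0 j ≡ first j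
  go 0F z≤n             = refl
  go 1F z≤n             = refl
  go 2F z≤n             = refl
  go 0F (s≤s z≤n)       = refl
  go 1F (s≤s z≤n)       = refl
  go 2F (s≤s z≤n)       = refl
  go 0F (s≤s (s≤s z≤n)) = refl
  go 1F (s≤s (s≤s z≤n)) = refl
  go 2F (s≤s (s≤s z≤n)) = refl

-- The ring of power series

infix 4 _≋_
record _≋_ (a b : PowerSeries) : Set where
  constructor pointwise
  field at : ∀ n → a n ≡ b n
open _≋_ public

≋-refl : ∀ {a} → a ≋ a
≋-refl .at _ = refl

≋-sym : ∀ {a b} → a ≋ b → b ≋ a
≋-sym a≋b .at n = sym (at a≋b n)

≋-trans : ∀ {a b c} → a ≋ b → b ≋ c → a ≋ c
≋-trans a≋b b≋c .at n = trans (at a≋b n) (at b≋c n)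

const : ℤ → PowerSeries
const c zero    = c
const c (suc _) = 0ℤ

tail : PowerSeries → PowerSeries
tail a = a ∘ suc

infixl 6 _⊞_
_⊞_ : PowerSeries → PowerSeries → PowerSeries
(a ⊞ b) n = a n + b n

infix 8 ⊟_
⊟_ : PowerSeries → PowerSeries
(⊟ a) n = - a n

infixr 7 _∙_
_∙_ : ℤ → PowerSeries → PowerSeries
(c ∙ a) n = c * a n

module _ where
  open ≡.≡-Reasoning
  open ℤSolver using (solve; _:=_; _:+_; _:*_; con)

  -- `(a ⊛ b) (suc n)` reduces to `a 0 * b (suc n) + (tail a ⊛ b) n`; the ring laws below are
  -- inductions along this equation.
  ⊛-cong : ∀ {a a′ b b′} → a ≋ a′ → b ≋ b′ → a ⊛ b ≋ a′ ⊛ b′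
  ⊛-cong a≋a′ b≋b′ .at n = go n _ _ _ _ a≋a′ b≋b′
    where
    go : ∀ n a a′ b b′ → a ≋ a′ → b ≋ b′ → (a ⊛ b) n ≡ (a′ ⊛ b′) n
    go zero    a a′ b b′ p q = cong₂ (λ x y → x * y + 0ℤ) (at p 0) (at q 0)
    go (suc n) a a′ b b′ p q = cong₂ _+_ (cong₂ _*_ (at p 0) (at q (suc n)))
      (go n (tail a) (tail a′) b b′ (pointwise (at p ∘ suc)) q)

  ⊛-congˡ : ∀ a {b b′} → b ≋ b′ → a ⊛ b ≋ a ⊛ b′
  ⊛-congˡ a {b} {b′} q = ⊛-cong {a} {a} {b} {b′} ≋-refl q

  ⊛-congʳ : ∀ b {a a′} → a ≋ a′ → a ⊛ b ≋ a′ ⊛ b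
  ⊛-congʳ b {a} {a′} p = ⊛-cong {a} {a′} {b} {b} p ≋-refl

  ⊛-distribʳ : ∀ c a b n → ((a ⊞ b) ⊛ c) n ≡ (a ⊛ c) n + (b ⊛ c) n
  ⊛-distribʳ c a b zero    = solve 3 (λ a b c → (a :+ b) :* c :+ con 0ℤ := a :* c :+ con 0ℤ :+ (b :* c :+ con 0ℤ))
    refl (a 0) (b 0) (c 0)
  ⊛-distribʳ c a b (suc n) = trans
    (cong (_+_ ((a 0 + b 0) * c (suc n))) (⊛-distribʳ c (tail a) (tail b) n))
    (solve 5 (λ a b c x y → (a :+ b) :* c :+ (x :+ y) := a :* c :+ x :+ (b :* c :+ y))
      refl (a 0) (b 0) (c (suc n)) ((tail a ⊛ c) n) ((tail b ⊛ c) n))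

  ∙-⊛ : ∀ x a b n → ((x ∙ a) ⊛ b) n ≡ x * (a ⊛ b) n
  ∙-⊛ x a b zero    = solve 3 (λ x a b → x :* a :* b :+ con 0ℤ := x :* (a :* b :+ con 0ℤ)) refl x (a 0) (b 0)
  ∙-⊛ x a b (suc n) = trans (cong (_+_ (x * a 0 * b (suc n))) (∙-⊛ x (tail a) b n))
    (solve 4 (λ x a b y → x :* a :* b :+ x :* y := x :* (a :* b :+ y)) refl x (a 0) (b (suc n)) ((tail a ⊛ b) n))

  tail-const : ∀ c → tail (const c) ≋ const 0ℤ
  tail-const c .at zero    = refl
  tail-const c .at (suc n) = refl

  ⊛-zeroˡ : ∀ b n → (const 0ℤ ⊛ b) n ≡ 0ℤ
  ⊛-zeroˡ b zero    = refl
  ⊛-zeroˡ b (suc n) = trans (ℤₚ.+-identityˡ ((tail (const 0ℤ) ⊛ b) n))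
    (trans (at (⊛-congʳ b (tail-const 0ℤ)) n) (⊛-zeroˡ b n))

  const-⊛ : ∀ c a → const c ⊛ a ≋ c ∙ a
  const-⊛ c a .at zero    = ℤₚ.+-identityʳ (c * a 0)
  const-⊛ c a .at (suc n) = trans
    (cong (_+_ (c * a (suc n))) (trans (at (⊛-congʳ a (tail-const c)) n) (⊛-zeroˡ a n)))
    (ℤₚ.+-identityʳ (c * a (suc n)))

  -- The convolution peeled off at the other end, which commutativity needs.
  ⊛-suc : ∀ a b n → (a ⊛ b) (suc n) ≡ (a ⊛ tail b) n + a (suc n) * b 0
  ⊛-suc a b zero    = solve 2 (λ x y → x :+ (y :+ con 0ℤ) := x :+ con 0ℤ :+ y) refl (a 0 * b 1) (a 1 * b 0)
  ⊛-suc a b (suc n) = trans (cong (_+_ (a 0 * b (suc (suc n)))) (⊛-suc (tail a) b n))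
    (sym (ℤₚ.+-assoc (a 0 * b (suc (suc n))) ((tail a ⊛ tail b) n) (a (suc (suc n)) * b 0)))

  ⊛-comm : ∀ a b n → (a ⊛ b) n ≡ (b ⊛ a) n
  ⊛-comm a b zero    = cong (_+ 0ℤ) (ℤₚ.*-comm (a 0) (b 0))
  ⊛-comm a b (suc n) = begin
    a 0 * b (suc n) + (tail a ⊛ b) n ≡⟨ cong₂ _+_ (ℤₚ.*-comm (a 0) (b (suc n))) (⊛-comm (tail a) b n) ⟩
    b (suc n) * a 0 + (b ⊛ tail a) n ≡⟨ ℤₚ.+-comm (b (suc n) * a 0) ((b ⊛ tail a) n) ⟩
    (b ⊛ tail a) n + b (suc n) * a 0 ≡⟨ ⊛-suc b a n ⟨
    (b ⊛ a) (suc n) ∎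

  ⊛-assoc : ∀ a b c n → ((a ⊛ b) ⊛ c) n ≡ (a ⊛ (b ⊛ c)) n
  ⊛-assoc a b c zero    = solve 3 (λ a b c → (a :* b :+ con 0ℤ) :* c :+ con 0ℤ := a :* (b :* c :+ con 0ℤ) :+ con 0ℤ)
    refl (a 0) (b 0) (c 0)
  ⊛-assoc a b c (suc n) = begin
    ab * c (suc n) + (tail (a ⊛ b) ⊛ c) n
      -- `tail (a ⊛ b)` is by computation `a 0 ∙ tail b ⊞ tail a ⊛ b`.
      ≡⟨ cong (_+_ (ab * c (suc n))) (⊛-distribʳ c (a 0 ∙ tail b) (tail a ⊛ b) n) ⟩
    ab * c (suc n) + (((a 0 ∙ tail b) ⊛ c) n + ((tail a ⊛ b) ⊛ c) n)
      ≡⟨ cong (_+_ (ab * c (suc n))) (cong₂ _+_ (∙-⊛ (a 0) (tail b) c n) (⊛-assoc (tail a) b c n)) ⟩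
    ab * c (suc n) + (a 0 * (tail b ⊛ c) n + (tail a ⊛ (b ⊛ c)) n)
      ≡⟨ solve 5 (λ a b c x y → (a :* b :+ con 0ℤ) :* c :+ (a :* x :+ y) := a :* (b :* c :+ x) :+ y) refl
           (a 0) (b 0) (c (suc n)) ((tail b ⊛ c) n) ((tail a ⊛ (b ⊛ c)) n) ⟩
    a 0 * (b ⊛ c) (suc n) + (tail a ⊛ (b ⊛ c)) n ∎
    where ab = a 0 * b 0 + 0ℤ

𝟙≋const : 𝟙 ≋ const 1ℤ
𝟙≋const .at zero    = refl
𝟙≋const .at (suc n) = refl

⊛-identityˡ : ∀ a → 𝟙 ⊛ a ≋ a
⊛-identityˡ a = ≋-trans (⊛-congʳ a 𝟙≋const) (≋-trans (const-⊛ 1ℤ a) (pointwise λ n → ℤₚ.*-identityˡ (a n)))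

powerSeriesRing : CommutativeRing 0ℓ 0ℓ
powerSeriesRing = record
  { Carrier = PowerSeries ; _≈_ = _≋_ ; _+_ = _⊞_ ; _*_ = _⊛_ ; -_ = ⊟_ ; 0# = const 0ℤ ; 1# = 𝟙
  ; isCommutativeRing = record
    { isRing = record
      { +-isAbelianGroup = record
        { isGroup = record
          { isMonoid = record
            { isSemigroup = record
              { isMagma = record
                { isEquivalence = record { refl = ≋-refl ; sym = ≋-sym ; trans = ≋-trans }
                ; ∙-cong = λ p q → pointwise λ n → cong₂ _+_ (at p n) (at q n)
                }
              ; assoc = λ a b c → pointwise λ n → ℤₚ.+-assoc (a n) (b n) (c n)
              }
            ; identity = (λ a → pointwise λ { zero → ℤₚ.+-identityˡ (a 0) ; (suc n) → ℤₚ.+-identityˡ (a (suc n)) })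
                       , (λ a → pointwise λ { zero → ℤₚ.+-identityʳ (a 0) ; (suc n) → ℤₚ.+-identityʳ (a (suc n)) })
            }
          ; inverse = (λ a → pointwise λ { zero → ℤₚ.+-inverseˡ (a 0) ; (suc n) → ℤₚ.+-inverseˡ (a (suc n)) })
                    , (λ a → pointwise λ { zero → ℤₚ.+-inverseʳ (a 0) ; (suc n) → ℤₚ.+-inverseʳ (a (suc n)) })
          ; ⁻¹-cong = λ p → pointwise λ n → cong -_ (at p n)
          }
        ; comm = λ a b → pointwise λ n → ℤₚ.+-comm (a n) (b n)
        }
      ; *-cong = ⊛-cong
      ; *-assoc = λ a b c → pointwise (⊛-assoc a b c)
      ; *-identity = ⊛-identityˡ
                   , (λ a → ≋-trans (pointwise (⊛-comm a 𝟙)) (⊛-identityˡ a))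
      ; distrib = (λ c a b → ≋-trans (pointwise (⊛-comm c (a ⊞ b)))
                    (≋-trans (pointwise (⊛-distribʳ c a b))
                      (pointwise λ n → cong₂ _+_ (⊛-comm a c n) (⊛-comm b c n))))
                , (λ c a b → pointwise (⊛-distribʳ c a b))
      }
    ; *-comm = λ a b → pointwise (⊛-comm a b)
    }
  }

const-homo : CommutativeRing.rawRing ℤₚ.+-*-commutativeRing -Raw-AlmostCommutative⟶ fromCommutativeRing powerSeriesRing
const-homo = record
  { ⟦_⟧    = const
  ; +-homo = λ a b → pointwise λ { zero → refl ; (suc _) → refl }
  ; *-homo = λ a b → ≋-sym (≋-trans (const-⊛ a (const b)) (pointwise λ { zero → refl ; (suc _) → ℤₚ.*-zeroʳ a }))
  ; -‿homo = λ a → pointwise λ { zero → refl ; (suc _) → refl }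
  ; 0-homo = ≋-refl
  ; 1-homo = ≋-sym 𝟙≋const
  }

module R = CommutativeRing powerSeriesRing
open ℤ-Algebra powerSeriesRing const-homo
open Exp R.semiring using (_^_; ^-congˡ; ^-assocʳ)

-- Dissection of power series modulo 3

X : PowerSeries
X zero    = 0ℤ
X (suc n) = 𝟙 n

shift : PowerSeries → PowerSeries
shift a zero    = 0ℤ
shift a (suc n) = a n

X-⊛ : ∀ a → X ⊛ a ≋ shift a
X-⊛ a .at zero    = refl
X-⊛ a .at (suc n) = trans (ℤₚ.+-identityˡ ((𝟙 ⊛ a) n)) (at (⊛-identityˡ a) n)

⊛-head-tail : ∀ a b n → (a ⊛ b) n ≡ a 0 * b n + shift (tail a ⊛ b) n
⊛-head-tail a b zero    = refl
⊛-head-tail a b (suc n) = refl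

δ : Fin 3 → PowerSeries → PowerSeries
δ r a n = a (toℕ r ℕ.+ n ℕ.* 3)

-- The three formulas are proved together by removing the constant term of a: the components of
-- `tail a` are `δ 1F a`, `δ 2F a` and `tail (δ 0F a)`, so each formula calls the preceding one
-- cyclically, and n drops once per turn.
δ₀-⊛ : ∀ a b n → (a ⊛ b) (n ℕ.* 3)
       ≡ (δ 0F a ⊛ δ 0F b) n + shift (δ 1F a ⊛ δ 2F b ⊞ δ 2F a ⊛ δ 1F b) n
δ₁-⊛ : ∀ a b n → (a ⊛ b) (1 ℕ.+ n ℕ.* 3)
       ≡ (δ 0F a ⊛ δ 1F b) n + (δ 1F a ⊛ δ 0F b) n + shift (δ 2F a ⊛ δ 2F b) n
δ₂-⊛ : ∀ a b n → (a ⊛ b) (2 ℕ.+ n ℕ.* 3)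
       ≡ (δ 0F a ⊛ δ 2F b) n + (δ 1F a ⊛ δ 1F b) n + (δ 2F a ⊛ δ 0F b) n

δ₀-⊛ a b zero    = sym (ℤₚ.+-identityʳ ((a ⊛ b) 0))
δ₀-⊛ a b (suc n) = trans (cong (_+_ (a 0 * b (3 ℕ.+ n ℕ.* 3))) (δ₂-⊛ (tail a) b n))
  (solve 4 (λ x y z t → x :+ (y :+ z :+ t) := x :+ t :+ (y :+ z)) refl
    (a 0 * b (3 ℕ.+ n ℕ.* 3)) ((δ 1F a ⊛ δ 2F b) n) ((δ 2F a ⊛ δ 1F b) n) ((tail (δ 0F a) ⊛ δ 0F b) n))
  where open ℤSolver
δ₁-⊛ a b n = begin
  a 0 * δ 1F b n + (tail a ⊛ b) (n ℕ.* 3)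
    ≡⟨ cong (_+_ (a 0 * δ 1F b n)) (δ₀-⊛ (tail a) b n) ⟩
  a 0 * δ 1F b n + ((δ 1F a ⊛ δ 0F b) n + shift (δ 2F a ⊛ δ 2F b ⊞ tail (δ 0F a) ⊛ δ 1F b) n)
    ≡⟨ cong (λ s → a 0 * δ 1F b n + ((δ 1F a ⊛ δ 0F b) n + s)) (shift-⊞ (δ 2F a ⊛ δ 2F b) (tail (δ 0F a) ⊛ δ 1F b) n) ⟩
  a 0 * δ 1F b n + ((δ 1F a ⊛ δ 0F b) n + (shift (δ 2F a ⊛ δ 2F b) n + shift (tail (δ 0F a) ⊛ δ 1F b) n))
    ≡⟨ solve 4 (λ x y z t → x :+ (y :+ (z :+ t)) := x :+ t :+ y :+ z) refl
         (a 0 * δ 1F b n) ((δ 1F a ⊛ δ 0F b) n) (shift (δ 2F a ⊛ δ 2F b) n) (shift (tail (δ 0F a) ⊛ δ 1F b) n) ⟩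
  a 0 * δ 1F b n + shift (tail (δ 0F a) ⊛ δ 1F b) n + (δ 1F a ⊛ δ 0F b) n + shift (δ 2F a ⊛ δ 2F b) n
    ≡⟨ cong (λ s → s + (δ 1F a ⊛ δ 0F b) n + shift (δ 2F a ⊛ δ 2F b) n) (⊛-head-tail (δ 0F a) (δ 1F b) n) ⟨
  (δ 0F a ⊛ δ 1F b) n + (δ 1F a ⊛ δ 0F b) n + shift (δ 2F a ⊛ δ 2F b) n ∎
  where
  open ℤSolver
  open ≡.≡-Reasoning
  shift-⊞ : ∀ a b n → shift (a ⊞ b) n ≡ shift a n + shift b n
  shift-⊞ a b zero    = refl
  shift-⊞ a b (suc n) = refl
δ₂-⊛ a b n = begin
  a 0 * δ 2F b n + (tail a ⊛ b) (1 ℕ.+ n ℕ.* 3)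
    ≡⟨ cong (_+_ (a 0 * δ 2F b n)) (δ₁-⊛ (tail a) b n) ⟩
  a 0 * δ 2F b n + ((δ 1F a ⊛ δ 1F b) n + (δ 2F a ⊛ δ 0F b) n + shift (tail (δ 0F a) ⊛ δ 2F b) n)
    ≡⟨ solve 4 (λ x y z t → x :+ (y :+ z :+ t) := x :+ t :+ y :+ z) refl
         (a 0 * δ 2F b n) ((δ 1F a ⊛ δ 1F b) n) ((δ 2F a ⊛ δ 0F b) n) (shift (tail (δ 0F a) ⊛ δ 2F b) n) ⟩
  a 0 * δ 2F b n + shift (tail (δ 0F a) ⊛ δ 2F b) n + (δ 1F a ⊛ δ 1F b) n + (δ 2F a ⊛ δ 0F b) n
    ≡⟨ cong (λ s → s + (δ 1F a ⊛ δ 1F b) n + (δ 2F a ⊛ δ 0F b) n) (⊛-head-tail (δ 0F a) (δ 2F b) n) ⟨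
  (δ 0F a ⊛ δ 2F b) n + (δ 1F a ⊛ δ 1F b) n + (δ 2F a ⊛ δ 0F b) n ∎
  where
  open ℤSolver
  open ≡.≡-Reasoning

isDissection : IsDissection X δ
isDissection = record
  { δ-cong = λ r eq → pointwise λ n → at eq (toℕ r ℕ.+ n ℕ.* 3)
  ; δ-+    = λ r a b → ≋-refl
  ; δ-*    = product
  ; δ-⟪⟫   = λ r c → ≋-trans (δ-cong r (⟪⟫≈ι c)) (≋-trans (constant r c) (const-triple r c))
  ; δ-q    = λ { 0F → pointwise λ { zero → refl ; (suc _) → refl }
               ; 1F → pointwise λ { zero → refl ; (suc _) → refl }
               ; 2F → pointwise λ { zero → refl ; (suc _) → refl } }
  }
  where
  δ-cong : ∀ r {a b} → a ≋ b → δ r a ≋ δ r b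
  δ-cong r eq = pointwise λ n → at eq (toℕ r ℕ.+ n ℕ.* 3)
  constant : ∀ r c → δ r (const c) ≋ ⟨_,_,_⟩ X (const c) (const 0ℤ) (const 0ℤ) r
  constant 0F c = pointwise λ { zero → refl ; (suc _) → refl }
  constant 1F c = pointwise λ { zero → refl ; (suc _) → refl }
  constant 2F c = pointwise λ { zero → refl ; (suc _) → refl }
  const-triple : ∀ r c → ⟨_,_,_⟩ X (const c) (const 0ℤ) (const 0ℤ) r ≋ ⟨_,_,_⟩ X ⟪ c ⟫ (const 0ℤ) (const 0ℤ) r
  const-triple 0F c = ≋-sym (⟪⟫≈ι c)
  const-triple 1F c = ≋-refl
  const-triple 2F c = ≋-refl
  product : ∀ r a b → δ r (a ⊛ b) ≋ (_⊗_ X (λ r → δ r a) (λ r → δ r b)) r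
  product 0F a b = pointwise λ n → trans (δ₀-⊛ a b n)
    (cong (_+_ ((δ 0F a ⊛ δ 0F b) n)) (sym (at (X-⊛ (δ 1F a ⊛ δ 2F b ⊞ δ 2F a ⊛ δ 1F b)) n)))
  product 1F a b = pointwise λ n → trans (δ₁-⊛ a b n)
    (cong (_+_ ((δ 0F a ⊛ δ 1F b) n + (δ 1F a ⊛ δ 0F b) n)) (sym (at (X-⊛ (δ 2F a ⊛ δ 2F b)) n)))
  product 2F a b = pointwise (δ₂-⊛ a b)

δ-ext : ∀ {a b} → (∀ r → δ r a ≋ δ r b) → a ≋ b
δ-ext {a} {b} eq = pointwise λ n → go {a} {b} n (λ m → at (eq 0F) m) (λ m → at (eq 1F) m) (λ m → at (eq 2F) m)
  where
  go : ∀ {a b : PowerSeries} n → (∀ m → a (m ℕ.* 3) ≡ b (m ℕ.* 3)) → (∀ m → a (1 ℕ.+ m ℕ.* 3) ≡ b (1 ℕ.+ m ℕ.* 3)) →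
       (∀ m → a (2 ℕ.+ m ℕ.* 3) ≡ b (2 ℕ.+ m ℕ.* 3)) → a n ≡ b n
  go 0 p₀ p₁ p₂ = p₀ 0
  go 1 p₀ p₁ p₂ = p₁ 0
  go 2 p₀ p₁ p₂ = p₂ 0
  go {a} {b} (suc (suc (suc n))) p₀ p₁ p₂ = go {tail (tail (tail a))} {tail (tail (tail b))} n (p₀ ∘ suc) (p₁ ∘ suc) (p₂ ∘ suc)

X^-at : ∀ m n → (X ^ m) n ≡ (if does (n ℕₚ.≟ m) then 1ℤ else 0ℤ)
X^-at zero    zero    = refl
X^-at zero    (suc n) = refl
X^-at (suc m) zero    = refl
X^-at (suc m) (suc n) = trans (at (X-⊛ (X ^ m)) (suc n)) (X^-at m n)

1-q^≋ : ∀ t N → 1-q^ (N ℕ.* t) ≋ 𝟙 R.- (X ^ t) ^ N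
1-q^≋ t N .at n = cong (λ x → 𝟙 n - x) (trans (sym (X^-at (N ℕ.* t) n))
  (trans (cong (λ m → (X ^ m) n) (ℕₚ.*-comm N t)) (sym (at (^-assocʳ X t N) n))))

∏≋qPochhammer : ∀ t N → ∏ t N ≋ qPochhammer (X ^ t) N
∏≋qPochhammer t zero    = ≋-refl
∏≋qPochhammer t (suc N) = ⊛-cong {1-q^ (suc N ℕ.* t)} {𝟙 R.- (X ^ t) ^ suc N} {∏ t N} {qPochhammer (X ^ t) N}
  (1-q^≋ t (suc N)) (∏≋qPochhammer t N)

-- Congruence modulo powers of q and the passage to the limit

infix 4 _≋[_]_
record _≋[_]_ (a : PowerSeries) (K : ℕ) (b : PowerSeries) : Set where
  constructor below
  field at< : ∀ {n} → n ℕ.< K → a n ≡ b n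
open _≋[_]_ public

≋⇒≋[] : ∀ {a b K} → a ≋ b → a ≋[ K ] b
≋⇒≋[] eq .at< {n} _ = at eq n

≋[]-sym : ∀ {a b K} → a ≋[ K ] b → b ≋[ K ] a
≋[]-sym eq .at< n<K = sym (at< eq n<K)

≋[]-trans : ∀ {a b c K} → a ≋[ K ] b → b ≋[ K ] c → a ≋[ K ] c
≋[]-trans p q .at< n<K = trans (at< p n<K) (at< q n<K)

≋[]-weaken : ∀ {a b K L} → K ≤ L → a ≋[ L ] b → a ≋[ K ] b
≋[]-weaken K≤L eq .at< n<K = at< eq (ℕₚ.<-≤-trans n<K K≤L)

⊞-cong[] : ∀ {a a′ b b′ K} → a ≋[ K ] a′ → b ≋[ K ] b′ → a ⊞ b ≋[ K ] a′ ⊞ b′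
⊞-cong[] p q .at< n<K = cong₂ _+_ (at< p n<K) (at< q n<K)

⊟-cong[] : ∀ {a a′ K} → a ≋[ K ] a′ → ⊟ a ≋[ K ] ⊟ a′
⊟-cong[] p .at< n<K = cong -_ (at< p n<K)

⊛-cong[] : ∀ {a a′ b b′ K} → a ≋[ K ] a′ → b ≋[ K ] b′ → a ⊛ b ≋[ K ] a′ ⊛ b′
⊛-cong[] {a} {a′} {b} {b′} p q .at< {n} n<K =
  go n a a′ (λ m≤n → at< p (ℕₚ.≤-<-trans m≤n n<K)) (λ m≤n → at< q (ℕₚ.≤-<-trans m≤n n<K))
  where
  go : ∀ n a a′ → (∀ {m} → m ≤ n → a m ≡ a′ m) → (∀ {m} → m ≤ n → b m ≡ b′ m) → (a ⊛ b) n ≡ (a′ ⊛ b′) n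
  go zero    a a′ p q = cong₂ (λ x y → x * y + 0ℤ) (p z≤n) (q z≤n)
  go (suc n) a a′ p q = cong₂ _+_ (cong₂ _*_ (p z≤n) (q ℕₚ.≤-refl))
    (go n (tail a) (tail a′) (λ m≤n → p (s≤s m≤n)) (λ m≤n → q (ℕₚ.m≤n⇒m≤1+n m≤n)))

⊛-congˡ[] : ∀ a {b b′ K} → b ≋[ K ] b′ → a ⊛ b ≋[ K ] a ⊛ b′
⊛-congˡ[] a {b} {b′} q = ⊛-cong[] {a} {a} {b} {b′} (≋⇒≋[] ≋-refl) q

⊛-congʳ[] : ∀ b {a a′ K} → a ≋[ K ] a′ → a ⊛ b ≋[ K ] a′ ⊛ b
⊛-congʳ[] b {a} {a′} p = ⊛-cong[] {a} {a′} {b} {b} p (≋⇒≋[] ≋-refl)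

X^-cong[] : ∀ t {a b K} → a ≋[ K ] b → X ^ t ⊛ a ≋[ t ℕ.+ K ] X ^ t ⊛ b
X^-cong[] zero    eq = ⊛-congˡ[] 𝟙 eq
X^-cong[] (suc t) {a} {b} {K} eq = ≋[]-trans (≋⇒≋[] (≋-trans (R.*-assoc X (X ^ t) a) (X-⊛ (X ^ t ⊛ a))))
  (≋[]-trans (shifted (X^-cong[] t eq)) (≋⇒≋[] (≋-sym (≋-trans (R.*-assoc X (X ^ t) b) (X-⊛ (X ^ t ⊛ b))))))
  where
  shifted : ∀ {a b L} → a ≋[ L ] b → shift a ≋[ suc L ] shift b
  shifted eq .at< {zero}  _         = refl
  shifted eq .at< {suc n} (s≤s n<L) = at< eq n<L

δ-cong[] : ∀ r {a b K} → a ≋[ K ℕ.* 3 ] b → δ r a ≋[ K ] δ r b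
δ-cong[] r {K = K} eq .at< {n} n<K = at< eq (ℕₚ.<-≤-trans (ℕₚ.+-monoˡ-< (n ℕ.* 3) (Finₚ.toℕ<n r)) (ℕₚ.*-monoˡ-≤ 3 n<K))

norm-cong[] : ∀ {s t : Fin 3 → PowerSeries} {K} → (∀ r → s r ≋[ K ] t r) → norm X s ≋[ K ] norm X t
norm-cong[] {K = K} eq = ⊞-cong[]
  (⊞-cong[] (⊞-cong[] (cube 0F) (⊛-congˡ[] X (cube 1F))) (⊛-congˡ[] (X ⊛ X) (cube 2F)))
  (⊟-cong[] (⊛-congˡ[] (⟪ + 3 ⟫ ⊛ X) (⊛-cong[] (⊛-cong[] (eq 0F) (eq 1F)) (eq 2F))))
  where
  cube : ∀ r → _ ≋[ K ] _
  cube r = ⊛-cong[] (⊛-cong[] (eq r) (eq r)) (eq r)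

qPochhammer-cong : ∀ {q q′} → q ≋ q′ → ∀ N → qPochhammer q N ≋ qPochhammer q′ N
qPochhammer-cong         eq zero    = ≋-refl
qPochhammer-cong {q} {q′} eq (suc N) = ⊛-cong {𝟙 R.- q ^ suc N} {𝟙 R.- q′ ^ suc N} {qPochhammer q N} {qPochhammer q′ N}
  (pointwise λ n → cong (λ x → 𝟙 n - x) (at (^-congˡ (suc N) eq) n)) (qPochhammer-cong eq N)

f₁≋ : ∀ N → f 1 ≋[ suc N ] qPochhammer X N
f₁≋ N = ≋[]-trans (below λ {n} n<1+N → sym (∏-stable 1 N n (ℕₚ.≤-pred n<1+N)))
  (≋⇒≋[] (≋-trans (∏≋qPochhammer 1 N) (qPochhammer-cong (R.*-identityʳ X) N)))

f₃≋ : ∀ N → f 3 ≋[ suc N ] qPochhammer (X ^ 3) N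
f₃≋ N = ≋[]-trans (below λ {n} n<1+N → sym (∏-stable 3 N n (ℕₚ.≤-pred n<1+N)))
  (≋⇒≋[] (∏≋qPochhammer 3 N))

module Dissect = Dissection isDissection

f₃⇝ : f 3 Dissect.⇝ ⟨_,_,_⟩ X (f 1) (const 0ℤ) (const 0ℤ)
f₃⇝ r .at n = trans (at< (δ-cong[] r (≋[]-weaken (ℕₚ.n≤1+n N) (f₃≋ N))) {n} ℕₚ.≤-refl)
  (trans (at (qPochhammer-scalar isDissection N r) n) (go r))
  where
  -- Coefficient n of a component needs degrees up to 3n + 2.
  N = suc n ℕ.* 3
  go : ∀ r → ⟨_,_,_⟩ X (qPochhammer X N) (const 0ℤ) (const 0ℤ) r n ≡ ⟨_,_,_⟩ X (f 1) (const 0ℤ) (const 0ℤ) r n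
  go 0F = sym (at< (f₁≋ N) (s≤s (ℕₚ.≤-trans (ℕₚ.n≤1+n n) (ℕₚ.m≤m*n (suc n) 3))))
  go 1F = refl
  go 2F = refl

private
  norm-f₁-below : ∀ M → norm X (λ r → δ r (f 1)) ⊛ f 3 ≋[ M ] f 1 ^ 4
  norm-f₁-below M = ≋[]-trans lhs (≋[]-trans (≋⇒≋[] finite) (≋[]-trans (≋[]-sym rhs) (≋⇒≋[] power)))
    where
    e₃ eᴹ : PowerSeries
    -- The components under the norm are known only to a third of the precision, so 3M factors are
    -- taken there, while M suffice for f₃ and for the cube on the right.
    e₃ = qPochhammer X (M ℕ.* 3)
    eᴹ = qPochhammer X M
    f≋e : f 1 ≋[ M ] eᴹ
    f≋e = ≋[]-weaken (ℕₚ.n≤1+n M) (f₁≋ M)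
    f≋e₃ : f 1 ≋[ M ℕ.* 3 ] e₃
    f≋e₃ = ≋[]-weaken (ℕₚ.n≤1+n (M ℕ.* 3)) (f₁≋ (M ℕ.* 3))
    lhs : norm X (λ r → δ r (f 1)) ⊛ f 3 ≋[ M ] norm X (λ r → δ r e₃) ⊛ qPochhammer (X ^ 3) M
    lhs = ⊛-cong[] {norm X (λ r → δ r (f 1))} {norm X (λ r → δ r e₃)} {f 3} {qPochhammer (X ^ 3) M}
      (norm-cong[] {λ r → δ r (f 1)} {λ r → δ r e₃} (λ r → δ-cong[] r f≋e₃))
      (≋[]-weaken (ℕₚ.n≤1+n M) (f₃≋ M))
    finite : norm X (λ r → δ r e₃) ⊛ qPochhammer (X ^ 3) M ≋ e₃ ⊛ (eᴹ ⊛ eᴹ ⊛ eᴹ)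
    finite = finite-norm isDissection M
    rhs : f 1 ⊛ (f 1 ⊛ f 1 ⊛ f 1) ≋[ M ] e₃ ⊛ (eᴹ ⊛ eᴹ ⊛ eᴹ)
    rhs = ⊛-cong[] {f 1} {e₃} {f 1 ⊛ f 1 ⊛ f 1} {eᴹ ⊛ eᴹ ⊛ eᴹ}
      (≋[]-weaken (ℕₚ.m≤m*n M 3) f≋e₃)
      (⊛-cong[] {f 1 ⊛ f 1} {eᴹ ⊛ eᴹ} {f 1} {eᴹ} (⊛-cong[] {f 1} {eᴹ} {f 1} {eᴹ} f≋e f≋e) f≋e)
    power : f 1 ⊛ (f 1 ⊛ f 1 ⊛ f 1) ≋ f 1 ^ 4
    power = Solver.solve 1 (λ a → a Solver.:* (a Solver.:* a Solver.:* a) Solver.:= a Solver.:^ 4) ≋-refl (f 1)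

≋[]⇒≋ : ∀ {a b} → (∀ K → a ≋[ K ] b) → a ≋ b
≋[]⇒≋ eq .at n = at< (eq (suc n)) ℕₚ.≤-refl

norm-f₁ : norm X (λ r → δ r (f 1)) ⊛ f 3 ≋ f 1 ^ 4
norm-f₁ = ≋[]⇒≋ norm-f₁-below

f₁-inverse : f 1 ⊛ f 1 ⁻¹ ≋ 𝟙
f₁-inverse .at = ⁻¹-inverse (f 1) refl

f₃-inverse : f 3 ⊛ f 3 ⁻¹ ≋ 𝟙
f₃-inverse .at = ⁻¹-inverse (f 3) refl

private
  -- In the limit, the Gaussian binomial coefficient becomes 1/f₁.
  f₁-gauss : ∀ d k → f 1 ⊛ gauss X (d ℕ.+ k) k ≋[ suc d ] 𝟙
  f₁-gauss d k = ≋[]-trans (≋⇒≋[] insert) (≋[]-trans (⊛-congˡ[] (f 1 ⁻¹) f₁f₁g) (≋⇒≋[] cancel))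
    where
    n = d ℕ.+ k
    e : ℕ → PowerSeries
    e = qPochhammer X
    g : PowerSeries
    g = gauss X n k
    f≋e : ∀ m → d ≤ m → f 1 ≋[ suc d ] e m
    f≋e m d≤m = ≋[]-weaken (s≤s d≤m) (f₁≋ m)
    product : e d ⊛ e (suc (n ℕ.+ k)) ⊛ g ≋ e (suc (n ℕ.+ n))
    product = gauss-product X n d k refl
    d≤n : d ≤ n
    d≤n = ℕₚ.m≤m+n d k
    f₁f₁g : f 1 ⊛ f 1 ⊛ g ≋[ suc d ] f 1
    f₁f₁g = ≋[]-trans (⊛-congʳ[] g (⊛-cong[] {f 1} {e d} {f 1} {e (suc (n ℕ.+ k))} (f≋e d ℕₚ.≤-refl)
        (f≋e (suc (n ℕ.+ k)) (ℕₚ.m≤n⇒m≤1+n (ℕₚ.≤-trans d≤n (ℕₚ.m≤m+n n k))))))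
      (≋[]-trans (≋⇒≋[] product) (≋[]-sym (f≋e (suc (n ℕ.+ n)) (ℕₚ.m≤n⇒m≤1+n (ℕₚ.≤-trans d≤n (ℕₚ.m≤m+n n n))))))
    cancel : f 1 ⁻¹ ⊛ f 1 ≋ 𝟙
    cancel = ≋-trans (R.*-comm (f 1 ⁻¹) (f 1)) f₁-inverse
    insert : f 1 ⊛ g ≋ f 1 ⁻¹ ⊛ (f 1 ⊛ f 1 ⊛ g)
    insert = ≋-sym (≋-trans (Solver.solve 3 (λ i a g → i Solver.:* (a Solver.:* a Solver.:* g) Solver.:= (i Solver.:* a) Solver.:* (a Solver.:* g))
                 ≋-refl (f 1 ⁻¹) (f 1) g)
               (≋-trans (⊛-congʳ (f 1 ⊛ g) cancel) (⊛-identityˡ (f 1 ⊛ g))))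

  m≤triangular : ∀ k → k ≤ triangular k
  m≤triangular zero    = z≤n
  m≤triangular (suc k) = ℕₚ.m≤m+n (suc k) (triangular k)

  sumTo-cong[] : ∀ {s t : ℕ → PowerSeries} {K} n → (∀ {k} → k ≤ n → s k ≋[ K ] t k) → sumTo s n ≋[ K ] sumTo t n
  sumTo-cong[] zero    eq = eq z≤n
  sumTo-cong[] (suc n) eq = ⊞-cong[] (sumTo-cong[] n (λ k≤n → eq (ℕₚ.m≤n⇒m≤1+n k≤n))) (eq ℕₚ.≤-refl)

  ⊛-sumTo : ∀ a t n → a ⊛ sumTo t n ≋ sumTo (λ k → a ⊛ t k) n
  ⊛-sumTo a t zero    = ≋-refl
  ⊛-sumTo a t (suc n) = ≋-trans (R.distribˡ a (sumTo t n) (t (suc n))) (R.+-congʳ {a ⊛ t (suc n)} (⊛-sumTo a t n))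

-- Multiply `finite-Jacobi` by f₁: its right side becomes f₁³, and on the left f₁ cancels each
-- Gaussian coefficient in the limit.
Jacobi : ∀ n → f 1 ^ 3 ≋[ suc n ] sumTo (θ-term X) n
Jacobi n = ≋[]-trans (≋⇒≋[] cube) (≋[]-trans (⊛-congˡ[] (f 1) (⊛-cong[] {f 1} {e} {f 1} {e} (f₁≋ n) (f₁≋ n)))
  (≋[]-trans (≋⇒≋[] (≋-trans (⊛-congˡ (f 1) (≋-sym finite)) (⊛-sumTo (f 1) t n)))
    (sumTo-cong[] n term)))
  where
  e : PowerSeries
  e = qPochhammer X n
  t : ℕ → PowerSeries
  t k = θ-term X k ⊛ gauss X n k
  finite : sumTo t n ≋ e ⊛ e
  finite = finite-Jacobi X n
  cube : f 1 ^ 3 ≋ f 1 ⊛ (f 1 ⊛ f 1)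
  cube = Solver.solve 1 (λ a → a Solver.:^ 3 Solver.:= a Solver.:* (a Solver.:* a)) ≋-refl (f 1)
  term : ∀ {k} → k ≤ n → f 1 ⊛ t k ≋[ suc n ] θ-term X k
  term {k} k≤n = ≋[]-trans (≋⇒≋[] rearrange)
    (≋[]-trans (⊛-congˡ[] ⟪ θ-coeff k ⟫ (≋[]-weaken bound (X^-cong[] (triangular k) limit)))
      (≋⇒≋[] (⊛-congˡ ⟪ θ-coeff k ⟫ (R.*-identityʳ (X ^ triangular k)))))
    where
    d = n ∸ k
    limit : f 1 ⊛ gauss X n k ≋[ suc d ] 𝟙
    limit = ≡.subst (λ m → f 1 ⊛ gauss X m k ≋[ suc d ] 𝟙) (ℕₚ.m∸n+n≡m k≤n) (f₁-gauss d k)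
    -- `gauss X n k` approximates 1/f₁ only below degree n - k + 1; the factor X to the power T(k),
    -- with T(k) at least k, makes up for the lost k.
    bound : suc n ≤ triangular k ℕ.+ suc d
    bound = ℕₚ.≤-trans (ℕₚ.≤-reflexive (trans (cong suc (sym (ℕₚ.m+[n∸m]≡n k≤n))) (sym (ℕₚ.+-suc k d))))
      (ℕₚ.+-monoˡ-≤ (suc d) (m≤triangular k))
    rearrange : f 1 ⊛ t k ≋ ⟪ θ-coeff k ⟫ ⊛ (X ^ triangular k ⊛ (f 1 ⊛ gauss X n k))
    rearrange = Solver.solve 4 (λ a c x g → a Solver.:* (c Solver.:* x Solver.:* g) Solver.:= c Solver.:* (x Solver.:* (a Solver.:* g)))
      ≋-refl (f 1) ⟪ θ-coeff k ⟫ (X ^ triangular k) (gauss X n k)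

δ₂f₁³ : δ 2F (f 1 ^ 3) ≋ const 0ℤ
δ₂f₁³ = ≋[]⇒≋ λ M → ≋[]-weaken (ℕₚ.n≤1+n M)
  (≋[]-trans (δ-cong[] 2F {K = suc M} (Jacobi (2 ℕ.+ M ℕ.* 3))) (≋⇒≋[] (δ₂-θ isDissection M)))

-- Both sides are dissected once more. This takes f₃³ to f₁³, so the same series `Jacobi` serves for
-- both; two dissections divide the precision by 9, hence the cutoff 2 + 9K.
δ₁f₁³ : δ 1F (f 1 ^ 3) ≋ ⟪ - (+ 3) ⟫ ⊛ f 3 ^ 3
δ₁f₁³ = δ-ext λ r → ≋[]⇒≋ λ K → ≋[]-trans
  (δ-cong[] r (≋[]-weaken (ℕₚ.n≤1+n (K ℕ.* 3)) (δ-cong[] 1F {K = suc (K ℕ.* 3)} (Jacobi (2 ℕ.+ K ℕ.* 3 ℕ.* 3)))))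
  (≋[]-trans (≋⇒≋[] (δδ₁-θ isDissection r (K ℕ.* 3)))
    (≋[]-trans (limit r K) (≋⇒≋[] (≋-sym (≋-trans (Dissect.δ-⟪⟫* r (- (+ 3)) (f 3 ^ 3)) (scale r))))))
  where
  θ-sum : ℕ → PowerSeries
  θ-sum = sumTo (θ-term X)
  limit : ∀ r K → ⟨_,_,_⟩ X (⟪ - (+ 3) ⟫ ⊛ θ-sum (K ℕ.* 3)) (const 0ℤ) (const 0ℤ) r
                  ≋[ K ] ⟨_,_,_⟩ X (⟪ - (+ 3) ⟫ ⊛ f 1 ^ 3) (const 0ℤ) (const 0ℤ) r
  limit 0F K = ⊛-congˡ[] ⟪ - (+ 3) ⟫ (≋[]-sym (≋[]-weaken (ℕₚ.≤-trans (ℕₚ.m≤m*n K 3) (ℕₚ.n≤1+n (K ℕ.* 3))) (Jacobi (K ℕ.* 3))))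
  limit 1F K = ≋⇒≋[] ≋-refl
  limit 2F K = ≋⇒≋[] ≋-refl
  scale : ∀ r → ⟪ - (+ 3) ⟫ ⊛ δ r (f 3 ^ 3) ≋ ⟨_,_,_⟩ X (⟪ - (+ 3) ⟫ ⊛ f 1 ^ 3) (const 0ℤ) (const 0ℤ) r
  scale 0F = ⊛-congˡ ⟪ - (+ 3) ⟫ (Dissect.scalar-^ {f 3} {f 1} f₃⇝ 3 0F)
  scale 1F = ≋-trans (⊛-congˡ ⟪ - (+ 3) ⟫ (Dissect.scalar-^ {f 3} {f 1} f₃⇝ 3 1F)) (R.zeroʳ ⟪ - (+ 3) ⟫)
  scale 2F = ≋-trans (⊛-congˡ ⟪ - (+ 3) ⟫ (Dissect.scalar-^ {f 3} {f 1} f₃⇝ 3 2F)) (R.zeroʳ ⟪ - (+ 3) ⟫)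

-- The combinations on the right-hand sides and their components

open Dissect.EtaQuotients {f 1} {f 3} {f 1 ⁻¹} {f 3 ⁻¹} f₁-inverse f₃-inverse f₃⇝ δ₁f₁³ δ₂f₁³ norm-f₁
  using (basisE; basisF; δ-basisE; δ-basisF)

basisE-zero′ : ∀ J ρ → basisE J ρ 0 ≋ f 1 ^ (3 ℕ.* index J ρ)
basisE-zero′ = basisE-zero isDissection {f 1} {f 3} {f 1 ⁻¹} {f 3 ⁻¹} f₁-inverse f₃-inverse f₃⇝ δ₁f₁³ δ₂f₁³ norm-f₁

seriesE seriesF : Fin 3 → Fin 3 → ℕ → PowerSeries
seriesE J ρ β = combination (coefficients J ρ (β ℕ.* 2)) (basisE J ρ) (toℕ J)
seriesF J ρ β = combination (coefficients J ρ (suc (β ℕ.* 2))) (basisF J ρ) (toℕ J)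

δ-seriesE : ∀ J ρ β → δ ρ (seriesE J ρ β) ≋ seriesF J ρ β
δ-seriesE J ρ β = ≋-trans
  (δ-combination isDissection ρ (coefficients J ρ (β ℕ.* 2)) (matE J ρ) {basisE J ρ} {basisF J ρ} (toℕ J) (λ i≤J → δ-basisE J ρ i≤J))
  (combination-cong (basisF J ρ) (toℕ J) (coefficients-matE J ρ β))

δ-seriesF : ∀ J ρ β → δ J (seriesF J ρ β) ≋ seriesE J ρ (suc β)
δ-seriesF J ρ β = ≋-trans
  (δ-combination isDissection J (coefficients J ρ (suc (β ℕ.* 2))) matF {basisF J ρ} {basisE J ρ} (toℕ J) (λ i≤J → δ-basisF J ρ i≤J))
  (combination-cong (basisE J ρ) (toℕ J) (coefficients-matF J ρ β))

seriesE-zero : ∀ J ρ → 1 ≤ index J ρ → seriesE J ρ 0 ≋ f 1 ^ (3 ℕ.* index J ρ)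
seriesE-zero J ρ 1≤k = ≋-trans (combination-cong (basisE J ρ) (toℕ J) (λ {j} j≤J → coefficients-zero J ρ 1≤k j j≤J))
  (≋-trans (combination-unit (basisE J ρ) (toℕ J)) (basisE-zero′ J ρ))

-- Laurent coefficients

[_] : PowerSeries → ℤ → ℤ
[ a ] = coeff (fromPowerSeries a)

[]-cong : ∀ {a b} → a ≋ b → ∀ n → [ a ] n ≡ [ b ] n
[]-cong eq (+ n)    = at eq n
[]-cong eq -[1+ n ] = refl

[]-neg : ∀ a n → n ℤ.< 0ℤ → [ a ] n ≡ 0ℤ
[]-neg a = bounded (fromPowerSeries a)

[]-⊞ : ∀ a b n → [ a ⊞ b ] n ≡ [ a ] n + [ b ] n
[]-⊞ a b (+ n)    = refl
[]-⊞ a b -[1+ n ] = refl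

[]-⟪⟫ : ∀ c a n → [ ⟪ c ⟫ ⊛ a ] n ≡ c * [ a ] n
[]-⟪⟫ c a (+ n)    = at (≋-trans (⊛-congʳ a (⟪⟫≈ι c)) (const-⊛ c a)) n
[]-⟪⟫ c a -[1+ n ] = sym (ℤₚ.*-zeroʳ c)

[]-X^ : ∀ i a n → [ X ^ i ⊛ a ] n ≡ [ a ] (n - + i)
[]-X^ zero    a n = trans ([]-cong (⊛-identityˡ a) n) (cong [ a ] (sym (ℤₚ.+-identityʳ n)))
[]-X^ (suc i) a n = trans ([]-cong (≋-trans (R.*-assoc X (X ^ i) a) (X-⊛ (X ^ i ⊛ a))) n)
  (trans (shifted (X ^ i ⊛ a) n) (trans ([]-X^ i a (n - 1ℤ))
    (cong [ a ] (solve 2 (λ n i → n :- con 1ℤ :- i := n :- (con 1ℤ :+ i)) refl n (+ i)))))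
  where
  open ℤSolver
  shifted : ∀ a n → [ shift a ] n ≡ [ a ] (n - 1ℤ)
  shifted a (+ zero)  = refl
  shifted a (+ suc n) = refl
  shifted a -[1+ n ]  = refl

-- Negative n is included because r ≤ 2 keeps 3n + r negative; the odd identities start at a
-- negative index.
[]-δ : ∀ r a n → [ a ] (+ 3 * n + + toℕ r) ≡ [ δ r a ] n
[]-δ r a (+ n) = cong [ a ] (begin
  + 3 * + n + + toℕ r     ≡⟨ cong (_+ + toℕ r) (ℤₚ.pos-* 3 n) ⟨
  + (3 ℕ.* n) + + toℕ r   ≡⟨⟩
  + (3 ℕ.* n ℕ.+ toℕ r)   ≡⟨ cong +_ (trans (ℕₚ.+-comm (3 ℕ.* n) (toℕ r)) (cong (toℕ r ℕ.+_) (ℕₚ.*-comm 3 n))) ⟩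
  + (toℕ r ℕ.+ n ℕ.* 3) ∎)
  where open ≡.≡-Reasoning
[]-δ r a -[1+ n ] = []-neg a _ (begin-strict
  + 3 * -[1+ n ] + + toℕ r   <⟨ ℤₚ.+-monoʳ-< (+ 3 * -[1+ n ]) (ℤ.+<+ (Finₚ.toℕ<n r)) ⟩
  + 3 * -[1+ n ] + + 3       ≡⟨ solve 1 (λ n → con (+ 3) :* (:- (con (+ 1) :+ n)) :+ con (+ 3) := :- (con (+ 3) :* n)) refl (+ n) ⟩
  - (+ 3 * + n)              ≡⟨ cong -_ (ℤₚ.pos-* 3 n) ⟨
  - (+ (3 ℕ.* n))            ≤⟨ ℤₚ.neg-mono-≤ (ℤ.+≤+ z≤n) ⟩
  0ℤ ∎)
  where
  open ℤSolver
  open ℤₚ.≤-Reasoning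

-- (9^β - 1) / 8
repunit : ℕ → ℕ
repunit zero    = 0
repunit (suc β) = 9 ℕ.^ β ℕ.+ repunit β

repunit-* : ∀ β → 9 ℕ.^ β ≡ suc (repunit β ℕ.* 8)
repunit-* zero    = refl
repunit-* (suc β) = begin
  9 ℕ.^ β ℕ.+ 8 ℕ.* 9 ℕ.^ β                        ≡⟨ cong (ℕ._+ 8 ℕ.* 9 ℕ.^ β) (repunit-* β) ⟩
  suc (repunit β ℕ.* 8 ℕ.+ 8 ℕ.* 9 ℕ.^ β)          ≡⟨ cong suc (trans (ℕₚ.+-comm (repunit β ℕ.* 8) _)
                                                       (cong (ℕ._+ repunit β ℕ.* 8) (ℕₚ.*-comm 8 (9 ℕ.^ β)))) ⟩
  suc (9 ℕ.^ β ℕ.* 8 ℕ.+ repunit β ℕ.* 8)          ≡⟨ cong suc (ℕₚ.*-distribʳ-+ 8 (9 ℕ.^ β) (repunit β)) ⟨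
  suc (repunit (suc β) ℕ.* 8) ∎
  where open ≡.≡-Reasoning

offset : ∀ k β → k ℕ.* (9 ℕ.^ β ∸ 1) / 8 ≡ k ℕ.* repunit β
offset k β = trans (cong (λ m → k ℕ.* (m ∸ 1) / 8) (repunit-* β))
  (trans (cong (_/ 8) (sym (ℕₚ.*-assoc k (repunit β) 8))) (m*n/n≡m (k ℕ.* repunit β) 8))

-- Induction on β

module _ (J ρ : Fin 3) (1≤k : 1 ≤ index J ρ) where
  private
    k : ℕ
    k = index J ρ
    open ≡.≡-Reasoning
    open ℤSolver using (solve; con; _:=_; _:+_; _:*_)

    k≡ : + k ≡ + 3 * + toℕ J + + toℕ ρ
    k≡ = cong (_+ + toℕ ρ) (ℤₚ.pos-* 3 (toℕ J))

    offset-suc : ∀ β → + (k ℕ.* repunit (suc β)) ≡ + k * + (9 ℕ.^ β) + + (k ℕ.* repunit β)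
    offset-suc β = trans (cong +_ (ℕₚ.*-distribˡ-+ k (9 ℕ.^ β) (repunit β)))
      (cong (_+ + (k ℕ.* repunit β)) (ℤₚ.pos-* k (9 ℕ.^ β)))

  -- The two claims alternate, odd β from even β and even β+1 from odd β. The odd series is shifted
  -- by J, which is the factor q^J that keeps `basisF` free of negative powers of q.
  p-seriesE : ∀ β n → [ f 1 ^ (3 ℕ.* k) ] (+ (9 ℕ.^ β) * n + + (k ℕ.* repunit β)) ≡ [ seriesE J ρ β ] n
  p-seriesF : ∀ β n → [ f 1 ^ (3 ℕ.* k) ] (+ (9 ℕ.^ β ℕ.* 3) * n + + (k ℕ.* repunit (suc β)))
                      ≡ [ seriesF J ρ β ] (n + + toℕ J)

  p-seriesE zero    n = trans
    (cong [ f 1 ^ (3 ℕ.* k) ] (trans (cong (λ m → + 1 * n + + m) (ℕₚ.*-zeroʳ k)) (trans (ℤₚ.+-identityʳ (+ 1 * n)) (ℤₚ.*-identityˡ n))))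
    (sym ([]-cong (seriesE-zero J ρ 1≤k) n))
  p-seriesE (suc β) n = begin
    [ f 1 ^ (3 ℕ.* k) ] (+ (9 ℕ.* 9 ℕ.^ β) * n + K)
      ≡⟨ cong (λ m → [ f 1 ^ (3 ℕ.* k) ] (m * n + K)) (ℤₚ.pos-* 9 (9 ℕ.^ β)) ⟩
    [ f 1 ^ (3 ℕ.* k) ] (+ 9 * P * n + K)
      ≡⟨ cong [ f 1 ^ (3 ℕ.* k) ] (solve 3 (λ P n K → con (+ 9) :* P :* n :+ K := P :* con (+ 3) :* (con (+ 3) :* n) :+ K) refl P n K) ⟩
    [ f 1 ^ (3 ℕ.* k) ] (P * + 3 * (+ 3 * n) + K)
      ≡⟨ cong (λ m → [ f 1 ^ (3 ℕ.* k) ] (m * (+ 3 * n) + K)) (ℤₚ.pos-* (9 ℕ.^ β) 3) ⟨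
    -- 9^(β+1) n = 3·9^β (3n), and the offset is already that of the odd case. Because of the shift
    -- the index becomes 3n + J, that is, class J.
    [ f 1 ^ (3 ℕ.* k) ] (+ (9 ℕ.^ β ℕ.* 3) * (+ 3 * n) + K)
      ≡⟨ p-seriesF β (+ 3 * n) ⟩
    [ seriesF J ρ β ] (+ 3 * n + + toℕ J)
      ≡⟨ []-δ J (seriesF J ρ β) n ⟩
    [ δ J (seriesF J ρ β) ] n
      ≡⟨ []-cong (δ-seriesF J ρ β) n ⟩
    [ seriesE J ρ (suc β) ] n ∎
    where
    P = + (9 ℕ.^ β)
    K = + (k ℕ.* repunit (suc β))

  p-seriesF β n = begin
    [ f 1 ^ (3 ℕ.* k) ] (+ (9 ℕ.^ β ℕ.* 3) * n + + (k ℕ.* repunit (suc β)))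
      ≡⟨ cong₂ (λ a b → [ f 1 ^ (3 ℕ.* k) ] (a * n + b)) (ℤₚ.pos-* (9 ℕ.^ β) 3) (offset-suc β) ⟩
    [ f 1 ^ (3 ℕ.* k) ] (P * + 3 * n + (+ k * P + K))
      ≡⟨ cong [ f 1 ^ (3 ℕ.* k) ] (solve 4 (λ P n k K → P :* con (+ 3) :* n :+ (k :* P :+ K) := P :* (con (+ 3) :* n :+ k) :+ K) refl P n (+ k) K) ⟩
    [ f 1 ^ (3 ℕ.* k) ] (P * (+ 3 * n + + k) + K)
      ≡⟨ p-seriesE β (+ 3 * n + + k) ⟩
    [ seriesE J ρ β ] (+ 3 * n + + k)
      -- Since k = 3J + ρ, the index 3n + k lies in class ρ at position n + J.
      ≡⟨ cong [ seriesE J ρ β ] (trans (cong (_+_ (+ 3 * n)) k≡)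
           (solve 3 (λ n J r → con (+ 3) :* n :+ (con (+ 3) :* J :+ r) := con (+ 3) :* (n :+ J) :+ r) refl n (+ toℕ J) (+ toℕ ρ))) ⟩
    [ seriesE J ρ β ] (+ 3 * (n + + toℕ J) + + toℕ ρ)
      ≡⟨ []-δ ρ (seriesE J ρ β) (n + + toℕ J) ⟩
    [ δ ρ (seriesE J ρ β) ] (n + + toℕ J)
      ≡⟨ []-cong (δ-seriesE J ρ β) (n + + toℕ J) ⟩
    [ seriesF J ρ β ] (n + + toℕ J) ∎
    where
    P = + (9 ℕ.^ β)
    K = + (k ℕ.* repunit β)

-- Translation into the Laurent series of the theorem

^≡↑ℕ : ∀ a n → a ^ n ≡ a ↑ℕ n
^≡↑ℕ a zero    = refl
^≡↑ℕ a (suc n) = cong (a ⊛_) (^≡↑ℕ a n)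

zpow≡↑ : ∀ a z → zpow a (a ⁻¹) z ≡ a ↑ z
zpow≡↑ a (+ n)    = ^≡↑ℕ a n
zpow≡↑ a -[1+ n ] = ^≡↑ℕ (a ⁻¹) (suc n)

eta-quotient : ℤ → ℤ → PowerSeries
eta-quotient a b = f 1 ↑ a ⊛ f 3 ↑ b

basisE≋ : ∀ J ρ {i} → i ≤ toℕ J → basisE J ρ i ≋ X ^ i ⊛ eta-quotient (+ (3 ℕ.* index J ρ) - + (12 ℕ.* i)) (+ (12 ℕ.* i))
basisE≋ J ρ {i} i≤J = ≋-trans
  (basisE≈ isDissection {f 1} {f 3} {f 1 ⁻¹} {f 3 ⁻¹} f₁-inverse f₃-inverse f₃⇝ δ₁f₁³ δ₂f₁³ norm-f₁ J ρ i≤J)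
  (R.reflexive (cong₂ (λ a b → X ^ i ⊛ (a ⊛ b)) (zpow≡↑ (f 1) (+ (3 ℕ.* index J ρ) - + (12 ℕ.* i))) (zpow≡↑ (f 3) (+ (12 ℕ.* i)))))

basisF≋ : ∀ J ρ {i} → i ≤ toℕ J → basisF J ρ i ≋ X ^ (toℕ J ∸ i) ⊛ eta-quotient (+ (12 ℕ.* i)) (+ (3 ℕ.* index J ρ) - + (12 ℕ.* i))
basisF≋ J ρ {i} i≤J = ≋-trans
  (basisF≈ isDissection {f 1} {f 3} {f 1 ⁻¹} {f 3 ⁻¹} f₁-inverse f₃-inverse f₃⇝ δ₁f₁³ δ₂f₁³ norm-f₁ J ρ i≤J)
  (R.reflexive (cong₂ (λ a b → X ^ (toℕ J ∸ i) ⊛ (a ⊛ b)) (zpow≡↑ (f 1) (+ (12 ℕ.* i))) (zpow≡↑ (f 3) (+ (3 ℕ.* index J ρ) - + (12 ℕ.* i)))))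

[]-combination : ∀ v b K n →
  [ combination v b K ] n ≡ v 0 * [ b 0 ] n + coeff (∑[1⋯ K ] (λ i → v i · fromPowerSeries (b i))) n
[]-combination v b zero    n = trans ([]-⟪⟫ (v 0) (b 0) n) (sym (ℤₚ.+-identityʳ (v 0 * [ b 0 ] n)))
[]-combination v b (suc K) n = trans ([]-⊞ (combination v b K) (⟪ v (suc K) ⟫ ⊛ b (suc K)) n)
  (trans (cong₂ _+_ ([]-combination v b K n) ([]-⟪⟫ (v (suc K)) (b (suc K)) n))
    (ℤₚ.+-assoc (v 0 * [ b 0 ] n) (coeff (∑[1⋯ K ] (λ i → v i · fromPowerSeries (b i))) n) (v (suc K) * [ b (suc K) ] n)))

∑-cong : ∀ x y K m n → (∀ {i} → suc i ≤ K → coeff (x (suc i)) m ≡ coeff (y (suc i)) n) →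
         coeff (∑[1⋯ K ] x) m ≡ coeff (∑[1⋯ K ] y) n
∑-cong x y zero    m n eq = refl
∑-cong x y (suc K) m n eq = cong₂ _+_ (∑-cong x y K m n (λ i≤K → eq (ℕₚ.m≤n⇒m≤1+n i≤K))) (eq ℕₚ.≤-refl)

-- ⌊k/3⌋ is abstracted to m so that k can stay a variable: at a numeral k,
-- conversion checking would unfold the powers of f 1 and f 3.
Identity : ℕ → ℕ → ℕ → Set
Identity β k m =
    ( ∑[ 0ℤ ⋯∞] (λ n → p (+ (3 ℕ.* k)) (+ (3 ℕ.^ (2 ℕ.* β)) * n + + (k ℕ.* (3 ℕ.^ (2 ℕ.* β) ∸ 1) / 8)))
    ≈ C k (2 ℕ.* β) · fromPowerSeries (f 1 ↑ (+ (3 ℕ.* k)))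
    ⊕ ∑[1⋯ m ] (λ i → D k i (2 ℕ.* β) · q^ (+ i) · fromPowerSeries (f 1 ↑ (+ (3 ℕ.* k) - + (12 ℕ.* i)) ⊛ f 3 ↑ (+ (12 ℕ.* i)))) )
    × ( ∑[ - (+ m) ⋯∞] (λ n → p (+ (3 ℕ.* k)) (+ (3 ℕ.^ (2 ℕ.* β ℕ.+ 1)) * n + + (k ℕ.* (3 ℕ.^ (2 ℕ.* β ℕ.+ 2) ∸ 1) / 8)))
    ≈ C k (2 ℕ.* β ℕ.+ 1) · fromPowerSeries (f 3 ↑ (+ (3 ℕ.* k)))
    ⊕ ∑[1⋯ m ] (λ i → D k i (2 ℕ.* β ℕ.+ 1) · q^ (- (+ i)) · fromPowerSeries (f 1 ↑ (+ (12 ℕ.* i)) ⊛ f 3 ↑ (+ (3 ℕ.* k) - + (12 ℕ.* i)))) )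

module _ (J ρ : Fin 3) where
  private
    k : ℕ
    k = index J ρ
    open ≡.≡-Reasoning

  []-seriesE : ∀ β n → [ seriesE J ρ β ] n ≡ coeff (C k (2 ℕ.* β) · fromPowerSeries (f 1 ↑ (+ (3 ℕ.* k)))
    ⊕ ∑[1⋯ toℕ J ] (λ i → D k i (2 ℕ.* β) · q^ (+ i) · fromPowerSeries (eta-quotient (+ (3 ℕ.* k) - + (12 ℕ.* i)) (+ (12 ℕ.* i))))) n
  []-seriesE β n = trans ([]-combination v (basisE J ρ) (toℕ J) n)
    (cong₂ _+_ (cong₂ _*_ (cong (C k) β2) leading) (∑-cong _ _ (toℕ J) n n term))
    where
    v = coefficients J ρ (β ℕ.* 2)
    β2 : β ℕ.* 2 ≡ 2 ℕ.* β
    β2 = ℕₚ.*-comm β 2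
    leading : [ basisE J ρ 0 ] n ≡ [ f 1 ↑ (+ (3 ℕ.* k)) ] n
    leading = []-cong (≋-trans (basisE-zero′ J ρ) (R.reflexive (^≡↑ℕ (f 1) (3 ℕ.* k)))) n
    term : ∀ {i} → suc i ≤ toℕ J → v (suc i) * [ basisE J ρ (suc i) ] n
           ≡ D k (suc i) (2 ℕ.* β) * [ eta-quotient (+ (3 ℕ.* k) - + (12 ℕ.* suc i)) (+ (12 ℕ.* suc i)) ] (n - + suc i)
    term {i} i<J = cong₂ _*_ (cong (D k (suc i)) β2)
      (trans ([]-cong (basisE≋ J ρ i<J) n) ([]-X^ (suc i) (eta-quotient (+ (3 ℕ.* k) - + (12 ℕ.* suc i)) (+ (12 ℕ.* suc i))) n))

  []-seriesF : ∀ β n → [ seriesF J ρ β ] (n + + toℕ J) ≡ coeff (C k (2 ℕ.* β ℕ.+ 1) · fromPowerSeries (f 3 ↑ (+ (3 ℕ.* k)))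
    ⊕ ∑[1⋯ toℕ J ] (λ i → D k i (2 ℕ.* β ℕ.+ 1) · q^ (- (+ i)) · fromPowerSeries (eta-quotient (+ (12 ℕ.* i)) (+ (3 ℕ.* k) - + (12 ℕ.* i))))) n
  []-seriesF β n = trans ([]-combination v (basisF J ρ) (toℕ J) (n + + toℕ J))
    (cong₂ _+_ (cong₂ _*_ (cong (C k) β2) leading) (∑-cong _ _ (toℕ J) (n + + toℕ J) n term))
    where
    v = coefficients J ρ (suc (β ℕ.* 2))
    β2 : suc (β ℕ.* 2) ≡ 2 ℕ.* β ℕ.+ 1
    β2 = trans (cong suc (ℕₚ.*-comm β 2)) (ℕₚ.+-comm 1 (2 ℕ.* β))
    -- Undoing the shift by J turns the factor q^(J-i) of `basisF` into q^(-i).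
    basis : ∀ {i} → i ≤ toℕ J → [ basisF J ρ i ] (n + + toℕ J)
            ≡ [ eta-quotient (+ (12 ℕ.* i)) (+ (3 ℕ.* k) - + (12 ℕ.* i)) ] (n - - (+ i))
    basis {i} i≤J = trans ([]-cong (basisF≋ J ρ i≤J) (n + + toℕ J))
      (trans ([]-X^ (toℕ J ∸ i) (eta-quotient (+ (12 ℕ.* i)) (+ (3 ℕ.* k) - + (12 ℕ.* i))) (n + + toℕ J))
        (cong [ eta-quotient (+ (12 ℕ.* i)) (+ (3 ℕ.* k) - + (12 ℕ.* i)) ] (begin
          n + + toℕ J - + (toℕ J ∸ i)                ≡⟨ cong (λ m → n + + m - + (toℕ J ∸ i)) (ℕₚ.m+[n∸m]≡n i≤J) ⟨
          n + (+ i + + (toℕ J ∸ i)) - + (toℕ J ∸ i)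
            ≡⟨ solve 3 (λ n i d → n :+ (i :+ d) :- d := n :- :- i) refl n (+ i) (+ (toℕ J ∸ i)) ⟩
          n - - (+ i) ∎)))
      where open ℤSolver
    leading : [ basisF J ρ 0 ] (n + + toℕ J) ≡ [ f 3 ↑ (+ (3 ℕ.* k)) ] n
    leading = trans (basis z≤n) (trans (cong [ eta-quotient (+ 0) (+ (3 ℕ.* k) - + 0) ] (ℤₚ.+-identityʳ n))
      (trans ([]-cong (⊛-identityˡ (f 3 ↑ (+ (3 ℕ.* k) - + 0))) n)
        (cong (λ e → [ f 3 ↑ e ] n) (ℤₚ.+-identityʳ (+ (3 ℕ.* k))))))
    term : ∀ {i} → suc i ≤ toℕ J → v (suc i) * [ basisF J ρ (suc i) ] (n + + toℕ J)
           ≡ D k (suc i) (2 ℕ.* β ℕ.+ 1) * [ eta-quotient (+ (12 ℕ.* suc i)) (+ (3 ℕ.* k) - + (12 ℕ.* suc i)) ] (n - - (+ suc i))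
    term {i} i<J = cong₂ _*_ (cong (D k (suc i)) β2) (basis i<J)

  3^2β : ∀ β → 3 ℕ.^ (2 ℕ.* β) ≡ 9 ℕ.^ β
  3^2β β = sym (ℕₚ.^-*-assoc 3 2 β)

  3^2β+1 : ∀ β → 3 ℕ.^ (2 ℕ.* β ℕ.+ 1) ≡ 9 ℕ.^ β ℕ.* 3
  3^2β+1 β = trans (ℕₚ.^-distribˡ-+-* 3 (2 ℕ.* β) 1) (cong (ℕ._* 3) (3^2β β))

  3^2β+2 : ∀ β → 3 ℕ.^ (2 ℕ.* β ℕ.+ 2) ≡ 9 ℕ.^ suc β
  3^2β+2 β = trans (ℕₚ.^-distribˡ-+-* 3 (2 ℕ.* β) 2) (trans (cong (ℕ._* 9) (3^2β β)) (ℕₚ.*-comm (9 ℕ.^ β) 9))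

  dissection-identity : 1 ≤ k → ∀ β → Identity β k (toℕ J)
  dissection-identity 1≤k β =
      (λ n → trans (truncate 0ℤ (λ n → p (+ (3 ℕ.* k)) (+ (3 ℕ.^ (2 ℕ.* β)) * n + + (k ℕ.* (3 ℕ.^ (2 ℕ.* β) ∸ 1) / 8)))
               [ seriesE J ρ β ] ([]-neg (seriesE J ρ β)) p-even n) ([]-seriesE β n))
    , (λ n → trans (truncate (- (+ toℕ J)) (λ n → p (+ (3 ℕ.* k)) (+ (3 ℕ.^ (2 ℕ.* β ℕ.+ 1)) * n + + (k ℕ.* (3 ℕ.^ (2 ℕ.* β ℕ.+ 2) ∸ 1) / 8)))
               (λ n → [ seriesF J ρ β ] (n + + toℕ J)) negative p-odd n) ([]-seriesF β n))
    where
    p≡ : ∀ n → p (+ (3 ℕ.* k)) n ≡ [ f 1 ^ (3 ℕ.* k) ] n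
    p≡ n = cong (λ a → [ a ] n) (sym (^≡↑ℕ (f 1) (3 ℕ.* k)))
    p-even : ∀ n → p (+ (3 ℕ.* k)) (+ (3 ℕ.^ (2 ℕ.* β)) * n + + (k ℕ.* (3 ℕ.^ (2 ℕ.* β) ∸ 1) / 8)) ≡ [ seriesE J ρ β ] n
    p-even n = begin
      p (+ (3 ℕ.* k)) (+ (3 ℕ.^ (2 ℕ.* β)) * n + + (k ℕ.* (3 ℕ.^ (2 ℕ.* β) ∸ 1) / 8))
        ≡⟨ cong (λ m → p (+ (3 ℕ.* k)) (+ m * n + + (k ℕ.* (m ∸ 1) / 8))) (3^2β β) ⟩
      p (+ (3 ℕ.* k)) (+ (9 ℕ.^ β) * n + + (k ℕ.* (9 ℕ.^ β ∸ 1) / 8))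
        ≡⟨ cong (λ m → p (+ (3 ℕ.* k)) (+ (9 ℕ.^ β) * n + + m)) (offset k β) ⟩
      p (+ (3 ℕ.* k)) (+ (9 ℕ.^ β) * n + + (k ℕ.* repunit β))
        ≡⟨ p≡ (+ (9 ℕ.^ β) * n + + (k ℕ.* repunit β)) ⟩
      [ f 1 ^ (3 ℕ.* k) ] (+ (9 ℕ.^ β) * n + + (k ℕ.* repunit β))
        ≡⟨ p-seriesE J ρ 1≤k β n ⟩
      [ seriesE J ρ β ] n ∎
    p-odd : ∀ n → p (+ (3 ℕ.* k)) (+ (3 ℕ.^ (2 ℕ.* β ℕ.+ 1)) * n + + (k ℕ.* (3 ℕ.^ (2 ℕ.* β ℕ.+ 2) ∸ 1) / 8))
            ≡ [ seriesF J ρ β ] (n + + toℕ J)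
    p-odd n = begin
      p (+ (3 ℕ.* k)) (+ (3 ℕ.^ (2 ℕ.* β ℕ.+ 1)) * n + + (k ℕ.* (3 ℕ.^ (2 ℕ.* β ℕ.+ 2) ∸ 1) / 8))
        ≡⟨ cong₂ (λ a b → p (+ (3 ℕ.* k)) (+ a * n + + (k ℕ.* (b ∸ 1) / 8))) (3^2β+1 β) (3^2β+2 β) ⟩
      p (+ (3 ℕ.* k)) (+ (9 ℕ.^ β ℕ.* 3) * n + + (k ℕ.* (9 ℕ.^ suc β ∸ 1) / 8))
        ≡⟨ cong (λ m → p (+ (3 ℕ.* k)) (+ (9 ℕ.^ β ℕ.* 3) * n + + m)) (offset k (suc β)) ⟩
      p (+ (3 ℕ.* k)) (+ (9 ℕ.^ β ℕ.* 3) * n + + (k ℕ.* repunit (suc β)))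
        ≡⟨ p≡ (+ (9 ℕ.^ β ℕ.* 3) * n + + (k ℕ.* repunit (suc β))) ⟩
      [ f 1 ^ (3 ℕ.* k) ] (+ (9 ℕ.^ β ℕ.* 3) * n + + (k ℕ.* repunit (suc β)))
        ≡⟨ p-seriesF J ρ 1≤k β n ⟩
      [ seriesF J ρ β ] (n + + toℕ J) ∎
    -- The lower summation limit discards nothing, since all coefficients below it vanish.
    truncate : ∀ m (t z : ℤ → ℤ) → (∀ n → n ℤ.< m → z n ≡ 0ℤ) → (∀ n → t n ≡ z n) → ∀ n → coeff (∑[ m ⋯∞] t) n ≡ z n
    truncate m t z neg eq n with m ℤₚ.≤? n
    ... | yes _   = eq n
    ... | no  m≰n = sym (neg n (ℤₚ.≰⇒> m≰n))
    negative : ∀ n → n ℤ.< - (+ toℕ J) → [ seriesF J ρ β ] (n + + toℕ J) ≡ 0ℤ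
    negative n n<-J = []-neg (seriesF J ρ β) (n + + toℕ J)
      (≡.subst (n + + toℕ J ℤ.<_) (ℤₚ.+-inverseˡ (+ toℕ J)) (ℤₚ.+-monoˡ-< (+ toℕ J) n<-J))
divide : ∀ k → k ≤ 8 → ∃ λ J → ∃ λ ρ → index J ρ ≡ k × toℕ J ≡ k / 3
divide 0 _ = 0F , 0F , refl , refl
divide 1 _ = 0F , 1F , refl , refl
divide 2 _ = 0F , 2F , refl , refl
divide 3 _ = 1F , 0F , refl , refl
divide 4 _ = 1F , 1F , refl , refl
divide 5 _ = 1F , 2F , refl , refl
divide 6 _ = 2F , 0F , refl , refl
divide 7 _ = 2F , 1F , refl , refl
divide 8 _ = 2F , 2F , refl , refl
divide (suc (suc (suc (suc (suc (suc (suc (suc (suc k))))))))) (s≤s (s≤s (s≤s (s≤s (s≤s (s≤s (s≤s (s≤s ()))))))))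

theorem1p2 : (β k : ℕ) → 1 ≤ k → k ≤ 8 →
    ( ∑[ 0ℤ ⋯∞] (λ n → p (+ (3 ℕ.* k)) (+ (3 ℕ.^ (2 ℕ.* β)) * n + + (k ℕ.* (3 ℕ.^ (2 ℕ.* β) ∸ 1) / 8)))
    ≈ C k (2 ℕ.* β) · fromPowerSeries (f 1 ↑ (+ (3 ℕ.* k)))
    ⊕ ∑[1⋯ k / 3 ] (λ i → D k i (2 ℕ.* β) · q^ (+ i) · fromPowerSeries (f 1 ↑ (+ (3 ℕ.* k) - + (12 ℕ.* i)) ⊛ f 3 ↑ (+ (12 ℕ.* i)))) )
    × ( ∑[ - (+ (k / 3)) ⋯∞] (λ n → p (+ (3 ℕ.* k)) (+ (3 ℕ.^ (2 ℕ.* β ℕ.+ 1)) * n + + (k ℕ.* (3 ℕ.^ (2 ℕ.* β ℕ.+ 2) ∸ 1) / 8)))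
    ≈ C k (2 ℕ.* β ℕ.+ 1) · fromPowerSeries (f 3 ↑ (+ (3 ℕ.* k)))
    ⊕ ∑[1⋯ k / 3 ] (λ i → D k i (2 ℕ.* β ℕ.+ 1) · q^ (- (+ i)) · fromPowerSeries (f 1 ↑ (+ (12 ℕ.* i)) ⊛ f 3 ↑ (+ (3 ℕ.* k) - + (12 ℕ.* i)))) )
theorem1p2 β k 1≤k k≤8 with J , ρ , k≡ , J≡ ← divide k k≤8 =
  ≡.subst₂ (Identity β) k≡ J≡ (dissection-identity J ρ (≡.subst (1 ≤_) (sym k≡) 1≤k) β)
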